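{- There are $k\in\mathbb{N}$ and a function $f\in O(\log n)$ such that for every $n\in\mathbb{N}$ and every chordal claw-free graph $G$ of order $n$ there is a $\mathsf{C}^k$-sentence $\Phi^G$ over the vocabulary $\{E\}$ of quantifier depth at most $f(n)$ that describes $G$ up to isomorphism, i.e., for every graph $H$: $H\models\Phi^G$ iff $H\cong G$.
   Context: Graphs are $\{E\}$-structures with $E$ binary; undirected graphs have symmetric irreflexive $E$. An undirected graph is chordal if every cycle of length at least $4$ has a chord, and claw-free if it has no induced subgraph isomorphic to $K_{1,3}$. The order of a graph is its number of vertices. $\mathsf{C}$ is first-order logic extended by counting quantifiers $\exists^{\ge m}x\,\psi$ for all $m\in\mathbb{N}$; $\mathsf{C}^k$ is its fragment using only the variables $x_1,\dots,x_k$ (reusable); quantifier depth is the maximal nesting depth of quantifiers. -}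

module Defs where

open import Data.Nat using (ℕ; zero; suc; _+_; _*_; _≤_; _≥_; _≤ᵇ_)
open import Data.Nat.Logarithm using (⌈log₂_⌉)
open import Data.Fin using (Fin; toℕ; _≟_)
open import Data.Bool using (Bool; true; false; not; _∧_; _∨_; if_then_else_)
open import Data.Maybe using (Maybe; just; nothing)
open import Data.List using (List; length; filterᵇ; allFin)
open import Data.Product using (Σ; _×_; _,_; ∃)
open import Relation.Binary.PropositionalEquality using (_≡_; _≢_)
open import Relation.Nullary using (¬_; does)
open import Function.Bundles using (_↔_; Inverse)

record Graph : Set where
  field
    order : ℕ
    E     : Fin order → Fin order → Bool

open Graph public

Adj : (G : Graph) → Fin (order G) → Fin (order G) → Set
Adj G u v = E G u v ≡ true

Undirected : Graph → Set
Undirected G = (∀ u v → E G u v ≡ E G v u) × (∀ u → E G u u ≡ false)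

Consecutive : ∀ {l} → Fin l → Fin l → Set
Consecutive {l} i j =
  (suc (toℕ i) ≡ toℕ j) Data.Sum.⊎ (suc (toℕ j) ≡ toℕ i)
  Data.Sum.⊎ ((toℕ i ≡ 0 × suc (toℕ j) ≡ l) Data.Sum.⊎ (toℕ j ≡ 0 × suc (toℕ i) ≡ l))
  where import Data.Sum

record Cycle (G : Graph) (l : ℕ) : Set where
  field
    vtx      : Fin l → Fin (order G)
    injective : ∀ i j → vtx i ≡ vtx j → i ≡ j
    edges    : ∀ i j → Consecutive i j → Adj G (vtx i) (vtx j)

HasChord : ∀ {G l} → Cycle G l → Set
HasChord {G} {l} c = Σ (Fin l) λ i → Σ (Fin l) λ j →
  ¬ Consecutive i j × i ≢ j × Adj G (Cycle.vtx c i) (Cycle.vtx c j)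

Chordal : Graph → Set
Chordal G = ∀ l → 4 ≤ l → (c : Cycle G l) → HasChord c

ClawFree : Graph → Set
ClawFree G = ¬ (Σ (Fin (order G)) λ z → Σ (Fin (order G)) λ a →
  Σ (Fin (order G)) λ b → Σ (Fin (order G)) λ d →
    (z ≢ a × z ≢ b × z ≢ d × a ≢ b × a ≢ d × b ≢ d)
  × (Adj G z a × Adj G z b × Adj G z d
     × Adj G a z × Adj G b z × Adj G d z)
  × (E G a b ≡ false × E G b a ≡ false × E G a d ≡ false
     × E G d a ≡ false × E G b d ≡ false × E G d b ≡ false))

_≅_ : Graph → Graph → Set
H ≅ G = Σ (Fin (order H) ↔ Fin (order G)) λ f →
  ∀ u v → E H u v ≡ E G (Inverse.to f u) (Inverse.to f v)

data Formula (k : ℕ) : Set where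
  rel    : Fin k → Fin k → Formula k
  eq     : Fin k → Fin k → Formula k
  neg    : Formula k → Formula k
  conj   : Formula k → Formula k → Formula k
  disj   : Formula k → Formula k → Formula k
  cnt    : ℕ → Fin k → Formula k → Formula k

qd : ∀ {k} → Formula k → ℕ
qd (rel x y)    = 0
qd (eq x y)     = 0
qd (neg φ)      = qd φ
qd (conj φ ψ)   = Data.Nat._⊔_ (qd φ) (qd ψ)
qd (disj φ ψ)   = Data.Nat._⊔_ (qd φ) (qd ψ)
qd (cnt m x φ)  = suc (qd φ)

free : ∀ {k} → Formula k → Fin k → Bool
free (rel x y)   z = does (x ≟ z) ∨ does (y ≟ z)
free (eq x y)    z = does (x ≟ z) ∨ does (y ≟ z)
free (neg φ)     z = free φ z
free (conj φ ψ)  z = free φ z ∨ free ψ z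
free (disj φ ψ)  z = free φ z ∨ free ψ z
free (cnt m x φ) z = not (does (x ≟ z)) ∧ free φ z

Sentence : ∀ {k} → Formula k → Set
Sentence φ = ∀ z → free φ z ≡ false

-- semantics w.r.t. partial assignments (only relevant for free variables)
Assignment : ℕ → Graph → Set
Assignment k G = Fin k → Maybe (Fin (order G))

update : ∀ {k G} → Assignment k G → Fin k → Fin (order G) → Assignment k G
update ρ x v y = if does (x ≟ y) then just v else ρ y

eval : ∀ {k} (G : Graph) → Formula k → Assignment k G → Bool
eval G (rel x y) ρ with ρ x | ρ y
... | just u | just v = E G u v
... | _      | _      = false
eval G (eq x y) ρ with ρ x | ρ y
... | just u | just v = does (u ≟ v)
... | _      | _      = false
eval G (neg φ) ρ      = not (eval G φ ρ)
eval G (conj φ ψ) ρ   = eval G φ ρ ∧ eval G ψ ρ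
eval G (disj φ ψ) ρ   = eval G φ ρ ∨ eval G ψ ρ
eval G (cnt m x φ) ρ  =
  m ≤ᵇ length (filterᵇ (λ v → eval G φ (update {G = G} ρ x v)) (allFin (order G)))

emptyAssignment : ∀ {k} {G : Graph} → Assignment k G
emptyAssignment _ = nothing

_⊨_ : ∀ {k} → Graph → Formula k → Set
H ⊨ φ = eval H φ (emptyAssignment {G = H}) ≡ true

IsOLog : (ℕ → ℕ) → Set
IsOLog f = Σ ℕ λ c → Σ ℕ λ N → ∀ n → N ≤ n → f n ≤ c * ⌈log₂ n ⌉

{-# OPTIONS --safe #-}

module Submission where

open import Defs
open import Data.Nat using (ℕ; zero; suc; _+_; _*_; _^_; _≤_; _<_; _≤ᵇ_; _≡ᵇ_; z≤n; s≤s; ⌈_/2⌉)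
open import Data.Nat.Properties hiding (_≟_)
open import Data.Nat.Induction using (<-wellFounded)
open import Data.Nat.Logarithm using (⌈log₂_⌉; ⌈log₂⌉-mono-≤)
open import Data.Nat.Logarithm.Core using (⌈log2⌉)
open import Data.Nat.Tactic.RingSolver using (solve-∀)
open import Data.Fin using (Fin; zero; suc; toℕ; _≟_; fromℕ<; inject≤; punchOut)
open import Data.Fin.Patterns
open import Data.Fin.Properties using (any?)
import Data.Fin.Properties as Fin
open import Data.Fin.Permutation as Perm using (Permutation; Permutation′; permutation; _⟨$⟩ʳ_; _⟨$⟩ˡ_; inverseˡ; inverseʳ; _∘ₚ_; ↔⇒≡)
open import Data.Bool using (Bool; true; false; not; _∧_; _∨_; if_then_else_)
import Data.Bool as Bool
import Data.Bool.Properties as Bool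
open import Data.Maybe using (just)
open import Data.List using (List; []; _∷_; length; filterᵇ; allFin; tabulate)
import Data.List as List
open import Data.List.Properties using (length-tabulate)
open import Data.List.Relation.Unary.All as All using (All; []; _∷_)
open import Data.List.Relation.Unary.Any using (here; there)
open import Data.List.Membership.Propositional using () renaming (_∈_ to _∈ₗ_)
open import Data.List.Membership.Propositional.Properties using (∈-allFin)
open import Data.Vec using (Vec; []; _∷_; lookup; map)
open import Data.Vec.Properties using (lookup-map)
open import Data.Product using (Σ; _×_; _,_; ∃; proj₁; proj₂)
open import Data.Sum using (_⊎_; inj₁; inj₂)
open import Data.Empty using (⊥; ⊥-elim)
open import Data.Unit using (⊤; tt)
open import Algebra.Properties.CommutativeMonoid.Sum +-0-commutativeMonoid using (sum; sum-permute; sum-cong-≗; ∑-distrib-+)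
open import Function using (_∘_; Inverse)
open import Induction.WellFounded using (Acc; acc)
open import Relation.Nullary using (yes; no; does; ¬?; _×-dec_; _→-dec_)
open import Relation.Nullary.Decidable using (True; toWitness)
open import Relation.Binary.PropositionalEquality

-- A "part" is a component X of the complement of a clique S, where S is the common neighbourhood of two
-- vertices p ∉ X and q ∈ X. The vertices of X adjacent to all of S form a set A such that S ∪ A is a maximal
-- clique, and each component of X ∖ A is again a part, a child of X (chordality provides its vertex q).
-- Claw-freeness leaves three ways in which the children can be attached to S ∪ A: with disjoint boundaries
-- inside A, or a single child whose boundary contains A, or two children each of which is seen uniformly by
-- its boundary. In every case isomorphisms of the children that preserve degrees in the whole graph can be
-- glued. Membership in a part is reachability, hence of logarithmic quantifier depth. Children are at most
-- half as large except along a chain of heavy ones; the members of such a chain are determined by their size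
-- alone, so they can be pebbled independently of each other, and the chain costs a bounded number of rounds.


-- Finite sets and permutations

-- Isomorphisms of different children may disagree on shared boundary vertices, and each may permute
-- its own boundary; gluing has to survive this. Disjoint boundaries cause no conflict. If a single
-- child has a boundary containing `A`, its isomorphism might exchange vertices of `A` with vertices
-- of `S`; the degree in the whole graph forbids it, since vertices of `S` also see `p`. If two
-- children are seen uniformly, their isomorphisms are kept on the interiors only, and the boundary
-- follows Duplicator's bijection. The depth rests on two economies. Reachability is never nested
-- along the recursion: its rounds form a reserve of `t + suc t` at the end of the game that every
-- part uses again, so halving the size costs a constant. Along a heavy chain, an answer given
-- relative to the previous member would lose rounds at each link; two independent answers to one
-- member are shown instead to define the same set in the second graph. That second graph is
-- arbitrary: structure is proved for the chordal claw-free graph only and read off in the other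
-- through the game.

infix 4 _∈_ _∉_ _==_

_∈_ _∉_ : ∀ {A : Set} → A → (A → Bool) → Set
x ∈ P = P x ≡ true
x ∉ P = P x ≡ false

split : ∀ b → b ≡ true ⊎ b ≡ false
split true  = inj₁ refl
split false = inj₂ refl

clash : ∀ {ℓ} {C : Set ℓ} {b} → b ≡ true → b ≡ false → C
clash refl ()

≢true⇒false : ∀ {b} → (b ≡ true → ⊥) → b ≡ false
≢true⇒false {true}  h = ⊥-elim (h refl)
≢true⇒false {false} _ = refl

Bool-ext : ∀ {a b} → (a ≡ true → b ≡ true) → (b ≡ true → a ≡ true) → a ≡ b
Bool-ext {true}  {b}     f g = sym (f refl)
Bool-ext {false} {true}  f g = g refl
Bool-ext {false} {false} f g = refl

∧-elim : ∀ {a b} → a ∧ b ≡ true → a ≡ true × b ≡ true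
∧-elim {true} h = refl , h

∧-intro : ∀ {a b} → a ≡ true → b ≡ true → a ∧ b ≡ true
∧-intro refl h = h

∨-elim : ∀ {a b} → a ∨ b ≡ true → a ≡ true ⊎ b ≡ true
∨-elim {true}  h = inj₁ refl
∨-elim {false} h = inj₂ h

∨-introˡ : ∀ {a b} → a ≡ true → a ∨ b ≡ true
∨-introˡ refl = refl

∨-introʳ : ∀ {a b} → b ≡ true → a ∨ b ≡ true
∨-introʳ {true}  _ = refl
∨-introʳ {false} h = h

∨-false : ∀ {a b} → a ≡ false → b ≡ false → a ∨ b ≡ false
∨-false refl h = h

not-elim : ∀ {a} → not a ≡ true → a ≡ false
not-elim {false} _ = refl

not-intro : ∀ {a} → a ≡ false → not a ≡ true
not-intro refl = refl

not-false : ∀ {a} → not a ≡ false → a ≡ true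
not-false {true} _ = refl

imp : Bool → Bool → Bool
imp a b = not a ∨ b

imp-elim : ∀ {a b} → imp a b ≡ true → a ≡ true → b ≡ true
imp-elim h refl = h

imp-intro : ∀ {a b} → (a ≡ true → b ≡ true) → imp a b ≡ true
imp-intro {true}  h = h refl
imp-intro {false} h = refl

iff : Bool → Bool → Bool
iff a b = does (a Bool.≟ b)

iff-elim : ∀ {a b} → iff a b ≡ true → a ≡ b
iff-elim {true}  {true}  _ = refl
iff-elim {false} {false} _ = refl

iff-intro : ∀ {a b} → a ≡ b → iff a b ≡ true
iff-intro {true}  refl = refl
iff-intro {false} refl = refl

opaque
  _==_ : ∀ {n} → Fin n → Fin n → Bool
  x == y = does (x ≟ y)

  ==-refl : ∀ {n} {x : Fin n} → (x == x) ≡ true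
  ==-refl {x = x} with x ≟ x
  ... | yes _ = refl
  ... | no ne = ⊥-elim (ne refl)

  ==-elim : ∀ {n} {x y : Fin n} → (x == y) ≡ true → x ≡ y
  ==-elim {x = x} {y} h with x ≟ y
  ... | yes e = e

  ==-false : ∀ {n} {x y : Fin n} → x ≢ y → (x == y) ≡ false
  ==-false {x = x} {y} ne with x ≟ y
  ... | yes e = ⊥-elim (ne e)
  ... | no _  = refl

==-≢ : ∀ {n} {x y : Fin n} → (x == y) ≡ false → x ≢ y
==-≢ {x = x} h refl = clash (==-refl {x = x}) h

module _ {n : ℕ} where

  opaque
    ∃ᵇ : (Fin n → Bool) → Bool
    ∃ᵇ P = does (any? (λ i → P i Bool.≟ true))

    ∃ᵇ-elim : ∀ {P} → ∃ᵇ P ≡ true → ∃ λ i → P i ≡ true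
    ∃ᵇ-elim {P} h with any? (λ i → P i Bool.≟ true)
    ... | yes w = w

    ∃ᵇ-intro : ∀ {P} i → P i ≡ true → ∃ᵇ P ≡ true
    ∃ᵇ-intro {P} i p with any? (λ i → P i Bool.≟ true)
    ... | yes _ = refl
    ... | no ¬w = ⊥-elim (¬w (i , p))

  ∃ᵇ-false : ∀ {P} → ∃ᵇ P ≡ false → ∀ i → P i ≡ false
  ∃ᵇ-false h i = ≢true⇒false λ p → clash (∃ᵇ-intro i p) h

  opaque
    ∀ᵇ : (Fin n → Bool) → Bool
    ∀ᵇ P = not (∃ᵇ (λ i → not (P i)))

    ∀ᵇ-elim : ∀ {P} → ∀ᵇ P ≡ true → ∀ i → P i ≡ true
    ∀ᵇ-elim h i = not-false (∃ᵇ-false (not-elim h) i)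

    ∀ᵇ-intro : ∀ {P} → (∀ i → P i ≡ true) → ∀ᵇ P ≡ true
    ∀ᵇ-intro p = not-intro (≢true⇒false λ h → let i , q = ∃ᵇ-elim h in clash (p i) (not-elim q))

    ∀ᵇ-counter : ∀ {P} → ∀ᵇ P ≡ false → ∃ λ i → P i ≡ false
    ∀ᵇ-counter h = let i , q = ∃ᵇ-elim (not-false h) in i , not-elim q

bit : Bool → ℕ
bit b = if b then 1 else 0

opaque
  count : ∀ {n} → (Fin n → Bool) → ℕ
  count P = sum (λ i → bit (P i))

  count-cong : ∀ {n} {P Q : Fin n → Bool} → (∀ i → P i ≡ Q i) → count P ≡ count Q
  count-cong h = sum-cong-≗ (λ i → cong bit (h i))

  count-perm : ∀ {m n} (P : Fin n → Bool) (π : Permutation m n) → count (λ i → P (π ⟨$⟩ʳ i)) ≡ count P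
  count-perm P π = sym (sum-permute (bit ∘ P) π)

  count-split : ∀ {n} (P Q : Fin n → Bool) → count P ≡ count (λ i → P i ∧ Q i) + count (λ i → P i ∧ not (Q i))
  count-split P Q = trans (sum-cong-≗ (λ i → bits (P i) (Q i))) (∑-distrib-+ (λ i → bit (P i ∧ Q i)) (λ i → bit (P i ∧ not (Q i))))
    where
    bits : ∀ a b → bit a ≡ bit (a ∧ b) + bit (a ∧ not b)
    bits true  true  = refl
    bits true  false = refl
    bits false _     = refl

  bit-mono : ∀ {a b} → (a ≡ true → b ≡ true) → bit a ≤ bit b
  bit-mono {false} f = z≤n
  bit-mono {true}  f rewrite f refl = ≤-refl

  count-mono : ∀ {n} {P Q : Fin n → Bool} → (∀ i → P i ≡ true → Q i ≡ true) → count P ≤ count Q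
  count-mono {zero}      h = z≤n
  count-mono {suc n} {P} {Q} h = +-mono-≤ (bit-mono (h zero)) (count-mono (h ∘ suc))

  count-strict : ∀ {n} {P Q : Fin n → Bool} → (∀ i → P i ≡ true → Q i ≡ true) → ∀ i → Q i ≡ true → P i ≡ false → count P < count Q
  count-strict {suc n} {P} {Q} h zero q p rewrite p | q = s≤s (count-mono (h ∘ suc))
  count-strict {suc n} {P} {Q} h (suc i) q p = +-mono-≤-< (bit-mono (h zero)) (count-strict (h ∘ suc) i q p)

  count-ones : ∀ n → count {n} (λ _ → true) ≡ n
  count-ones zero    = refl
  count-ones (suc n) = cong suc (count-ones n)

  count-zeros : ∀ {n} {P : Fin n → Bool} → (∀ i → P i ≡ false) → count P ≡ 0
  count-zeros {zero}  h = refl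
  count-zeros {suc n} h rewrite h zero = count-zeros (h ∘ suc)

  count-single : ∀ {n} (x : Fin n) {Q : Fin n → Bool} → Q x ≡ true → (∀ y → Q y ≡ true → x ≡ y) → count Q ≡ 1
  count-single {suc n} zero {Q} q u rewrite q = cong suc (count-zeros λ y → ≢true⇒false λ h → Fin.0≢1+n (u (suc y) h))
  count-single {suc n} (suc x) {Q} q u with Q zero in e
  ... | true  = ⊥-elim (Fin.0≢1+n (sym (u zero e)))
  ... | false = count-single x q λ y h → Fin.suc-injective (u (suc y) h)

count-pos : ∀ {n} {P : Fin n → Bool} i → P i ≡ true → 0 < count P
count-pos {P = P} i p = ≤-<-trans z≤n (count-strict {P = λ _ → false} (λ _ ()) i p refl)

count-≡⇒⊆ : ∀ {n} {P Q : Fin n → Bool} → (∀ i → P i ≡ true → Q i ≡ true) → count P ≡ count Q → ∀ i → Q i ≡ true → P i ≡ true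
count-≡⇒⊆ {P = P} h e i q with split (P i)
... | inj₁ p = p
... | inj₂ p = ⊥-elim (<-irrefl e (count-strict h i q p))

count≤n : ∀ {n} (P : Fin n → Bool) → count P ≤ n
count≤n {n} P = subst (count P ≤_) (count-ones n) (count-mono (λ _ _ → refl))

count-disjoint : ∀ {n} {P Q R : Fin n → Bool} → (∀ i → P i ≡ true → R i ≡ true × Q i ≡ false) → (∀ i → Q i ≡ true → R i ≡ true) →
  count P + count Q ≤ count R
count-disjoint {P = P} {Q} {R} p q =
  subst (count P + count Q ≤_) (sym (trans (count-split R Q) (+-comm (count (λ i → R i ∧ Q i)) _)))
    (+-mono-≤ (count-mono λ i h → ∧-intro (proj₁ (p i h)) (not-intro (proj₂ (p i h))))
              (count-mono λ i h → ∧-intro (q i h) h))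

count-nonempty : ∀ {n} {P : Fin n → Bool} → 0 < count P → ∃ λ i → P i ≡ true
count-nonempty {P = P} c with split (∃ᵇ P)
... | inj₁ w = ∃ᵇ-elim w
... | inj₂ w = ⊥-elim (<-irrefl refl (<-≤-trans c (≤-trans (count-mono {Q = λ _ → false} λ i h → clash h (∃ᵇ-false w i)) (≤-reflexive (count-zeros λ _ → refl)))))

infixl 6 _∖_

opaque
  _∖_ : ∀ {n} → (Fin n → Bool) → Fin n → Fin n → Bool
  (P ∖ x) y = P y ∧ not (x == y)

  ∖-elim : ∀ {n} {P : Fin n → Bool} {x y} → (P ∖ x) y ≡ true → P y ≡ true × x ≢ y
  ∖-elim h = let a , b = ∧-elim h in a , ==-≢ (not-elim b)

  ∖-intro : ∀ {n} {P : Fin n → Bool} {x y} → P y ≡ true → x ≢ y → (P ∖ x) y ≡ true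
  ∖-intro h ne = ∧-intro h (not-intro (==-false ne))

  count-∖ : ∀ {n} (P : Fin n → Bool) {x} → P x ≡ true → count P ≡ suc (count (P ∖ x))
  count-∖ {n} P {x} p = trans (count-split P (x ==_)) (cong (_+ count (P ∖ x)) (count-single x (∧-intro p ==-refl) λ y h → ==-elim (proj₂ (∧-elim {P y} h))))

module _ {n : ℕ} where

  Perm : Set
  Perm = Permutation′ n

  perm-inj : (π : Perm) → ∀ {x y} → π ⟨$⟩ʳ x ≡ π ⟨$⟩ʳ y → x ≡ y
  perm-inj π e = trans (sym (inverseˡ π)) (trans (cong (π ⟨$⟩ˡ_) e) (inverseˡ π))

  ==-perm : (π : Perm) → ∀ x y → (π ⟨$⟩ʳ x == π ⟨$⟩ʳ y) ≡ (x == y)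
  ==-perm π x y = Bool-ext (λ h → subst (λ z → (x == z) ≡ true) (perm-inj π (==-elim h)) ==-refl)
                           (λ h → subst (λ z → (π ⟨$⟩ʳ x == π ⟨$⟩ʳ z) ≡ true) (==-elim h) ==-refl)

  swapF : Fin n → Fin n → Fin n → Fin n
  swapF a b x = if a == x then b else (if b == x then a else x)

  swapF-a : ∀ a b → swapF a b a ≡ b
  swapF-a a b rewrite ==-refl {x = a} = refl

  swapF-b : ∀ a b → swapF a b b ≡ a
  swapF-b a b with split (a == b)
  ... | inj₁ e rewrite e = sym (==-elim e)
  ... | inj₂ e rewrite e | ==-refl {x = b} = refl

  swapF-other : ∀ a b x → a ≢ x → b ≢ x → swapF a b x ≡ x
  swapF-other a b x p q rewrite ==-false p | ==-false q = refl

  swapF-inv : ∀ a b x → swapF a b (swapF a b x) ≡ x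
  swapF-inv a b x with a ≟ x | b ≟ x
  ... | yes refl | _        = trans (cong (swapF a b) (swapF-a a b)) (swapF-b a b)
  ... | no _     | yes refl = trans (cong (swapF a b) (swapF-b a b)) (swapF-a a b)
  ... | no p     | no q     = trans (cong (swapF a b) (swapF-other a b x p q)) (swapF-other a b x p q)

  swap : Fin n → Fin n → Perm
  swap a b = permutation (swapF a b) (swapF a b) (swapF-inv a b) (swapF-inv a b)

  opaque
    glue : (P Q : Fin n → Bool) (π ρ : Perm) → (∀ x → P x ≡ Q (π ⟨$⟩ʳ x)) → (∀ x → P x ≡ Q (ρ ⟨$⟩ʳ x)) →
      Σ Perm λ σ → (∀ x → P x ≡ true → σ ⟨$⟩ʳ x ≡ π ⟨$⟩ʳ x) × (∀ x → P x ≡ false → σ ⟨$⟩ʳ x ≡ ρ ⟨$⟩ʳ x)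
    glue P Q π ρ hπ hρ = permutation f g fg gf , (λ x → f-in x) , (λ x → f-out x)
      where
      f g : Fin n → Fin n
      f x = if P x then π ⟨$⟩ʳ x else ρ ⟨$⟩ʳ x
      g y = if Q y then π ⟨$⟩ˡ y else ρ ⟨$⟩ˡ y
      f-in : ∀ x → P x ≡ true → f x ≡ π ⟨$⟩ʳ x
      f-in x p rewrite p = refl
      f-out : ∀ x → P x ≡ false → f x ≡ ρ ⟨$⟩ʳ x
      f-out x p rewrite p = refl
      fg : ∀ y → f (g y) ≡ y
      fg y with split (Q y)
      ... | inj₁ q rewrite q | trans (hπ (π ⟨$⟩ˡ y)) (trans (cong Q (inverseʳ π)) q) = inverseʳ π
      ... | inj₂ q rewrite q | trans (hρ (ρ ⟨$⟩ˡ y)) (trans (cong Q (inverseʳ ρ)) q) = inverseʳ ρ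
      gf : ∀ x → g (f x) ≡ x
      gf x with split (P x)
      ... | inj₁ p rewrite p | trans (sym (hπ x)) p = inverseˡ π
      ... | inj₂ p rewrite p | trans (sym (hρ x)) p = inverseˡ ρ

  ∃ᵇ-perm : (P Q : Fin n → Bool) (π : Perm) → (∀ x → P x ≡ Q (π ⟨$⟩ʳ x)) → ∃ᵇ P ≡ ∃ᵇ Q
  ∃ᵇ-perm P Q π h = Bool-ext
    (λ e → let x , p = ∃ᵇ-elim e in ∃ᵇ-intro (π ⟨$⟩ʳ x) (trans (sym (h x)) p))
    (λ e → let y , q = ∃ᵇ-elim e in ∃ᵇ-intro (π ⟨$⟩ˡ y) (trans (h (π ⟨$⟩ˡ y)) (trans (cong Q (inverseʳ π)) q)))

  ∀ᵇ-perm : (P Q : Fin n → Bool) (π : Perm) → (∀ x → P x ≡ Q (π ⟨$⟩ʳ x)) → ∀ᵇ P ≡ ∀ᵇ Q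
  ∀ᵇ-perm P Q π h = Bool-ext
    (λ e → ∀ᵇ-intro λ y → trans (cong Q (sym (inverseʳ π))) (trans (sym (h (π ⟨$⟩ˡ y))) (∀ᵇ-elim e (π ⟨$⟩ˡ y))))
    (λ e → ∀ᵇ-intro λ x → trans (h x) (∀ᵇ-elim e (π ⟨$⟩ʳ x)))

  count-perm′ : (P Q : Fin n → Bool) (π : Perm) → (∀ x → P x ≡ Q (π ⟨$⟩ʳ x)) → count P ≡ count Q
  count-perm′ P Q π h = trans (count-cong h) (count-perm Q π)

  -- A is an equivalence on one copy of Fin n, and R v x says that x in a second copy lies in the class of v.
  class-matching : (A R : Fin n → Fin n → Bool) →
    (∀ v → A v v ≡ true) →
    (∀ v w x → A v w ≡ true → R w x ≡ true → R v x ≡ true) →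
    (∀ v w x → A v w ≡ true → R v x ≡ true → R w x ≡ true) →
    (∀ v w x → R v x ≡ true → R w x ≡ true → A w v ≡ true) →
    (∀ v → count (A v) ≡ count (R v)) →
    Σ Perm λ π → ∀ v → R v (π ⟨$⟩ʳ v) ≡ true
  class-matching A R rf t₁ t₂ t₃ sizes =
    let π , h = go n (λ _ → true) (λ _ → true) (count≤n _) (λ v _ → trans (count-cong λ i → ∧-true _) (trans (sizes v) (count-cong λ i → sym (∧-true _))))
    in π , λ v → proj₁ (h v refl)
    where
    ∧-true : ∀ b → b ∧ true ≡ b
    ∧-true true  = refl
    ∧-true false = refl
    drop : ∀ (P Q : Fin n → Bool) u x → ((λ y → P y ∧ Q y) ∖ u) x ≡ P x ∧ (Q ∖ u) x
    drop P Q u x = Bool-ext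
      (λ h → let a , ne = ∖-elim h ; b , c = ∧-elim a in ∧-intro b (∖-intro c ne))
      (λ h → let a , b = ∧-elim h ; c , ne = ∖-elim b in ∖-intro (∧-intro a c) ne)
    go : ∀ N (P Q : Fin n → Bool) → count P ≤ N →
         (∀ v → P v ≡ true → count (λ w → A v w ∧ P w) ≡ count (λ x → R v x ∧ Q x)) →
         Σ Perm λ π → ∀ v → P v ≡ true → R v (π ⟨$⟩ʳ v) ≡ true × Q (π ⟨$⟩ʳ v) ≡ true
    go N P Q le bal with split (∃ᵇ P)
    go N P Q le bal | inj₂ none = Perm.id , λ v p → clash p (∃ᵇ-false none v)
    go zero P Q le bal | inj₁ some = let v , p = ∃ᵇ-elim some in ⊥-elim (<-irrefl refl (<-≤-trans (count-pos v p) le))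
    go (suc N) P Q le bal | inj₁ some = τ , ok
      where
      v = proj₁ (∃ᵇ-elim some)
      p = proj₂ (∃ᵇ-elim some)
      found : ∃ λ x → R v x ∧ Q x ≡ true
      found = count-nonempty (subst (0 <_) (bal v p) (count-pos v (∧-intro (rf v) p)))
      u = proj₁ found
      Ru = proj₁ (∧-elim (proj₂ found))
      Qu = proj₂ (∧-elim (proj₂ found))
      bal′ : ∀ w → (P ∖ v) w ≡ true → count (λ x → A w x ∧ (P ∖ v) x) ≡ count (λ x → R w x ∧ (Q ∖ u) x)
      bal′ w pw with split (A w v)
      ... | inj₁ a = suc-injective (trans (cong suc (count-cong λ x → sym (drop (A w) P v x)))
                       (trans (sym (count-∖ (λ x → A w x ∧ P x) (∧-intro a p)))
                       (trans (bal w (proj₁ (∖-elim pw)))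
                       (trans (count-∖ (λ x → R w x ∧ Q x) (∧-intro (t₁ w v u a Ru) Qu))
                              (cong suc (count-cong λ x → drop (R w) Q u x))))))
      ... | inj₂ a = trans (count-cong λ x → Bool-ext
                              (λ h → let h₁ , h₂ = ∧-elim h in ∧-intro h₁ (proj₁ (∖-elim h₂)))
                              (λ h → let h₁ , h₂ = ∧-elim h in ∧-intro h₁ (∖-intro h₂ λ e → clash (subst (λ z → A w z ≡ true) (sym e) h₁) a)))
                     (trans (bal w (proj₁ (∖-elim pw)))
                     (count-cong λ x → Bool-ext
                              (λ h → let h₁ , h₂ = ∧-elim h in ∧-intro h₁ (∖-intro h₂ λ e → clash (t₃ v w u Ru (subst (λ z → R w z ≡ true) (sym e) h₁)) a))
                              (λ h → let h₁ , h₂ = ∧-elim h in ∧-intro h₁ (proj₁ (∖-elim h₂)))))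
      rec = go N (P ∖ v) (Q ∖ u) (≤-pred (subst (_≤ suc N) (count-∖ P p) le)) bal′
      π = proj₁ rec
      -- The recursive bijection may send `v` anywhere. The swap redirects it to `u` and disturbs no
      -- other element of `P`, since those have images in `Q` without `u`.
      τ = π ∘ₚ swap (π ⟨$⟩ʳ v) u
      ok : ∀ x → P x ≡ true → R x (τ ⟨$⟩ʳ x) ≡ true × Q (τ ⟨$⟩ʳ x) ≡ true
      ok x px with v ≟ x
      ... | yes refl rewrite swapF-a (π ⟨$⟩ʳ v) u = Ru , Qu
      ... | no ne with proj₂ rec x (∖-intro px ne)
      ...   | r , q rewrite swapF-other (π ⟨$⟩ʳ v) u (π ⟨$⟩ʳ x) (λ e → ne (perm-inj π e)) (proj₂ (∖-elim q)) = r , proj₁ (∖-elim q)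

-- The bijective pebble game and its defining formulas

Edges : ℕ → Set
Edges n = Fin n → Fin n → Bool

⟦_⟧ : ∀ {n} → Edges n → Graph
⟦_⟧ {n} E = record { order = n ; E = E }

opaque
  unfolding count
  length-filter : ∀ {n m} (P : Fin m → Bool) (f : Fin n → Fin m) → length (filterᵇ P (tabulate f)) ≡ count (λ i → P (f i))
  length-filter {zero}  P f = refl
  length-filter {suc n} P f with P (f zero)
  ... | true  = cong suc (length-filter P (f ∘ suc))
  ... | false = length-filter P (f ∘ suc)

module _ {k : ℕ} {A : Set} where

  upd : (Fin k → A) → Fin k → A → Fin k → A
  upd ρ x v y = if does (x ≟ y) then v else ρ y

  upd-same : ∀ {ρ} x {v} → upd ρ x v x ≡ v
  upd-same x with x ≟ x
  ... | yes _ = refl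
  ... | no ne = ⊥-elim (ne refl)

  upd-other : ∀ {ρ} {x y} {v} → x ≢ y → upd ρ x v y ≡ ρ y
  upd-other {x = x} {y} ne with x ≟ y
  ... | yes e = ⊥-elim (ne e)
  ... | no _  = refl

  upd-≗ : ∀ {ρ σ} x v → (∀ y → ρ y ≡ σ y) → ∀ y → upd ρ x v y ≡ upd σ x v y
  upd-≗ x v h y with x ≟ y
  ... | yes _ = refl
  ... | no _  = h y

-- By the pigeonhole principle, the values of `g` away from `x` cannot exhaust the k variables, so
-- one pebble stays free for a move.
fresh : ∀ {k} (g : Fin k → Fin k) x → ∃ λ z → ∀ y → y ≢ x → g y ≢ z
fresh {suc k} g x with any? (λ z → Fin.all? (λ y → ¬? (y ≟ x) →-dec ¬? (g y ≟ z)))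
... | yes w = w
... | no ¬w = ⊥-elim (collide (Fin.pigeonhole ≤-refl λ z → punchOut (λ e → hit-≢ z (sym e))))
  where
  hit : ∀ z → ∃ λ y → y ≢ x × g y ≡ z
  hit z with any? (λ y → ¬? (y ≟ x) ×-dec (g y ≟ z))
  ... | yes w = w
  ... | no ¬v = ⊥-elim (¬w (z , λ y ne e → ¬v (y , ne , e)))
  hit-≢ : ∀ z → proj₁ (hit z) ≢ x
  hit-≢ z = proj₁ (proj₂ (hit z))
  collide : (∃ λ i → ∃ λ j → i Data.Fin.< j × punchOut (λ e → hit-≢ i (sym e)) ≡ punchOut (λ e → hit-≢ j (sym e))) → ⊥
  collide (i , j , lt , e) = Fin.<⇒≢ lt (trans (sym (proj₂ (proj₂ (hit i))))
    (trans (cong g (Fin.punchOut-injective (λ e → hit-≢ i (sym e)) (λ e → hit-≢ j (sym e)) e)) (proj₂ (proj₂ (hit j)))))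

record Atoms {n k} (E : Edges n) (ρ : Fin k → Fin n) (E′ : Edges n) (σ : Fin k → Fin n) : Set where
  constructor atoms
  field
    edge : ∀ x y → E (ρ x) (ρ y) ≡ E′ (σ x) (σ y)
    same : ∀ x y → (ρ x == ρ y) ≡ (σ x == σ y)

-- Duplicator wins r rounds of the bijective k-pebble game from the position (ρ , σ).
EQ : ∀ {n k} → ℕ → Edges n → (Fin k → Fin n) → Edges n → (Fin k → Fin n) → Set
EQ zero    E ρ E′ σ = Atoms E ρ E′ σ
EQ (suc r) E ρ E′ σ = Atoms E ρ E′ σ ×
  (∀ x → Σ Perm λ π → ∀ v → EQ r E (upd ρ x v) E′ (upd σ x (π ⟨$⟩ʳ v)))

module _ {n k : ℕ} where

  EQ-atoms : ∀ r {E E′ : Edges n} {ρ σ : Fin k → Fin n} → EQ r E ρ E′ σ → Atoms E ρ E′ σ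
  EQ-atoms zero    h = h
  EQ-atoms (suc r) h = proj₁ h

  EQ-refl : ∀ r {E : Edges n} {ρ : Fin k → Fin n} → EQ r E ρ E ρ
  EQ-refl zero    = atoms (λ _ _ → refl) (λ _ _ → refl)
  EQ-refl (suc r) = atoms (λ _ _ → refl) (λ _ _ → refl) , λ x → Perm.id , λ v → EQ-refl r

  EQ-sym : ∀ r {E E′ : Edges n} {ρ σ : Fin k → Fin n} → EQ r E ρ E′ σ → EQ r E′ σ E ρ
  EQ-sym zero    (atoms e s) = atoms (λ x y → sym (e x y)) (λ x y → sym (s x y))
  EQ-sym (suc r) {E} {E′} {ρ} {σ} (atoms e s , h) = atoms (λ x y → sym (e x y)) (λ x y → sym (s x y)) ,
    λ x → let π , p = h x in Perm.flip π , λ v →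
      subst (λ w → EQ r E′ (upd σ x w) E (upd ρ x (π ⟨$⟩ˡ v))) (inverseʳ π) (EQ-sym r (p (π ⟨$⟩ˡ v)))

  EQ-trans : ∀ r {E F G : Edges n} {ρ σ τ : Fin k → Fin n} → EQ r E ρ F σ → EQ r F σ G τ → EQ r E ρ G τ
  EQ-trans zero    (atoms e s) (atoms e′ s′) = atoms (λ x y → trans (e x y) (e′ x y)) (λ x y → trans (s x y) (s′ x y))
  EQ-trans (suc r) (atoms e s , h) (atoms e′ s′ , h′) = atoms (λ x y → trans (e x y) (e′ x y)) (λ x y → trans (s x y) (s′ x y)) ,
    λ x → let π , p = h x ; π′ , p′ = h′ x in π ∘ₚ π′ , λ v → EQ-trans r (p v) (p′ (π ⟨$⟩ʳ v))

  EQ-≗ : ∀ r {E E′ : Edges n} {ρ σ ρ′ σ′ : Fin k → Fin n} → (∀ x → ρ x ≡ ρ′ x) → (∀ x → σ x ≡ σ′ x) →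
         EQ r E ρ E′ σ → EQ r E ρ′ E′ σ′
  EQ-≗ zero {E} {E′} p q (atoms e s) = atoms
    (λ x y → subst₂ (λ a b → E a b ≡ _) (p x) (p y) (subst₂ (λ a b → _ ≡ E′ a b) (q x) (q y) (e x y)))
    (λ x y → subst₂ (λ a b → (a == b) ≡ _) (p x) (p y) (subst₂ (λ a b → _ ≡ (a == b)) (q x) (q y) (s x y)))
  EQ-≗ (suc r) p q (a , h) = EQ-≗ zero p q a ,
    λ x → let π , f = h x in π , λ v → EQ-≗ r (upd-≗ x v p) (upd-≗ x _ q) (f v)

  EQ-mono : ∀ r {E E′ : Edges n} {ρ σ : Fin k → Fin n} → EQ (suc r) E ρ E′ σ → EQ r E ρ E′ σ
  EQ-mono zero    h = proj₁ h
  EQ-mono (suc r) (a , h) = a , λ x → let π , f = h x in π , λ v → EQ-mono r (f v)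

  -- `g` may permute, double or drop pebbles. A move of pebble `x` is imitated by a pebble `z` that
  -- `g` does not use elsewhere, and from then on `g` sends `x` to `z`.
  EQ-reindex : ∀ r {E E′ : Edges n} {ρ σ : Fin k → Fin n} → EQ r E ρ E′ σ → (g : Fin k → Fin k) → EQ r E (ρ ∘ g) E′ (σ ∘ g)
  EQ-reindex zero    (atoms e s) g = atoms (λ x y → e (g x) (g y)) (λ x y → s (g x) (g y))
  EQ-reindex (suc r) {E} {E′} {ρ} {σ} (a , h) g = EQ-reindex zero a g , λ x → let z , fr = fresh g x ; π , f = h z in
    π , λ v → EQ-≗ r (shuffle x z fr ρ) (shuffle x z fr σ) (EQ-reindex r (f v) (upd g x z))
    where
    shuffle : ∀ x z → (∀ y → y ≢ x → g y ≢ z) → ∀ (τ : Fin k → Fin n) {w} y → upd τ z w (upd g x z y) ≡ upd (τ ∘ g) x w y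
    shuffle x z fr τ y with x ≟ y
    ... | yes _ = upd-same {ρ = τ} z
    ... | no ne = upd-other {ρ = τ} (λ e → fr y (λ e′ → ne (sym e′)) (sym e))

-- Hintikka formulas for the counting logic

module Hintikka {k′ : ℕ} where

  k : ℕ
  k = suc k′

  -- `eq x x` alone is false as long as `x` has no value; this tautology holds under partial
  -- assignments as well.
  truth : Fin k → Formula k
  truth x = neg (conj (eq x x) (neg (eq x x)))

  truth-true : ∀ G x ρ → eval G (truth x) ρ ≡ true
  truth-true G x ρ with eval G (eq x x) ρ
  ... | true  = refl
  ... | false = refl

  lit : Bool → Formula k → Formula k
  lit true  φ = φ
  lit false φ = neg φ

  ⋀ : ∀ {m} → (Fin m → Formula k) → Formula k
  ⋀ {zero}  φ = truth zero
  ⋀ {suc m} φ = conj (φ zero) (⋀ (φ ∘ suc))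

  exactly : ℕ → Fin k → Formula k → Formula k
  exactly c x φ = conj (cnt c x φ) (neg (cnt (suc c) x φ))

  ⋀-elim : ∀ {m} G ρ (φ : Fin m → Formula k) → eval G (⋀ φ) ρ ≡ true → ∀ i → eval G (φ i) ρ ≡ true
  ⋀-elim G ρ φ h zero    = proj₁ (∧-elim h)
  ⋀-elim G ρ φ h (suc i) = ⋀-elim G ρ (φ ∘ suc) (proj₂ (∧-elim {eval G (φ zero) ρ} h)) i

  ⋀-intro : ∀ {m} G ρ (φ : Fin m → Formula k) → (∀ i → eval G (φ i) ρ ≡ true) → eval G (⋀ φ) ρ ≡ true
  ⋀-intro {zero}  G ρ φ h = truth-true G zero ρ
  ⋀-intro {suc m} G ρ φ h = ∧-intro (h zero) (⋀-intro G ρ (φ ∘ suc) (h ∘ suc))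

  qd-⋀ : ∀ {m d} (φ : Fin m → Formula k) → (∀ i → qd (φ i) ≤ d) → qd (⋀ φ) ≤ d
  qd-⋀ {zero}  φ h = z≤n
  qd-⋀ {suc m} φ h = ⊔-lub (h zero) (qd-⋀ (φ ∘ suc) (h ∘ suc))

  lit-elim : ∀ G ρ b φ → eval G (lit b φ) ρ ≡ true → b ≡ eval G φ ρ
  lit-elim G ρ true  φ h = sym h
  lit-elim G ρ false φ h = sym (not-elim h)

  lit-intro : ∀ G ρ b φ → b ≡ eval G φ ρ → eval G (lit b φ) ρ ≡ true
  lit-intro G ρ true  φ h = sym h
  lit-intro G ρ false φ h = not-intro (sym h)

  qd-lit : ∀ b φ {d} → qd φ ≤ d → qd (lit b φ) ≤ d
  qd-lit true  φ h = h
  qd-lit false φ h = h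

  ≤ᵇ-true : ∀ {m n} → (m ≤ᵇ n) ≡ true → m ≤ n
  ≤ᵇ-true {m} {n} h = ≤ᵇ⇒≤ m n (subst Bool.T (sym h) tt)

  true-≤ᵇ : ∀ {m n} → m ≤ n → (m ≤ᵇ n) ≡ true
  true-≤ᵇ h = Bool-ext {b = true} (λ _ → refl) (λ _ → T⇒≡ (≤⇒≤ᵇ h))
    where
    T⇒≡ : ∀ {b} → Bool.T b → b ≡ true
    T⇒≡ {true} _ = refl

  eval-cnt : ∀ G c x (φ : Formula k) ρ → eval G (cnt c x φ) ρ ≡ (c ≤ᵇ count (λ v → eval G φ (update {G = G} ρ x v)))
  eval-cnt G c x φ ρ = cong (c ≤ᵇ_) (length-filter (λ v → eval G φ (update {G = G} ρ x v)) (λ i → i))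

  exactly-elim : ∀ G c x (φ : Formula k) ρ → eval G (exactly c x φ) ρ ≡ true → count (λ v → eval G φ (update {G = G} ρ x v)) ≡ c
  exactly-elim G c x φ ρ h with ∧-elim {eval G (cnt c x φ) ρ} h
  ... | h₁ , h₂ = ≤-antisym (≤-pred (≰⇒> λ le → clash (trans (eval-cnt G (suc c) x φ ρ) (true-≤ᵇ le)) (not-elim h₂)))
                            (≤ᵇ-true (trans (sym (eval-cnt G c x φ ρ)) h₁))

  exactly-intro : ∀ G c x (φ : Formula k) ρ → count (λ v → eval G φ (update {G = G} ρ x v)) ≡ c → eval G (exactly c x φ) ρ ≡ true
  exactly-intro G c x φ ρ refl = ∧-intro {eval G (cnt c x φ) ρ} (trans (eval-cnt G c x φ ρ) (true-≤ᵇ (≤-refl {c})))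
    (not-intro (≢true⇒false λ h → <-irrefl refl (≤ᵇ-true {suc c} {c} (trans (sym (eval-cnt G (suc c) x φ ρ)) h))))

  eval-≗ : ∀ G (φ : Formula k) {ρ σ : Assignment k G} → (∀ x → ρ x ≡ σ x) → eval G φ ρ ≡ eval G φ σ
  eval-≗ G (rel x y) h rewrite h x | h y = refl
  eval-≗ G (eq x y)  h rewrite h x | h y = refl
  eval-≗ G (neg φ)   h = cong not (eval-≗ G φ h)
  eval-≗ G (conj φ ψ) h = cong₂ _∧_ (eval-≗ G φ h) (eval-≗ G ψ h)
  eval-≗ G (disj φ ψ) h = cong₂ _∨_ (eval-≗ G φ h) (eval-≗ G ψ h)
  eval-≗ G (cnt m x φ) {ρ} {σ} h = trans (eval-cnt G m x φ ρ) (trans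
    (cong (m ≤ᵇ_) (count-cong λ v → eval-≗ G φ (upd-≗ x (just v) h)))
    (sym (eval-cnt G m x φ σ)))

  module _ {n : ℕ} where

    Val : Edges n → Formula k → (Fin k → Fin n) → Bool
    Val E φ ρ = eval ⟦ E ⟧ φ (λ x → just (ρ x))

    update-just : ∀ (ρ : Fin k → Fin n) x v y → upd (λ x → just (ρ x)) x (just v) y ≡ just (upd ρ x v y)
    update-just ρ x v y with x ≟ y
    ... | yes _ = refl
    ... | no _  = refl

    Val-update : ∀ E φ ρ x v → eval ⟦ E ⟧ φ (update {G = ⟦ E ⟧} (λ x → just (ρ x)) x v) ≡ Val E φ (upd ρ x v)
    Val-update E φ ρ x v = eval-≗ ⟦ E ⟧ φ (update-just ρ x v)

    edge-lit same-lit : Edges n → (Fin k → Fin n) → Fin k → Fin k → Formula k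
    edge-lit E ρ x y = lit (E (ρ x) (ρ y)) (rel x y)
    same-lit E ρ x y = lit (ρ x == ρ y) (eq x y)

    diagram : Edges n → (Fin k → Fin n) → Formula k
    diagram E ρ = conj (⋀ λ x → ⋀ (edge-lit E ρ x)) (⋀ λ x → ⋀ (same-lit E ρ x))

    -- The type of a position: its atomic diagram together with the size of the class of each `v`,
    -- for each pebble. No clause excludes further classes in the other graph, because both have n
    -- vertices and the listed sizes already add up to n.
    Hin : ℕ → Edges n → (Fin k → Fin n) → Formula k
    census : ℕ → Edges n → (Fin k → Fin n) → Fin k → Fin n → Formula k
    Hin zero    E ρ = diagram E ρ
    Hin (suc r) E ρ = conj (diagram E ρ) (⋀ λ x → ⋀ (census r E ρ x))
    census r E ρ x v = exactly (count (λ w → Val E (Hin r E (upd ρ x v)) (upd ρ x w))) x (Hin r E (upd ρ x v))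

    qd-Hin : ∀ r E ρ → qd (Hin r E ρ) ≤ r
    qd-diagram : ∀ E ρ {d} → qd (diagram E ρ) ≤ d
    qd-diagram E ρ = ⊔-lub
      (qd-⋀ (λ x → ⋀ (edge-lit E ρ x)) λ x → qd-⋀ (edge-lit E ρ x) λ y → qd-lit (E (ρ x) (ρ y)) (rel x y) z≤n)
      (qd-⋀ (λ x → ⋀ (same-lit E ρ x)) λ x → qd-⋀ (same-lit E ρ x) λ y → qd-lit (ρ x == ρ y) (eq x y) z≤n)
    qd-Hin zero    E ρ = qd-diagram E ρ
    qd-Hin (suc r) E ρ = ⊔-lub (qd-diagram E ρ) (qd-⋀ (λ x → ⋀ (census r E ρ x)) λ x → qd-⋀ (census r E ρ x) λ v →
      ⊔-lub (s≤s (qd-Hin r E (upd ρ x v))) (s≤s (qd-Hin r E (upd ρ x v))))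

    opaque
      unfolding _==_
      ==-does : (x y : Fin n) → (x == y) ≡ does (x ≟ y)
      ==-does x y = refl

    diagram-sound : ∀ E ρ E′ σ → Val E′ (diagram E ρ) σ ≡ true → Atoms E ρ E′ σ
    diagram-sound E ρ E′ σ h with ∧-elim {Val E′ (⋀ λ x → ⋀ (edge-lit E ρ x)) σ} h
    ... | h₁ , h₂ = atoms
      (λ x y → lit-elim ⟦ E′ ⟧ _ _ (rel x y) (⋀-elim ⟦ E′ ⟧ _ (edge-lit E ρ x) (⋀-elim ⟦ E′ ⟧ _ (λ x → ⋀ (edge-lit E ρ x)) h₁ x) y))
      (λ x y → trans (lit-elim ⟦ E′ ⟧ _ _ (eq x y) (⋀-elim ⟦ E′ ⟧ _ (same-lit E ρ x) (⋀-elim ⟦ E′ ⟧ _ (λ x → ⋀ (same-lit E ρ x)) h₂ x) y)) (sym (==-does _ _)))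

    diagram-complete : ∀ E ρ E′ σ → Atoms E ρ E′ σ → Val E′ (diagram E ρ) σ ≡ true
    diagram-complete E ρ E′ σ (atoms e s) = ∧-intro
      (⋀-intro ⟦ E′ ⟧ _ (λ x → ⋀ (edge-lit E ρ x)) λ x → ⋀-intro ⟦ E′ ⟧ _ (edge-lit E ρ x) λ y → lit-intro ⟦ E′ ⟧ _ _ (rel x y) (e x y))
      (⋀-intro ⟦ E′ ⟧ _ (λ x → ⋀ (same-lit E ρ x)) λ x → ⋀-intro ⟦ E′ ⟧ _ (same-lit E ρ x) λ y → lit-intro ⟦ E′ ⟧ _ _ (eq x y) (trans (s x y) (==-does _ _)))

    -- The two directions depend on each other: equal class sizes give a bijection by
    -- `class-matching` only if satisfying the formula of level r is an equivalence, which takes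
    -- soundness and completeness at that level.
    Hin-sound : ∀ r E ρ E′ σ → Val E′ (Hin r E ρ) σ ≡ true → EQ r E ρ E′ σ
    Hin-complete : ∀ r E ρ E′ σ → EQ r E ρ E′ σ → Val E′ (Hin r E ρ) σ ≡ true

    Hin-sound zero    E ρ E′ σ h = diagram-sound E ρ E′ σ h
    Hin-sound (suc r) E ρ E′ σ h with ∧-elim {Val E′ (diagram E ρ) σ} h
    ... | h₁ , h₂ = diagram-sound E ρ E′ σ h₁ , λ x →
      let A = λ v w → Val E (Hin r E (upd ρ x v)) (upd ρ x w)
          R = λ v w → Val E′ (Hin r E (upd ρ x v)) (upd σ x w)
          s : ∀ {v w} → A v w ≡ true → EQ r E (upd ρ x v) E (upd ρ x w)
          s {v} {w} = Hin-sound r E (upd ρ x v) E (upd ρ x w)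
          c : ∀ {v w} → R v w ≡ true → EQ r E (upd ρ x v) E′ (upd σ x w)
          c {v} {w} = Hin-sound r E (upd ρ x v) E′ (upd σ x w)
          π , p = class-matching A R
            (λ v → Hin-complete r E (upd ρ x v) E (upd ρ x v) (EQ-refl r))
            (λ v w u a b → Hin-complete r E (upd ρ x v) E′ (upd σ x u) (EQ-trans r (s a) (c b)))
            (λ v w u a b → Hin-complete r E (upd ρ x w) E′ (upd σ x u) (EQ-trans r (EQ-sym r (s a)) (c b)))
            (λ v w u a b → Hin-complete r E (upd ρ x w) E (upd ρ x v) (EQ-trans r (c b) (EQ-sym r (c a))))
            (λ v → sym (trans (count-cong λ w → sym (Val-update E′ (Hin r E (upd ρ x v)) σ x w))
              (exactly-elim ⟦ E′ ⟧ _ x (Hin r E (upd ρ x v)) _ (⋀-elim ⟦ E′ ⟧ _ (census r E ρ x) (⋀-elim ⟦ E′ ⟧ _ (λ x → ⋀ (census r E ρ x)) h₂ x) v))))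
      in π , λ v → c (p v)

    Hin-complete zero    E ρ E′ σ h = diagram-complete E ρ E′ σ h
    Hin-complete (suc r) E ρ E′ σ (a , h) = ∧-intro (diagram-complete E ρ E′ σ a)
      (⋀-intro ⟦ E′ ⟧ _ (λ x → ⋀ (census r E ρ x)) λ x → ⋀-intro ⟦ E′ ⟧ _ (census r E ρ x) λ v →
        let φ = Hin r E (upd ρ x v) ; π , p = h x in
        exactly-intro ⟦ E′ ⟧ _ x φ _ (trans (count-cong λ w → Val-update E′ φ σ x w) (sym
          (count-perm′ _ _ π λ w → Bool-ext
            (λ t → Hin-complete r E (upd ρ x v) E′ _ (EQ-trans r (Hin-sound r E (upd ρ x v) E _ t) (p w)))
            (λ t → Hin-complete r E (upd ρ x v) E _ (EQ-trans r (Hin-sound r E (upd ρ x v) E′ _ t) (EQ-sym r (p w))))))))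

  closed-true : Formula k
  closed-true = cnt 0 zero (truth zero)

  exs : List (Fin k) → Formula k → Formula k
  exs []       φ = φ
  exs (x ∷ xs) φ = cnt 1 x (exs xs φ)

  qd-exs : ∀ xs φ → qd (exs xs φ) ≡ length xs + qd φ
  qd-exs []       φ = refl
  qd-exs (x ∷ xs) φ = cong suc (qd-exs xs φ)

  free-exs : ∀ xs φ z → z ∈ₗ xs → free (exs xs φ) z ≡ false
  free-exs (x ∷ xs) φ z (here refl) with x ≟ x
  ... | yes _ = refl
  ... | no ne = ⊥-elim (ne refl)
  free-exs (x ∷ xs) φ z (there i) rewrite free-exs xs φ z i = Bool.∧-zeroʳ _

  eval-ex : ∀ G x (φ : Formula k) ρ → eval G (cnt 1 x φ) ρ ≡ true → ∃ λ v → eval G φ (upd ρ x (just v)) ≡ true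
  eval-ex G x φ ρ h = count-nonempty (≤ᵇ-true (trans (sym (eval-cnt G 1 x φ ρ)) h))

  exs-elim : ∀ G xs (φ : Formula k) ρ → eval G (exs xs φ) ρ ≡ true →
    Σ (Assignment k G) λ σ → eval G φ σ ≡ true × (∀ y → (∃ λ v → ρ y ≡ just v) ⊎ y ∈ₗ xs → ∃ λ v → σ y ≡ just v)
  exs-elim G []       φ ρ h = ρ , h , λ { y (inj₁ d) → d ; y (inj₂ ()) }
  exs-elim G (x ∷ xs) φ ρ h =
    let v , p = eval-ex G x (exs xs φ) ρ h
        σ , q , d = exs-elim G xs φ (upd ρ x (just v)) p
    in σ , q , λ y c → d y (defined v y c)
    where
    defined : ∀ v y → (∃ λ v → ρ y ≡ just v) ⊎ y ∈ₗ (x ∷ xs) → (∃ λ w → upd ρ x (just v) y ≡ just w) ⊎ y ∈ₗ xs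
    defined v y c with x ≟ y
    defined v y c                | yes _ = inj₁ (v , refl)
    defined v y (inj₁ d)         | no _  = inj₁ d
    defined v y (inj₂ (here e))  | no ne = ⊥-elim (ne (sym e))
    defined v y (inj₂ (there i)) | no _  = inj₂ i

  exs-intro : ∀ {n} (E : Edges n) xs (φ : Formula k) ρ (σ : Fin k → Fin n) → Val E φ σ ≡ true →
    (∀ y → ρ y ≡ just (σ y) ⊎ y ∈ₗ xs) → eval ⟦ E ⟧ (exs xs φ) ρ ≡ true
  exs-intro E []       φ ρ σ h d = trans (eval-≗ ⟦ E ⟧ φ λ y → bare (d y)) h
    where
    bare : ∀ {y} → ρ y ≡ just (σ y) ⊎ y ∈ₗ [] → ρ y ≡ just (σ y)
    bare (inj₁ e) = e
  exs-intro E (x ∷ xs) φ ρ σ h d = trans (eval-cnt ⟦ E ⟧ 1 x (exs xs φ) ρ)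
    (true-≤ᵇ (count-pos (σ x) (exs-intro E xs φ (upd ρ x (just (σ x))) σ h defined)))
    where
    defined : ∀ y → upd ρ x (just (σ x)) y ≡ just (σ y) ⊎ y ∈ₗ xs
    defined y with x ≟ y | d y
    ... | yes refl | _              = inj₁ refl
    ... | no _     | inj₁ e         = inj₁ e
    ... | no ne    | inj₂ (here e)  = ⊥-elim (ne (sym e))
    ... | no _     | inj₂ (there i) = inj₂ i

  exs-valuation : ∀ {n} (E : Edges n) (φ : Formula k) ρ → eval ⟦ E ⟧ (exs (allFin k) φ) ρ ≡ true →
    Σ (Fin k → Fin n) λ σ → Val E φ σ ≡ true
  exs-valuation E φ ρ h =
    let σ , p , d = exs-elim ⟦ E ⟧ (allFin k) φ ρ h
        v = λ y → d y (inj₂ (∈-allFin y))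
    in (λ y → proj₁ (v y)) , trans (eval-≗ ⟦ E ⟧ φ λ y → sym (proj₂ (v y))) p

  opaque
    -- Quantifying all k variables turns the empty assignment into a total one, to which the game
    -- applies. This costs k levels of depth.
    close : Formula k → Formula k
    close φ = exs (allFin k) φ

    qd-close : ∀ φ → qd (close φ) ≡ k + qd φ
    qd-close φ = trans (qd-exs (allFin k) φ) (cong (_+ qd φ) (length-tabulate (λ i → i)))

    free-close : ∀ φ z → free (close φ) z ≡ false
    free-close φ z = free-exs (allFin k) φ z (∈-allFin z)

    close-elim : ∀ {n} (E : Edges n) φ ρ → eval ⟦ E ⟧ (close φ) ρ ≡ true → Σ (Fin k → Fin n) λ σ → Val E φ σ ≡ true
    close-elim = exs-valuation

    close-intro : ∀ {n} (E : Edges n) φ ρ (σ : Fin k → Fin n) → Val E φ σ ≡ true → eval ⟦ E ⟧ (close φ) ρ ≡ true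
    close-intro E φ ρ σ h = exs-intro E (allFin k) φ ρ σ h λ y → inj₂ (∈-allFin y)

-- Game positions given by short tuples of vertices

module Tuples (k : ℕ) {n : ℕ} where

  -- All placements of the k pebbles on the listed vertices are winning, so that pebbles can be permuted, doubled and dropped at no cost.
  record T {m} (d : ℕ) (E E′ : Edges n) (xs ys : Vec (Fin n) m) : Set where
    constructor tuple
    field game : (g : Fin k → Fin m) → EQ d E (lookup xs ∘ g) E′ (lookup ys ∘ g)

  open T public

  module _ {E E′ : Edges n} where

    T-sub : ∀ {d m m′} {xs ys : Vec (Fin n) m} → T d E E′ xs ys → (h : Vec (Fin m) m′) →
            T d E E′ (map (lookup xs) h) (map (lookup ys) h)
    T-sub {d} τ h .game g = EQ-≗ d (λ i → sym (lookup-map (g i) _ h)) (λ i → sym (lookup-map (g i) _ h)) (game τ (lookup h ∘ g))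

    T-down : ∀ c {d m} {xs ys : Vec (Fin n) m} → T (c + d) E E′ xs ys → T d E E′ xs ys
    T-down zero    τ = τ
    T-down (suc c) τ = T-down c (tuple λ g → EQ-mono _ (game τ g))

    T-lower : ∀ {c d m} {xs ys : Vec (Fin n) m} → c ≤ d → T d E E′ xs ys → T c E E′ xs ys
    T-lower {c} {d} le τ = T-down (d Data.Nat.∸ c) (subst (λ z → T z E E′ _ _) (sym (m∸n+n≡m le)) τ)

    opaque
      T-ext : ∀ {d m} {xs ys : Vec (Fin n) (suc m)} {lt : True (suc m <? k)} → T (suc d) E E′ xs ys →
              Σ Perm λ π → ∀ v → T d E E′ (v ∷ xs) ((π ⟨$⟩ʳ v) ∷ ys)
      T-ext {d} {m} {xs} {ys} {lt} τ = proj₁ move , λ v → tuple λ g →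
        EQ-≗ d (place xs g v) (place ys g _) (EQ-reindex d (proj₂ move v) (slot ∘ g))
        where
        m<k : suc m < k
        m<k = toWitness lt
        z : Fin k
        z = fromℕ< m<k
        s : Fin (suc m) → Fin k
        s j = inject≤ j (<⇒≤ m<k)
        slot : Fin (suc (suc m)) → Fin k
        slot zero    = z
        slot (suc j) = s j
        -- Pebbles beyond the length of the tuple are parked on its first vertex, so the tuple has
        -- to be nonempty. Pebble `z` is among them and can be moved.
        g₀ : Fin k → Fin (suc m)
        g₀ i with toℕ i <? suc m
        ... | yes p = fromℕ< p
        ... | no _  = zero
        g₀-s : ∀ j → g₀ (s j) ≡ j
        g₀-s j with toℕ (s j) <? suc m
        ... | yes p = trans (Fin.fromℕ<-cong _ _ (Fin.toℕ-inject≤ j _) p (Fin.toℕ<n j)) (Fin.fromℕ<-toℕ j _)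
        ... | no ¬p = ⊥-elim (¬p (subst (_< suc m) (sym (Fin.toℕ-inject≤ j _)) (Fin.toℕ<n j)))
        z≢s : ∀ j → z ≢ s j
        z≢s j e = <-irrefl (trans (sym (Fin.toℕ-inject≤ j _)) (trans (sym (cong toℕ e)) (Fin.toℕ-fromℕ< m<k))) (Fin.toℕ<n j)
        move : Σ Perm λ π → ∀ v → EQ d E (upd (lookup xs ∘ g₀) z v) E′ (upd (lookup ys ∘ g₀) z (π ⟨$⟩ʳ v))
        move = proj₂ (game τ g₀) z
        place : ∀ (zs : Vec (Fin n) (suc m)) (g : Fin k → Fin (suc (suc m))) v i →
                upd (lookup zs ∘ g₀) z v (slot (g i)) ≡ lookup (v ∷ zs) (g i)
        place zs g v i with g i
        ... | zero  = upd-same {ρ = lookup zs ∘ g₀} z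
        ... | suc j = trans (upd-other {ρ = lookup zs ∘ g₀} (z≢s j)) (cong (lookup zs) (g₀-s j))

    T-sym : ∀ {d m} {xs ys : Vec (Fin n) m} → T d E E′ xs ys → T d E′ E ys xs
    T-sym {d} τ .game g = EQ-sym d (game τ g)

    opaque
      T-back : ∀ {d m} {xs ys : Vec (Fin n) (suc m)} {lt : True (suc m <? k)} → T (suc d) E E′ xs ys →
               ∀ w → Σ (Fin n) λ v → T d E E′ (v ∷ xs) (w ∷ ys)
      T-back {d} {xs = xs} {ys} {lt} τ w = let π , p = T-ext {lt = lt} τ in π ⟨$⟩ˡ w , subst (λ z → T d E E′ ((π ⟨$⟩ˡ w) ∷ xs) (z ∷ ys)) (inverseʳ π) (p (π ⟨$⟩ˡ w))

    opaque
      T-forth : ∀ {d m} {xs ys : Vec (Fin n) (suc m)} {lt : True (suc m <? k)} → T (suc d) E E′ xs ys →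
               ∀ v → Σ (Fin n) λ w → T d E E′ (v ∷ xs) (w ∷ ys)
      T-forth {d} {lt = lt} τ v = let π , p = T-ext {lt = lt} τ in π ⟨$⟩ʳ v , p v

    module _ {d m} {xs ys : Vec (Fin n) m} {1<k : True (1 <? k)} (τ : T d E E′ xs ys) where

      private
        s₀ s₁ : Fin k
        s₀ = fromℕ< (<-trans (s≤s z≤n) (toWitness 1<k))
        s₁ = fromℕ< (toWitness 1<k)
        pick : Fin m → Fin m → Fin k → Fin m
        pick i j x = if does (x ≟ s₀) then i else j
        at₀ : ∀ i j → pick i j s₀ ≡ i
        at₀ i j with s₀ ≟ s₀
        ... | yes _ = refl
        ... | no ne = ⊥-elim (ne refl)
        at₁ : ∀ i j → pick i j s₁ ≡ j
        at₁ i j with s₁ ≟ s₀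
        ... | yes e = ⊥-elim (0≢1+n (trans (sym (Fin.toℕ-fromℕ< _)) (trans (cong toℕ (sym e)) (Fin.toℕ-fromℕ< _))))
        ... | no _  = refl
        look : ∀ i j → Atoms E (lookup xs ∘ pick i j) E′ (lookup ys ∘ pick i j)
        look i j = EQ-atoms d (game τ (pick i j))

      T-edge : ∀ i j → E (lookup xs i) (lookup xs j) ≡ E′ (lookup ys i) (lookup ys j)
      T-edge i j = subst₂ (λ a b → E (lookup xs a) (lookup xs b) ≡ E′ (lookup ys a) (lookup ys b)) (at₀ i j) (at₁ i j) (Atoms.edge (look i j) s₀ s₁)

      T-same : ∀ i j → (lookup xs i == lookup xs j) ≡ (lookup ys i == lookup ys j)
      T-same i j = subst₂ (λ a b → (lookup xs a == lookup xs b) ≡ (lookup ys a == lookup ys b)) (at₀ i j) (at₁ i j) (Atoms.same (look i j) s₀ s₁)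

    module _ {d m} {xs ys : Vec (Fin n) (suc m)} {lt : True (suc m <? k)} (τ : T (suc d) E E′ xs ys) where

      ∃-tr : ∀ {P Q : Fin n → Bool} → (∀ {v w} → T d E E′ (v ∷ xs) (w ∷ ys) → P v ≡ Q w) → ∃ᵇ P ≡ ∃ᵇ Q
      ∃-tr h = let π , p = T-ext {lt = lt} τ in ∃ᵇ-perm _ _ π (λ x → h (p x))

      ∀-tr : ∀ {P Q : Fin n → Bool} → (∀ {v w} → T d E E′ (v ∷ xs) (w ∷ ys) → P v ≡ Q w) → ∀ᵇ P ≡ ∀ᵇ Q
      ∀-tr h = let π , p = T-ext {lt = lt} τ in ∀ᵇ-perm _ _ π (λ x → h (p x))

      count-tr : ∀ {P Q : Fin n → Bool} → (∀ {v w} → T d E E′ (v ∷ xs) (w ∷ ys) → P v ≡ Q w) → count P ≡ count Q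
      count-tr h = let π , p = T-ext {lt = lt} τ in count-perm′ _ _ π (λ x → h (p x))

      -- Any `w` of the second graph answers some `v` of the first, where the fact is known. In this
      -- way consequences of chordality and claw-freeness become available in a graph that is not
      -- assumed to have either property.
      fact-tr : ∀ {P Q : Fin n → Bool} → (∀ {v w} → T d E E′ (v ∷ xs) (w ∷ ys) → P v ≡ Q w) → (∀ v → P v ≡ true) → ∀ w → Q w ≡ true
      fact-tr h f w = let v , τ′ = T-back {lt = lt} τ w in trans (sym (h τ′)) (f v)

    fact₂-tr : ∀ {d m} {xs ys : Vec (Fin n) (suc m)} {lt : True (suc m <? k)} {lt₂ : True (suc (suc m) <? k)} (τ : T (2 + d) E E′ xs ys)
      {P Q : Fin n → Fin n → Bool} → (∀ {u u′ v v′} → T d E E′ (v ∷ u ∷ xs) (v′ ∷ u′ ∷ ys) → P u v ≡ Q u′ v′) →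
      (∀ u v → P u v ≡ true) → ∀ u v → Q u v ≡ true
    fact₂-tr {lt = lt} {lt₂} τ h f u v =
      let u₀ , τ₁ = T-back {lt = lt} τ u
          v₀ , τ₂ = T-back {lt = lt₂} τ₁ v
      in trans (sym (h τ₂)) (f u₀ v₀)

-- Connectivity by repeated doubling

module _ {n : ℕ} where

  -- Pairs joined by a walk of length at most 2 ^ t; the doubling keeps the quantifier depth at t.
  reach : Edges n → ℕ → Edges n
  reach R zero    x y = (x == y) ∨ R x y
  reach R (suc t) x y = ∃ᵇ λ z → reach R t x z ∧ reach R t z y

  -- Growth by single steps, against which the doubling of `reach` is measured: balls visibly become
  -- stationary, and a ball of radius `2 ^ t` splits into two halves at each level of `reach`.
  ball : Edges n → ℕ → Edges n
  ball R zero    x y = x == y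
  ball R (suc i) x y = ball R i x y ∨ ∃ᵇ λ z → ball R i x z ∧ R z y

  reach-elim : ∀ (R : Edges n) t (C : Fin n → Set) → (∀ u v → C u → R u v ≡ true → C v) →
               ∀ {x y} → C x → reach R t x y ≡ true → C y
  reach-elim R zero    C h {x} {y} c r with ∨-elim {x == y} r
  ... | inj₁ e = subst C (==-elim e) c
  ... | inj₂ e = h _ _ c e
  reach-elim R (suc t) C h c r = let z , w = ∃ᵇ-elim r ; a , b = ∧-elim w in
    reach-elim R t C h (reach-elim R t C h c a) b

  ball-mono : ∀ (R : Edges n) {i j x y} → i ≤ j → ball R i x y ≡ true → ball R j x y ≡ true
  ball-mono R {i} {j} {x} {y} le b = subst (λ m → ball R m x y ≡ true) (m∸n+n≡m le) (grow (j Data.Nat.∸ i))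
    where
    grow : ∀ d → ball R (d + i) x y ≡ true
    grow zero    = b
    grow (suc d) = ∨-introˡ (grow d)

  ball-step : ∀ (R : Edges n) i {x y z} → ball R i x y ≡ true → R y z ≡ true → ball R (suc i) x z ≡ true
  ball-step R i {x} {y} {z} b r = ∨-introʳ {ball R i x z} (∃ᵇ-intro y (∧-intro b r))

  ball-split : ∀ (R : Edges n) i j {x y} → ball R (j + i) x y ≡ true → ∃ λ z → ball R i x z ≡ true × ball R j z y ≡ true
  ball-split R i zero    {y = y} b = y , b , ==-refl
  ball-split R i (suc j) {x} {y} b with ∨-elim {ball R (j + i) x y} b
  ... | inj₁ c = let z , p , q = ball-split R i j c in z , p , ∨-introˡ q
  ... | inj₂ c = let u , w = ∃ᵇ-elim c ; a , r = ∧-elim w ; z , p , q = ball-split R i j a in z , p , ball-step R j q r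

  ball⇒reach : ∀ (R : Edges n) t {x y} → ball R (2 ^ t) x y ≡ true → reach R t x y ≡ true
  ball⇒reach R zero    {x} {y} b with ∨-elim {x == y} b
  ... | inj₁ e = ∨-introˡ e
  ... | inj₂ w = let z , h = ∃ᵇ-elim w ; e , r = ∧-elim h in
    ∨-introʳ {x == y} (subst (λ u → R u y ≡ true) (sym (==-elim e)) r)
  ball⇒reach R (suc t) {x} {y} b =
    let z , p , q = ball-split R (2 ^ t) (2 ^ t) (subst (λ m → ball R (2 ^ t + m) x y ≡ true) (+-identityʳ _) b)
    in ∃ᵇ-intro z (∧-intro (ball⇒reach R t p) (ball⇒reach R t q))

  Stable : Edges n → Fin n → ℕ → Set
  Stable R x j = ∀ y → ball R (suc j) x y ≡ true → ball R j x y ≡ true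

  -- Until the ball is stationary every step adds a vertex, and radius 0 already provides one. With
  -- i = n the second alternative is impossible.
  stabilise : ∀ (R : Edges n) x i → (∃ λ j → j < i × Stable R x j) ⊎ (i < count (ball R i x))
  stabilise R x zero = inj₂ (count-pos x ==-refl)
  stabilise R x (suc i) with stabilise R x i
  ... | inj₁ (j , lt , s) = inj₁ (j , m<n⇒m<1+n lt , s)
  ... | inj₂ big with split (∃ᵇ λ y → ball R (suc i) x y ∧ not (ball R i x y))
  ...   | inj₁ w = let y , h = ∃ᵇ-elim w ; a , b = ∧-elim h in
            inj₂ (≤-trans (s≤s big) (count-strict {P = ball R i x} (λ z → ∨-introˡ) y a (not-elim b)))
  ...   | inj₂ none = inj₁ (i , n<1+n i , λ y h → not-false (≢true⇒false λ q → clash (∧-intro h q) (∃ᵇ-false none y)))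

module Reach {n : ℕ} (t : ℕ) (big : n ≤ 2 ^ t) (R : Edges n) where

  private
    stable : ∀ x → ∃ λ j → j < n × Stable R x j
    stable x with stabilise R x n
    ... | inj₁ s  = s
    ... | inj₂ lt = ⊥-elim (<-irrefl refl (<-≤-trans lt (count≤n _)))

    closed : ∀ x u v → ball R (proj₁ (stable x)) x u ≡ true → R u v ≡ true → ball R (proj₁ (stable x)) x v ≡ true
    closed x u v b r = proj₂ (proj₂ (stable x)) v (ball-step R (proj₁ (stable x)) b r)

    to-ball : ∀ {x y} → reach R t x y ≡ true → ball R (proj₁ (stable x)) x y ≡ true
    to-ball {x} = reach-elim R t (λ y → ball R (proj₁ (stable x)) x y ≡ true) (closed x) (ball-mono R {0} {proj₁ (stable x)} z≤n (==-refl {x = x}))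

    of-ball : ∀ {x y} → ball R (proj₁ (stable x)) x y ≡ true → reach R t x y ≡ true
    of-ball {x} b = ball⇒reach R t (ball-mono R (≤-trans (<⇒≤ (proj₁ (proj₂ (stable x)))) big) b)

  reach-refl : ∀ x → reach R t x x ≡ true
  reach-refl x = of-ball {x} (ball-mono R {0} {proj₁ (stable x)} z≤n (==-refl {x = x}))

  reach-snoc : ∀ {x y z} → reach R t x y ≡ true → R y z ≡ true → reach R t x z ≡ true
  reach-snoc {x} {y} {z} r e = of-ball {x} (closed x y z (to-ball {x} r) e)

  reach-step : ∀ {x y} → R x y ≡ true → reach R t x y ≡ true
  reach-step {x} = reach-snoc (reach-refl x)

  reach-trans : ∀ {x y z} → reach R t x y ≡ true → reach R t y z ≡ true → reach R t x z ≡ true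
  reach-trans {x} = reach-elim R t (λ z → reach R t x z ≡ true) (λ u v → reach-snoc {x} {u} {v})

  reach-sym : (∀ u v → R u v ≡ true → R v u ≡ true) → ∀ {x y} → reach R t x y ≡ true → reach R t y x ≡ true
  reach-sym s {x} = reach-elim R t (λ z → reach R t z x ≡ true)
    (λ u v c e → reach-trans {v} {u} {x} (reach-step {v} {u} (s u v e)) c) (reach-refl x)

-- Matching isomorphic blocks

record IsEquiv {n} (R : Edges n) : Set where
  field
    rfl  : ∀ x → R x x ≡ true
    symm : ∀ {x y} → R x y ≡ true → R y x ≡ true
    tran : ∀ {x y z} → R x y ≡ true → R y z ≡ true → R x z ≡ true

  class-≡ : ∀ {x y} → R x y ≡ true → ∀ z → R x z ≡ R y z
  class-≡ r z = Bool-ext (tran (symm r)) (tran r)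

module Blocks {n} {L : Set} (E E′ bl bl′ : Edges n) (lab lab′ : Fin n → L) (eqv : IsEquiv bl) (eqv′ : IsEquiv bl′) where

  open IsEquiv eqv
  open IsEquiv eqv′ using () renaming (rfl to rfl′; symm to symm′; tran to tran′; class-≡ to class-≡′)

  record BIso (v w : Fin n) : Set where
    field
      π    : Perm {n}
      onB  : ∀ x → bl v x ≡ bl′ w (π ⟨$⟩ʳ x)
      edge : ∀ x y → bl v x ≡ true → bl v y ≡ true → E x y ≡ E′ (π ⟨$⟩ʳ x) (π ⟨$⟩ʳ y)
      labs : ∀ x → bl v x ≡ true → lab x ≡ lab′ (π ⟨$⟩ʳ x)

  open BIso

  move : ∀ {v w v₂ w₂} → BIso v w → bl v v₂ ≡ true → bl′ w w₂ ≡ true → BIso v₂ w₂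
  move b p q = record
    { π = π b
    ; onB = λ x → trans (sym (class-≡ p x)) (trans (onB b x) (class-≡′ q _))
    ; edge = λ x y bx by → edge b x y (tran p bx) (tran p by)
    ; labs = λ x bx → labs b x (tran p bx) }

  -- Block isomorphisms lead from the first graph to the second, so two of them compose only through
  -- the inverse of a third.
  zigzag : ∀ {x w v z} → BIso x w → BIso v w → BIso v z → BIso x z
  zigzag {x} {w} {v} {z} a b c = record
    { π = π a ∘ₚ Perm.flip (π b) ∘ₚ π c
    ; onB = λ y → trans (onB a y) (trans (sym (back y)) (onB c _))
    ; edge = λ y y′ h h′ → trans (edge a y y′ h h′) (trans
        (sym (trans (edge b _ _ (via y h) (via y′ h′)) (cong₂ E′ (inverseʳ (π b)) (inverseʳ (π b)))))
        (edge c _ _ (via y h) (via y′ h′)))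
    ; labs = λ y h → trans (labs a y h) (trans (sym (trans (labs b _ (via y h)) (cong lab′ (inverseʳ (π b))))) (labs c _ (via y h))) }
    where
    back : ∀ y → bl v (π b ⟨$⟩ˡ (π a ⟨$⟩ʳ y)) ≡ bl′ w (π a ⟨$⟩ʳ y)
    back y = trans (onB b _) (cong (bl′ w) (inverseʳ (π b)))
    via : ∀ y → bl x y ≡ true → bl v (π b ⟨$⟩ˡ (π a ⟨$⟩ʳ y)) ≡ true
    via y h = trans (back y) (trans (sym (onB a y)) h)

  Matches : (P P′ : Fin n → Bool) → Perm {n} → Set
  Matches P P′ f = (∀ x → P x ≡ P′ (f ⟨$⟩ʳ x)) × (∀ x → P x ≡ true → BIso x (f ⟨$⟩ʳ x))

  -- Exchanging the images of an element mapped wrongly into the block of w and of an element mapped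
  -- wrongly out of it keeps every element with an isomorphic block.
  rewire : ∀ {P P′ : Fin n → Bool} {v w} → (∀ {x} → bl v x ≡ true → P x ≡ true) → (∀ {x} → bl′ w x ≡ true → P′ x ≡ true) →
    BIso v w → ∀ N f → Matches P P′ f → count (λ x → not (bl v x) ∧ bl′ w (f ⟨$⟩ʳ x)) ≤ N →
    Σ (Perm {n}) λ g → Matches P P′ g × (∀ x → P x ≡ false → g ⟨$⟩ʳ x ≡ f ⟨$⟩ʳ x) × (∀ x → bl v x ≡ bl′ w (g ⟨$⟩ʳ x))
  rewire {P} {P′} {v} {w} cl cl′ b N f (mP , mI) le with split (∃ᵇ λ x → not (bl v x) ∧ bl′ w (f ⟨$⟩ʳ x))
  ... | inj₂ none = f , (mP , mI) , (λ _ _ → refl) , λ x → Bool-ext (count-≡⇒⊆ inside sizes x) (inside x)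
    where
    inside : ∀ x → bl′ w (f ⟨$⟩ʳ x) ≡ true → bl v x ≡ true
    inside x h = not-false (≢true⇒false λ q → clash (∧-intro q h) (∃ᵇ-false none x))
    sizes : count (λ x → bl′ w (f ⟨$⟩ʳ x)) ≡ count (bl v)
    sizes = trans (count-perm (bl′ w) f) (sym (count-perm′ (bl v) (bl′ w) (π b) (onB b)))
  rewire {P} {P′} {v} {w} cl cl′ b zero f m le | inj₁ some =
    ⊥-elim (<-irrefl refl (<-≤-trans (count-pos _ (proj₂ (∃ᵇ-elim some))) le))
  rewire {P} {P′} {v} {w} cl cl′ b (suc N) f (mP , mI) le | inj₁ some =
    let g , m , off , on = rewire cl cl′ b N f₁ (mP₁ , mI₁) (≤-pred (≤-trans fewer le))
    in g , m , (λ z h → trans (off z h) (cong (f ⟨$⟩ʳ_) (swapF-other x y z (λ { refl → clash Px h }) (λ { refl → clash Py h })))) , on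
    where
    x = proj₁ (∃ᵇ-elim some)
    x-bad = ∧-elim {not (bl v x)} (proj₂ (∃ᵇ-elim some))
    -- The blocks of `v` and `w` have the same size. If `f` sent the whole block of `v` into that of
    -- `w`, no room would be left there for the image of `x`.
    partner : ∃ λ y → bl v y ≡ true × bl′ w (f ⟨$⟩ʳ y) ≡ false
    partner with split (∃ᵇ λ y → bl v y ∧ not (bl′ w (f ⟨$⟩ʳ y)))
    ... | inj₁ h = let y , q = ∃ᵇ-elim h ; q₁ , q₂ = ∧-elim q in y , q₁ , not-elim q₂
    ... | inj₂ h = clash (count-≡⇒⊆ {P = bl v} {λ y → bl′ w (f ⟨$⟩ʳ y)}
             (λ y q → not-false (≢true⇒false λ r → clash (∧-intro q r) (∃ᵇ-false h y)))
             (trans (count-perm′ (bl v) (bl′ w) (π b) (onB b)) (sym (count-perm (bl′ w) f))) x (proj₂ x-bad)) (not-elim (proj₁ x-bad))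
    y = proj₁ partner
    f₁ = swap x y ∘ₚ f
    Px : P x ≡ true
    Px = trans (mP x) (cl′ (proj₂ x-bad))
    Py : P y ≡ true
    Py = cl (proj₁ (proj₂ partner))
    data Pos (z : Fin n) : Set where
      at-x  : z ≡ x → Pos z
      at-y  : z ≡ y → Pos z
      other : f₁ ⟨$⟩ʳ z ≡ f ⟨$⟩ʳ z → x ≢ z → Pos z
    pos : ∀ z → Pos z
    pos z with split (x == z) | split (y == z)
    ... | inj₁ e | _      = at-x (sym (==-elim e))
    ... | inj₂ _ | inj₁ e = at-y (sym (==-elim e))
    ... | inj₂ p | inj₂ q = other (cong (f ⟨$⟩ʳ_) (swapF-other x y z (==-≢ p) (==-≢ q))) (==-≢ p)
    f₁x : f₁ ⟨$⟩ʳ x ≡ f ⟨$⟩ʳ y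
    f₁x = cong (f ⟨$⟩ʳ_) (swapF-a x y)
    f₁y : f₁ ⟨$⟩ʳ y ≡ f ⟨$⟩ʳ x
    f₁y = cong (f ⟨$⟩ʳ_) (swapF-b x y)
    mP₁ : ∀ z → P z ≡ P′ (f₁ ⟨$⟩ʳ z)
    mP₁ z with pos z
    ... | at-x refl  = trans Px (trans (sym Py) (trans (mP y) (cong P′ (sym f₁x))))
    ... | at-y refl  = trans Py (trans (sym Px) (trans (mP x) (cong P′ (sym f₁y))))
    ... | other e _  = trans (mP z) (cong P′ (sym e))
    mI₁ : ∀ z → P z ≡ true → BIso z (f₁ ⟨$⟩ʳ z)
    mI₁ z h with pos z
    ... | at-x refl  = subst (BIso x) (sym f₁x)
            (zigzag (move (mI x Px) (rfl x) (symm′ (proj₂ x-bad))) b (move (mI y Py) (symm (proj₁ (proj₂ partner))) (rfl′ _)))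
    ... | at-y refl  = subst (BIso y) (sym f₁y) (move b (proj₁ (proj₂ partner)) (proj₂ x-bad))
    ... | other e _  = subst (BIso z) (sym e) (mI z h)
    fewer : count (λ z → not (bl v z) ∧ bl′ w (f₁ ⟨$⟩ʳ z)) < count (λ z → not (bl v z) ∧ bl′ w (f ⟨$⟩ʳ z))
    fewer = count-strict sub x (proj₂ (∃ᵇ-elim some))
      (≢true⇒false λ h → clash (subst (λ u → bl′ w u ≡ true) f₁x (proj₂ (∧-elim {not (bl v x)} h))) (proj₂ (proj₂ partner)))
      where
      sub : ∀ z → not (bl v z) ∧ bl′ w (f₁ ⟨$⟩ʳ z) ≡ true → not (bl v z) ∧ bl′ w (f ⟨$⟩ʳ z) ≡ true
      sub z h with pos z
      ... | at-x refl = proj₂ (∃ᵇ-elim some)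
      ... | at-y refl = clash (proj₁ (proj₂ partner)) (not-elim (proj₁ (∧-elim h)))
      ... | other e _ = let h₁ , h₂ = ∧-elim {not (bl v z)} h in ∧-intro h₁ (subst (λ u → bl′ w u ≡ true) e h₂)

  record Glued (P P′ : Fin n → Bool) (f : Perm {n}) : Set where
    field
      Φ       : Perm {n}
      onP     : ∀ x → P x ≡ P′ (Φ ⟨$⟩ʳ x)
      outside : ∀ x → P x ≡ false → Φ ⟨$⟩ʳ x ≡ f ⟨$⟩ʳ x
      blocks  : ∀ x y → P x ≡ true → bl x y ≡ bl′ (Φ ⟨$⟩ʳ x) (Φ ⟨$⟩ʳ y)
      edges   : ∀ x y → P x ≡ true → bl x y ≡ true → E x y ≡ E′ (Φ ⟨$⟩ʳ x) (Φ ⟨$⟩ʳ y)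
      labels  : ∀ x → P x ≡ true → lab x ≡ lab′ (Φ ⟨$⟩ʳ x)

  open Glued

  -- Duplicator's bijection matches vertices with isomorphic blocks but may scatter a block over
  -- several others. `rewire` makes it map one block onto its partner; there the block isomorphism
  -- replaces it, and the remaining blocks are treated by recursion.
  glue-blocks : ∀ N (P P′ : Fin n → Bool) → count P ≤ N →
    (∀ {x y} → P x ≡ true → bl x y ≡ true → P y ≡ true) → (∀ {x y} → P′ x ≡ true → bl′ x y ≡ true → P′ y ≡ true) →
    ∀ f → Matches P P′ f → Glued P P′ f
  glue-blocks N P P′ le cl cl′ f (mP , mI) with split (∃ᵇ P)
  ... | inj₂ none = record
    { Φ = f ; onP = mP ; outside = λ _ _ → refl
    ; blocks = λ x y p → clash p (∃ᵇ-false none x) ; edges = λ x y p → clash p (∃ᵇ-false none x) ; labels = λ x p → clash p (∃ᵇ-false none x) }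
  glue-blocks zero P P′ le cl cl′ f m | inj₁ some = ⊥-elim (<-irrefl refl (<-≤-trans (count-pos _ (proj₂ (∃ᵇ-elim some))) le))
  glue-blocks (suc N) P P′ le cl cl′ f (mP , mI) | inj₁ some = record
    { Φ = Φ₂ ; onP = onP₂ ; outside = outside₂ ; blocks = blocks₂ ; edges = edges₂ ; labels = labels₂ }
    where
    v = proj₁ (∃ᵇ-elim some)
    Pv = proj₂ (∃ᵇ-elim some)
    w = f ⟨$⟩ʳ v
    P′w : P′ w ≡ true
    P′w = trans (sym (mP v)) Pv
    b = mI v Pv
    re = rewire {P} {P′} (cl Pv) (cl′ P′w) b _ f (mP , mI) ≤-refl
    g = proj₁ re
    g-P = proj₁ (proj₁ (proj₂ re))
    g-I = proj₂ (proj₁ (proj₂ re))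
    g-off = proj₁ (proj₂ (proj₂ re))
    g-bl = proj₂ (proj₂ (proj₂ re))
    Q Q′ : Fin n → Bool
    Q x = P x ∧ not (bl v x)
    Q′ x = P′ x ∧ not (bl′ w x)
    rec : Glued Q Q′ g
    rec = glue-blocks N Q Q′
      (≤-pred (≤-trans (count-strict (λ x h → proj₁ (∧-elim h)) v Pv (≢true⇒false λ h → clash (rfl v) (not-elim (proj₂ (∧-elim {P v} h))))) le))
      (λ {x} {y} h r → let h₁ , h₂ = ∧-elim h in ∧-intro (cl h₁ r) (not-intro (≢true⇒false λ q → clash (tran q (symm r)) (not-elim h₂))))
      (λ {x} {y} h r → let h₁ , h₂ = ∧-elim h in ∧-intro (cl′ h₁ r) (not-intro (≢true⇒false λ q → clash (tran′ q (symm′ r)) (not-elim h₂))))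
      g ((λ x → cong₂ _∧_ (g-P x) (cong not (g-bl x))) , λ x h → g-I x (proj₁ (∧-elim h)))
    Φ₁ = Φ rec
    Φ₁-bl : ∀ x → bl v x ≡ bl′ w (Φ₁ ⟨$⟩ʳ x)
    Φ₁-bl x with split (Q x)
    ... | inj₁ q = trans (not-elim (proj₂ (∧-elim {P x} q))) (sym (not-elim (proj₂ (∧-elim {P′ (Φ₁ ⟨$⟩ʳ x)} (trans (sym (onP rec x)) q)))))
    ... | inj₂ q = trans (g-bl x) (cong (bl′ w) (sym (outside rec x q)))
    joined = glue (bl v) (bl′ w) (π b) Φ₁ (onB b) Φ₁-bl
    Φ₂ = proj₁ joined
    Φ₂-in : ∀ x → bl v x ≡ true → Φ₂ ⟨$⟩ʳ x ≡ π b ⟨$⟩ʳ x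
    Φ₂-in = proj₁ (proj₂ joined)
    Φ₂-out : ∀ x → bl v x ≡ false → Φ₂ ⟨$⟩ʳ x ≡ Φ₁ ⟨$⟩ʳ x
    Φ₂-out = proj₂ (proj₂ joined)
    Φ₂-bl : ∀ x → bl v x ≡ bl′ w (Φ₂ ⟨$⟩ʳ x)
    Φ₂-bl x with split (bl v x)
    ... | inj₁ h = trans (onB b x) (cong (bl′ w) (sym (Φ₂-in x h)))
    ... | inj₂ h = trans (Φ₁-bl x) (cong (bl′ w) (sym (Φ₂-out x h)))
    onP₂ : ∀ x → P x ≡ P′ (Φ₂ ⟨$⟩ʳ x)
    onP₂ x with split (bl v x)
    ... | inj₁ h = trans (cl Pv h) (sym (cl′ P′w (trans (sym (Φ₂-bl x)) h)))
    ... | inj₂ h = trans (Bool-ext (λ p → let q = ∧-intro p (not-intro h) in proj₁ (∧-elim (trans (sym (onP rec x)) q)))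
                          (λ p′ → proj₁ (∧-elim (trans (onP rec x) (∧-intro p′ (not-intro (trans (sym (Φ₁-bl x)) h)))))))
                         (cong P′ (sym (Φ₂-out x h)))
    outside₂ : ∀ x → P x ≡ false → Φ₂ ⟨$⟩ʳ x ≡ f ⟨$⟩ʳ x
    outside₂ x p = trans (Φ₂-out x (≢true⇒false λ h → clash (cl Pv h) p))
      (trans (outside rec x (≢true⇒false λ q → clash (proj₁ (∧-elim q)) p)) (g-off x p))
    ∉bl : ∀ {x y} → bl v x ≡ false → bl x y ≡ true → bl v y ≡ false
    ∉bl h r = ≢true⇒false λ q → clash (tran q (symm r)) h
    blocks₂ : ∀ x y → P x ≡ true → bl x y ≡ bl′ (Φ₂ ⟨$⟩ʳ x) (Φ₂ ⟨$⟩ʳ y)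
    blocks₂ x y p with split (bl v x) | split (bl v y)
    ... | inj₁ h | _ = trans (sym (class-≡ h y)) (trans (Φ₂-bl y) (class-≡′ (trans (sym (Φ₂-bl x)) h) _))
    ... | inj₂ h | inj₁ h′ = trans (≢true⇒false λ r → clash (tran h′ (symm r)) h)
            (sym (≢true⇒false λ r → clash (tran′ (trans (sym (Φ₂-bl y)) h′) (symm′ r)) (trans (sym (Φ₂-bl x)) h)))
    ... | inj₂ h | inj₂ h′ = trans (blocks rec x y (∧-intro p (not-intro h))) (cong₂ bl′ (sym (Φ₂-out x h)) (sym (Φ₂-out y h′)))
    edges₂ : ∀ x y → P x ≡ true → bl x y ≡ true → E x y ≡ E′ (Φ₂ ⟨$⟩ʳ x) (Φ₂ ⟨$⟩ʳ y)
    edges₂ x y p r with split (bl v x)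
    ... | inj₁ h = trans (edge b x y h (tran h r)) (cong₂ E′ (sym (Φ₂-in x h)) (sym (Φ₂-in y (tran h r))))
    ... | inj₂ h = trans (edges rec x y (∧-intro p (not-intro h)) r) (cong₂ E′ (sym (Φ₂-out x h)) (sym (Φ₂-out y (∉bl h r))))
    labels₂ : ∀ x → P x ≡ true → lab x ≡ lab′ (Φ₂ ⟨$⟩ʳ x)
    labels₂ x p with split (bl v x)
    ... | inj₁ h = trans (labs b x h) (cong lab′ (sym (Φ₂-in x h)))
    ... | inj₂ h = trans (labels rec x (∧-intro p (not-intro h))) (cong lab′ (sym (Φ₂-out x h)))

-- Chordal graphs

within : ∀ {n} → Edges n → (Fin n → Bool) → Edges n
within E M u v = E u v ∧ (M u ∧ M v)

module Paths {n} (E : Edges n) (sy : ∀ u v → E u v ≡ E v u) (irr : ∀ u → E u u ≡ false) where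

  adj-sym : ∀ {u v} → E u v ≡ true → E v u ≡ true
  adj-sym {u} {v} h = trans (sy v u) h

  adj-≢ : ∀ {u v} → E u v ≡ true → u ≢ v
  adj-≢ {u} h refl = clash h (irr u)

  Far : Fin n → Fin n → Set
  Far x z = E x z ≡ false × x ≢ z

  Induced : Fin n → List (Fin n) → Set
  Induced x []       = ⊤
  Induced x (y ∷ ys) = E x y ≡ true × All (Far x) ys × Induced y ys

  far-at : ∀ {x ys} → All (Far x) ys → ∀ i → Far x (List.lookup ys i)
  far-at (f ∷ fs) zero    = f
  far-at (f ∷ fs) (suc i) = far-at fs i

  induced-adj : ∀ x xs → Induced x xs → ∀ i j → E (List.lookup (x ∷ xs) i) (List.lookup (x ∷ xs) j) ≡ true →
                suc (toℕ i) ≡ toℕ j ⊎ suc (toℕ j) ≡ toℕ i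
  induced-adj x xs       p             zero          zero          e = clash e (irr x)
  induced-adj x (y ∷ ys) p             zero          (suc zero)    e = inj₁ refl
  induced-adj x (y ∷ ys) (_ , f , _)   zero          (suc (suc j)) e = clash e (proj₁ (far-at f j))
  induced-adj x (y ∷ ys) p             (suc zero)    zero          e = inj₂ refl
  induced-adj x (y ∷ ys) (_ , f , _)   (suc (suc i)) zero          e = clash (adj-sym e) (proj₁ (far-at f i))
  induced-adj x (y ∷ ys) (_ , _ , p)   (suc i)       (suc j)       e with induced-adj y ys p i j e
  ... | inj₁ h = inj₁ (cong suc h)
  ... | inj₂ h = inj₂ (cong suc h)

  induced-edge : ∀ x xs → Induced x xs → ∀ i j → suc (toℕ i) ≡ toℕ j → E (List.lookup (x ∷ xs) i) (List.lookup (x ∷ xs) j) ≡ true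
  induced-edge x (y ∷ ys) (e , _)     zero    (suc zero)    h = e
  induced-edge x (y ∷ ys) (_ , _ , p) (suc i) (suc j)       h = induced-edge y ys p i j (suc-injective h)
  induced-edge x []       p           zero    zero          ()

  induced-distinct : ∀ x xs → Induced x xs → ∀ j → x ≢ List.lookup xs j
  induced-distinct x (y ∷ ys) (e , _)     zero    h = adj-≢ e h
  induced-distinct x (y ∷ ys) (_ , f , _) (suc j) h = proj₂ (far-at f j) h

  induced-inj : ∀ x xs → Induced x xs → ∀ i j → List.lookup (x ∷ xs) i ≡ List.lookup (x ∷ xs) j → i ≡ j
  induced-inj x xs       p zero    zero    h = refl
  induced-inj x xs       p zero    (suc j) h = ⊥-elim (induced-distinct x xs p j h)
  induced-inj x xs       p (suc i) zero    h = ⊥-elim (induced-distinct x xs p i (sym h))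
  induced-inj x (y ∷ ys) (_ , _ , p) (suc i) (suc j) h = cong suc (induced-inj y ys p i j h)

  module _ (D : Fin n → Bool) where

    -- Induced paths in D of which only the last vertex e is adjacent to b.
    data Path (b e : Fin n) : Fin n → List (Fin n) → Set where
      end  : D e ≡ true → E e b ≡ true → Path b e e []
      step : ∀ {x y ys} → D x ≡ true → E x y ≡ true → All (Far x) ys → E x b ≡ false → Path b e y ys → Path b e x (y ∷ ys)

    path-head : ∀ {b e x xs} → Path b e x xs → D x ≡ true
    path-head (end d _)        = d
    path-head (step d _ _ _ _) = d

    path-end : ∀ {b e x xs} → Path b e x xs → D e ≡ true × E e b ≡ true
    path-end (end d a)        = d , a
    path-end (step _ _ _ _ p) = path-end p

    path-induced : ∀ {b e x xs} → Path b e x xs → Induced x xs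
    path-induced (end _ _)        = _
    path-induced (step _ a f _ p) = a , f , path-induced p

    Found : Fin n → Fin n → Fin n → Set
    Found b e x = (∃ λ ys → Path b e x ys) ⊎ (∃ λ y → ∃ λ ys → Path b e y ys × E x y ≡ true × All (Far x) ys)

    -- Leaving the path at its last vertex that is equal or adjacent to x keeps the resulting path induced.
    search : ∀ {b e y ys} x → Path b e y ys → Found b e x ⊎ All (Far x) (y ∷ ys)
    visit : ∀ {b e y ys} x → Path b e y ys → All (Far x) ys → Found b e x ⊎ All (Far x) (y ∷ ys)
    visit {y = y} {ys} x p f with split (x == y) | split (E x y)
    ... | inj₁ e | _      = inj₁ (inj₁ (ys , subst (λ z → Path _ _ z ys) (sym (==-elim e)) p))
    ... | inj₂ _ | inj₁ a = inj₁ (inj₂ (y , ys , p , a , f))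
    ... | inj₂ e | inj₂ a = inj₂ ((a , ==-≢ e) ∷ f)
    search x (end d a) = visit x (end d a) []
    search x (step d a f e p) with search x p
    ... | inj₁ w = inj₁ w
    ... | inj₂ g = visit x (step d a f e p) g

    path-last : ∀ {b e x xs} → Path b e x xs → ∀ i → E (List.lookup (x ∷ xs) i) b ≡ true → suc (toℕ i) ≡ length (x ∷ xs)
    path-last (end _ _)        zero    h = refl
    path-last (step _ _ _ c _) zero    h = clash h c
    path-last (step _ _ _ _ p) (suc i) h = cong suc (path-last p i h)

    last-adj : ∀ {b e x xs} → Path b e x xs → ∀ i → suc (toℕ i) ≡ length (x ∷ xs) → E (List.lookup (x ∷ xs) i) b ≡ true
    last-adj (end _ a)        zero    h = a
    last-adj (step _ _ _ _ p) (suc i) h = last-adj p i (suc-injective h)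

    path-∈ : ∀ {b e x xs} → Path b e x xs → ∀ i → D (List.lookup (x ∷ xs) i) ≡ true
    path-∈ p zero = path-head p
    path-∈ (step _ _ _ _ p) (suc i) = path-∈ p i

    module _ (chordal : Chordal ⟦ E ⟧) where

      -- An induced path with at least two vertices, of which only the first is adjacent to `a` and
      -- only the last to `b`, closes with the edge `a b` to an induced cycle of length at least 4.
      no-chordless : ∀ {a b e y z zs} → E a b ≡ true → D a ≡ false → D b ≡ false →
        Path b e y (z ∷ zs) → E a y ≡ true → All (Far a) (z ∷ zs) → ⊥
      no-chordless {a} {b} {e} {y} {z} {zs} ab Da Db p ay far = chordless (chordal len (s≤s (s≤s (s≤s (s≤s z≤n)))) cycle)
        where
        G = ⟦ E ⟧
        ws = y ∷ z ∷ zs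
        len = suc (suc (length ws))
        ind : Induced a ws
        ind = ay , far , path-induced p
        vtx : Fin len → Fin n
        vtx = List.lookup (b ∷ a ∷ ws)
        b≢ : ∀ i → b ≢ List.lookup (a ∷ ws) i
        b≢ zero    h = adj-≢ ab (sym h)
        b≢ (suc i) h = clash (path-∈ p i) (subst (λ v → D v ≡ false) h Db)
        inj : ∀ i j → vtx i ≡ vtx j → i ≡ j
        inj zero    zero    h = refl
        inj zero    (suc j) h = ⊥-elim (b≢ j h)
        inj (suc i) zero    h = ⊥-elim (b≢ i (sym h))
        inj (suc i) (suc j) h = cong suc (induced-inj a ws ind i j h)
        edge-b : ∀ j → Consecutive {len} (suc j) zero → E (List.lookup (a ∷ ws) j) b ≡ true
        edge-b zero    c = ab
        edge-b (suc j) (inj₂ (inj₁ ()))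
        edge-b (suc j) (inj₂ (inj₂ (inj₁ ())))
        edge-b (suc j) (inj₂ (inj₂ (inj₂ (_ , h)))) = last-adj p j (suc-injective (suc-injective h))
        flip : ∀ {l} {i j : Fin l} → Consecutive i j → Consecutive j i
        flip (inj₁ h) = inj₂ (inj₁ h)
        flip (inj₂ (inj₁ h)) = inj₁ h
        flip (inj₂ (inj₂ (inj₁ h))) = inj₂ (inj₂ (inj₂ h))
        flip (inj₂ (inj₂ (inj₂ h))) = inj₂ (inj₂ (inj₁ h))
        edge : ∀ i j → Consecutive i j → E (vtx i) (vtx j) ≡ true
        edge zero    zero    (inj₁ ())
        edge zero    zero    (inj₂ (inj₁ ()))
        edge zero    zero    (inj₂ (inj₂ (inj₁ (_ , ()))))
        edge zero    zero    (inj₂ (inj₂ (inj₂ (_ , ()))))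
        edge zero    (suc j) c = adj-sym (edge-b j (flip {i = zero} {suc j} c))
        edge (suc i) zero    c = edge-b i c
        edge (suc i) (suc j) (inj₁ h) = induced-edge a ws ind i j (suc-injective h)
        edge (suc i) (suc j) (inj₂ (inj₁ h)) = adj-sym (induced-edge a ws ind j i (suc-injective h))
        edge (suc i) (suc j) (inj₂ (inj₂ (inj₁ (() , _))))
        edge (suc i) (suc j) (inj₂ (inj₂ (inj₂ (() , _))))
        cycle : Cycle G len
        cycle = record { vtx = vtx ; injective = inj ; edges = edge }
        chord-b : ∀ j → E (List.lookup (a ∷ ws) j) b ≡ true → Consecutive {len} (suc j) zero
        chord-b zero    h = inj₂ (inj₁ refl)
        chord-b (suc j) h = inj₂ (inj₂ (inj₂ (refl , cong (λ l → suc (suc l)) (path-last p j h))))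
        chordless : HasChord cycle → ⊥
        chordless (zero  , zero  , nc , ne , h) = ne refl
        chordless (zero  , suc j , nc , ne , h) = nc (flip {i = suc j} {zero} (chord-b j (adj-sym h)))
        chordless (suc i , zero  , nc , ne , h) = nc (chord-b i h)
        chordless (suc i , suc j , nc , ne , h) with induced-adj a ws ind i j h
        ... | inj₁ c = nc (inj₁ (cong suc c))
        ... | inj₂ c = nc (inj₂ (inj₁ (cong suc c)))

      -- Only the path from its last vertex adjacent to `a` onwards is kept. If that vertex were not
      -- already the end, the rest would close with `a` and `b` to a chordless cycle.
      path-end-adj : ∀ {a b c e cs} → Path b e c cs → E a c ≡ true → (a ≢ b → E a b ≡ true) → D a ≡ false → D b ≡ false → E e a ≡ true
      path-end-adj {a} {b} p ac ab Da Db with split (a == b)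
      ... | inj₁ h = subst (λ z → E _ z ≡ true) (sym (==-elim h)) (proj₂ (path-end p))
      ... | inj₂ h with search a p
      ...   | inj₂ (f ∷ _) = clash ac (proj₁ f)
      ...   | inj₁ (inj₁ (_ , q)) = clash (path-head q) Da
      ...   | inj₁ (inj₂ (y , [] , end _ _ , ay , _)) = adj-sym ay
      ...   | inj₁ (inj₂ (y , z ∷ zs , q , ay , far)) = ⊥-elim (no-chordless (ab (==-≢ h)) Da Db q ay far)

  module Apex t (big : n ≤ 2 ^ t) (chordal : Chordal ⟦ E ⟧) (M : Fin n → Bool) (d : Fin n) (Md : M d ≡ true) where

    D : Fin n → Bool
    D = reach (within E M) t d

    open Reach {n} t big (within E M)

    within-sym : ∀ u v → within E M u v ≡ true → within E M v u ≡ true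
    within-sym u v h = let a , b = ∧-elim h ; c , e = ∧-elim {M u} b in ∧-intro (adj-sym a) (∧-intro e c)

    D⊆M : ∀ {v} → D v ≡ true → M v ≡ true
    D⊆M = reach-elim (within E M) t (λ v → M v ≡ true) (λ u v _ h → proj₂ (∧-elim {M u} (proj₂ (∧-elim {E u v} h)))) Md

    D-closed : ∀ {u v} → D u ≡ true → E u v ≡ true → M v ≡ true → D v ≡ true
    D-closed du e m = reach-snoc {d} du (∧-intro e (∧-intro (D⊆M du) m))

    -- The path is grown backwards along a walk from `e` to `c`. A new vertex that sees `b` starts
    -- afresh as a path of one vertex; any other is attached to the last vertex of the path that it
    -- sees, unless it lies on the path already.
    path-from : ∀ {b e} → D e ≡ true → E e b ≡ true → ∀ {c} → D c ≡ true → ∃ λ e → ∃ λ cs → Path D b e c cs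
    path-from {b} {e} de eb {c} dc = reach-elim (within E M) t (λ u → ∃ λ e → ∃ λ us → Path D b e u us) extend (e , [] , end de eb)
      (reach-trans {e} {d} {c} (reach-sym within-sym {d} {e} de) dc)
      where
      extend : ∀ u v → (∃ λ e → ∃ λ us → Path D b e u us) → within E M u v ≡ true → ∃ λ e → ∃ λ vs → Path D b e v vs
      extend u v (e , us , p) h with ∧-elim h
      ... | uv , m with D-closed (path-head D p) uv (proj₂ (∧-elim {M u} m)) | search D v p | split (E v b)
      ...   | dv | _                                  | inj₁ vb = v , [] , end dv vb
      ...   | dv | inj₁ (inj₁ (vs , q))               | inj₂ _  = e , vs , q
      ...   | dv | inj₂ (f ∷ _)                       | inj₂ _  = clash (adj-sym uv) (proj₁ f)
      ...   | dv | inj₁ (inj₂ (y , ys , q , vy , far)) | inj₂ vb = e , y ∷ ys , step dv vy far vb q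

    touched : Fin n → Bool
    touched v = ∃ᵇ λ x → D x ∧ E x v

    module _ {K : Fin n → Bool} (clique : ∀ {u v} → K u ≡ true → K v ≡ true → u ≢ v → E u v ≡ true) (apart : ∀ {v} → K v ≡ true → D v ≡ false) where

      -- If `c` sees all of `vs`, an induced path inside `D` leads from `c` to a vertex seeing `b`.
      -- By `path-end-adj` its end sees all of `vs` as well, because these form a clique with `b`.
      apex-list : ∀ vs → All (λ v → K v ≡ true × touched v ≡ true) vs → ∃ λ c → D c ≡ true × All (λ v → E c v ≡ true) vs
      apex-list []       _ = d , reach-refl d , []
      apex-list (b ∷ vs) ((Kb , w) ∷ ks) =
        let c , dc , adj = apex-list vs ks
            e , h = ∃ᵇ-elim w
            de , eb = ∧-elim h
            e′ , cs , p = path-from de eb dc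
            de′ , eb′ = path-end D p
        in e′ , de′ , eb′ ∷ All.zipWith (λ { ((Ka , _) , ca) → path-end-adj D chordal p (adj-sym ca) (clique Ka Kb) (apart Ka) (apart Kb) }) (ks , adj)

      apex : ∃ λ c → D c ≡ true × (∀ {v} → K v ≡ true → touched v ≡ true → E c v ≡ true)
      apex = let c , dc , adj = apex-list (gather (allFin n)) (gather-good (allFin n)) in
             c , dc , λ {v} Kv tv → All.lookup adj (gather-∈ (allFin n) (∈-allFin v) Kv tv)
        where
        gather : List (Fin n) → List (Fin n)
        gather []       = []
        gather (v ∷ vs) with split (K v ∧ touched v)
        ... | inj₁ _ = v ∷ gather vs
        ... | inj₂ _ = gather vs
        gather-good : ∀ vs → All (λ v → K v ≡ true × touched v ≡ true) (gather vs)
        gather-good []       = []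
        gather-good (v ∷ vs) with split (K v ∧ touched v)
        ... | inj₁ h = ∧-elim h ∷ gather-good vs
        ... | inj₂ _ = gather-good vs
        gather-∈ : ∀ vs {v} → v ∈ₗ vs → K v ≡ true → touched v ≡ true → v ∈ₗ gather vs
        gather-∈ (v ∷ vs) i Kv tv with split (K v ∧ touched v)
        gather-∈ (v ∷ vs) (here refl) Kv tv | inj₁ _ = here refl
        gather-∈ (v ∷ vs) (there i)   Kv tv | inj₁ _ = there (gather-∈ vs i Kv tv)
        gather-∈ (v ∷ vs) (here refl) Kv tv | inj₂ h = clash (∧-intro Kv tv) h
        gather-∈ (v ∷ vs) (there i)   Kv tv | inj₂ _ = gather-∈ vs i Kv tv

  Simplicial : Fin n → Set
  Simplicial c = ∀ {u v} → E c u ≡ true → E c v ≡ true → u ≢ v → E u v ≡ true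

  module _ {t} (big : n ≤ 2 ^ t) (chordal : Chordal ⟦ E ⟧) where

    -- Dirac's argument on simplicial vertices. An apex `c` that is the only vertex of its component
    -- has its neighbourhood inside the clique `K`; otherwise `c` is removed and a component of the
    -- rest is considered, which is again bounded by a clique.
    simplicial-in : ∀ N M d (Md : M d ≡ true) → count (reach (within E M) t d) ≤ N → ∀ {K} →
      (∀ {u v} → K u ≡ true → K v ≡ true → u ≢ v → E u v ≡ true) →
      (∀ {v} → K v ≡ true → reach (within E M) t d v ≡ false) →
      (∀ {u v} → reach (within E M) t d u ≡ true → E u v ≡ true → reach (within E M) t d v ≡ false → K v ≡ true) →
      ∃ λ c → reach (within E M) t d c ≡ true × Simplicial c
    simplicial-in N M d Md le {K} clique apart border with Apex.apex t big chordal M d Md clique apart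
    ... | c , dc , adj with split (∃ᵇ (reach (within E M) t d ∖ c))
    ...   | inj₂ none = c , dc , λ {u} {v} cu cv → clique (nbr cu) (nbr cv)
      where
      nbr : ∀ {u} → E c u ≡ true → K u ≡ true
      nbr {u} cu = border dc cu (≢true⇒false λ du → clash (∖-intro du (adj-≢ cu)) (∃ᵇ-false none u))
    simplicial-in zero M d Md le {K} clique apart border | c , dc , adj | inj₁ some = ⊥-elim (<-irrefl refl (<-≤-trans (count-pos c dc) le))
    simplicial-in (suc N) M d Md le {K} clique apart border | c , dc , adj | inj₁ some =
      let e , de′ , s = simplicial-in N M′ d′ (proj₂ (∃ᵇ-elim some)) fewer {K′} clique′ apart′ border′ in e , inside e de′ , s
      where
      open Apex t big chordal M d Md using (D; D-closed; D⊆M; touched)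
      M′ : Fin n → Bool
      M′ = D ∖ c
      d′ = proj₁ (∃ᵇ-elim some)
      open Apex t big chordal M′ d′ (proj₂ (∃ᵇ-elim some)) using () renaming (D to D′; D⊆M to D′⊆M′; D-closed to D′-closed)
      inside : ∀ e → D′ e ≡ true → D e ≡ true
      inside e h = proj₁ (∖-elim (D′⊆M′ h))
      fewer : count D′ ≤ N
      fewer = ≤-pred (≤-trans (count-strict {P = D′} {D} inside c dc (≢true⇒false λ h → proj₂ (∖-elim (D′⊆M′ h)) refl)) le)
      -- The apex `c` sees every vertex of `K` that the component touches, so adding it to these
      -- keeps a clique.
      K′ : Fin n → Bool
      K′ v = (K v ∧ touched v) ∨ (c == v)
      clique′ : ∀ {u v} → K′ u ≡ true → K′ v ≡ true → u ≢ v → E u v ≡ true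
      clique′ {u} {v} hu hv ne with ∨-elim {K u ∧ touched u} hu | ∨-elim {K v ∧ touched v} hv
      ... | inj₁ p | inj₁ q = clique (proj₁ (∧-elim p)) (proj₁ (∧-elim q)) ne
      ... | inj₁ p | inj₂ q = subst (λ z → E u z ≡ true) (==-elim q) (adj-sym (adj (proj₁ (∧-elim p)) (proj₂ (∧-elim {K u} p))))
      ... | inj₂ p | inj₁ q = subst (λ z → E z v ≡ true) (==-elim p) (adj (proj₁ (∧-elim q)) (proj₂ (∧-elim {K v} q)))
      ... | inj₂ p | inj₂ q = ⊥-elim (ne (trans (sym (==-elim p)) (==-elim q)))
      apart′ : ∀ {v} → K′ v ≡ true → D′ v ≡ false
      apart′ {v} h = ≢true⇒false λ dv → case dv (∨-elim {K v ∧ touched v} h)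
        where
        case : D′ v ≡ true → K v ∧ touched v ≡ true ⊎ (c == v) ≡ true → ⊥
        case dv (inj₁ p) = clash (inside v dv) (apart (proj₁ (∧-elim p)))
        case dv (inj₂ p) = proj₂ (∖-elim (D′⊆M′ dv)) (==-elim p)
      border′ : ∀ {u v} → D′ u ≡ true → E u v ≡ true → D′ v ≡ false → K′ v ≡ true
      border′ {u} {v} du uv nv with split (c == v) | split (D v)
      ... | inj₁ e | _       = ∨-introʳ {K v ∧ touched v} e
      ... | inj₂ e | inj₁ dv = clash (D′-closed du uv (∖-intro dv (==-≢ e))) nv
      ... | inj₂ e | inj₂ dv = ∨-introˡ (∧-intro (border (inside u du) uv dv) (∃ᵇ-intro u (∧-intro (inside u du) uv)))

    simplicial-exists : ∀ d → ∃ λ c → reach (within E (λ _ → true)) t d c ≡ true × Simplicial c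
    simplicial-exists d = simplicial-in _ (λ _ → true) d refl ≤-refl {λ _ → false} (λ ()) (λ ())
      (λ du uv dv → clash (Apex.D-closed t big chordal (λ _ → true) d refl du uv refl) dv)

-- Parts

module _ {n : ℕ} (t : ℕ) (E : Edges n) where

  inS : (p q v : Fin n) → Bool
  inS p q v = E v p ∧ E v q

  avoiding : (p q : Fin n) → Edges n
  avoiding p q u v = E u v ∧ (not (inS p q u) ∧ not (inS p q v))

  inX : (p q v : Fin n) → Bool
  inX p q = reach (avoiding p q) t q

  core : (X S : Fin n → Bool) → Fin n → Bool
  core X S v = X v ∧ ∀ᵇ λ s → imp (S s) (E s v)

  inA : (p q v : Fin n) → Bool
  inA p q = core (inX p q) (inS p q)

  record Valid (p q : Fin n) : Set where
    field
      clique   : ∀ {u v} → u ∈ inS p q → v ∈ inS p q → u ≢ v → E u v ≡ true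
      nonempty : ∃ λ s → s ∈ inS p q
      outside  : p ∉ inX p q

  -- What the construction of children uses, freed from `p` and `q`, so that it also covers a whole
  -- component whose `S` is a single simplicial vertex. `linked` expresses the connectedness of `X`:
  -- a union of components of `X` without `A` has an edge to `A`.
  record Config (X S A : Fin n → Bool) : Set where
    field
      A⊆X    : ∀ {v} → v ∈ A → v ∈ X
      apart  : ∀ {v} → v ∈ X → v ∉ S
      border : ∀ {u v} → u ∈ X → E u v ≡ true → v ∈ X ⊎ v ∈ S
      clique : ∀ {u v} → S u ∨ A u ≡ true → S v ∨ A v ≡ true → u ≢ v → E u v ≡ true
      missed : ∀ {v} → v ∈ X → v ∉ A → ∃ λ s → s ∈ S × E s v ≡ false
      linked : ∀ {v} (C : Fin n → Bool) → v ∈ X → v ∈ C → (∀ {u} → u ∈ C → u ∉ A) →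
               (∀ {u w} → u ∈ C → E u w ≡ true → w ∈ X → w ∉ A → w ∈ C) →
               ∃ λ u → ∃ λ a → u ∈ C × a ∈ A × E u a ≡ true

  -- `p` lies in the old clique `S` but has no neighbour in the child, which makes it a leaf of
  -- several claws.
  record Child (X S A : Fin n → Bool) (d p q : Fin n) : Set where
    field
      valid  : Valid p q
      member : d ∈ inX p q
      below  : ∀ {v} → v ∈ inX p q → v ∈ X × v ∉ A
      border : ∀ {v} → v ∈ inS p q → S v ∨ A v ≡ true
      top    : p ∈ S

module Parts {n : ℕ} (t : ℕ) (big : n ≤ 2 ^ t) (E : Edges n) (sy : ∀ u v → E u v ≡ E v u) (irr : ∀ u → E u u ≡ false) where

  open Paths E sy irr

  non-adj-sym : ∀ {u v} → E u v ≡ false → E v u ≡ false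
  non-adj-sym {u} {v} h = trans (sy v u) h

  module _ (p q : Fin n) where

    private
      S = inS t E p q
      X = inX t E p q
      A = inA t E p q
    open Reach {n} t big (avoiding t E p q)

    q∉S : q ∉ S
    q∉S = ≢true⇒false λ h → clash (proj₂ (∧-elim {E q p} h)) (irr q)

    p∉S : p ∉ S
    p∉S = ≢true⇒false λ h → clash (proj₁ (∧-elim h)) (irr p)

    q∈X : q ∈ X
    q∈X = reach-refl q

    avoiding-sym : ∀ u v → avoiding t E p q u v ≡ true → avoiding t E p q v u ≡ true
    avoiding-sym u v h = let a , b = ∧-elim h ; c , d = ∧-elim {not (S u)} b in ∧-intro (adj-sym a) (∧-intro d c)

    X∉S : ∀ {v} → v ∈ X → v ∉ S
    X∉S = reach-elim (avoiding t E p q) t (_∉ S) (λ u v _ h → not-elim (proj₂ (∧-elim {not (S u)} (proj₂ (∧-elim {E u v} h))))) q∉S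

    X-step : ∀ {u v} → u ∈ X → E u v ≡ true → v ∉ S → v ∈ X
    X-step u∈ e v∉ = reach-snoc {q} u∈ (∧-intro e (∧-intro (not-intro (X∉S u∈)) (not-intro v∉)))

    X-border : ∀ {u v} → u ∈ X → E u v ≡ true → v ∈ X ⊎ v ∈ S
    X-border {u} {v} u∈ e with split (S v)
    ... | inj₁ s = inj₂ s
    ... | inj₂ s = inj₁ (X-step u∈ e s)

    -- Connectedness of `X` as an induction principle with an arbitrary starting point in `X`.
    X-elim : (C : Fin n → Set) → (∀ {u v} → C u → u ∈ X → E u v ≡ true → v ∈ X → C v) → ∀ {x y} → x ∈ X → y ∈ X → C x → C y
    X-elim C h {x} {y} x∈ y∈ c = proj₁ (reach-elim (avoiding t E p q) t (λ u → C u × u ∈ X)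
      (λ u v (c , u∈) r → let e = proj₁ (∧-elim r)
                              v∈ = X-step u∈ e (not-elim (proj₂ (∧-elim {not (S u)} (proj₂ (∧-elim {E u v} r)))))
                          in h c u∈ e v∈ , v∈)
      (c , x∈) (reach-trans {x} {q} {y} (reach-sym avoiding-sym {q} {x} x∈) y∈))

    q∈A : q ∈ A
    q∈A = ∧-intro q∈X (∀ᵇ-intro λ s → imp-intro λ h → proj₂ (∧-elim {E s p} h))

    A⊆X : ∀ {v} → v ∈ A → v ∈ X
    A⊆X h = proj₁ (∧-elim h)

    S-A : ∀ {s a} → s ∈ S → a ∈ A → E s a ≡ true
    S-A {s} {a} hs ha = imp-elim (∀ᵇ-elim (proj₂ (∧-elim {X a} ha)) s) hs

-- Invariance of definable sets

deg : ∀ {n} → Edges n → Fin n → ℕ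
deg E v = count (E v)

infixr 6 _∧₂_
infixr 5 _∨₂_

_∧₂_ : ∀ {a a′ b b′} → a ≡ a′ → b ≡ b′ → (a ∧ b) ≡ (a′ ∧ b′)
refl ∧₂ refl = refl

_∨₂_ : ∀ {a a′ b b′} → a ≡ a′ → b ≡ b′ → (a ∨ b) ≡ (a′ ∨ b′)
refl ∨₂ refl = refl

not₂ : ∀ {a a′} → a ≡ a′ → not a ≡ not a′
not₂ refl = refl

imp₂ : ∀ {a a′ b b′} → a ≡ a′ → b ≡ b′ → imp a b ≡ imp a′ b′
imp₂ refl refl = refl

iff₂ : ∀ {a a′ b b′} → a ≡ a′ → b ≡ b′ → iff a b ≡ iff a′ b′
iff₂ refl refl = refl

-- No tuple in the arguments below has more than eight entries, so twelve pebbles leave a margin.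
pebbles : ℕ
pebbles = 12

crossing : ∀ {n} → Edges n → (X A : Fin n → Bool) → Edges n
crossing E X A u v = E u v ∧ ((X u ∧ X v) ∧ not (A u ∧ A v))

-- the components of X once the edges inside A are removed
block : ∀ {n} → ℕ → Edges n → (X A : Fin n → Bool) → Edges n
block t E X A = reach (crossing E X A) t

module Transfer {n : ℕ} (t : ℕ) (E E′ : Edges n) where

  open Tuples pebbles {n}

  S-tr : ∀ {d p q v p′ q′ v′} → T d E E′ (p ∷ q ∷ v ∷ []) (p′ ∷ q′ ∷ v′ ∷ []) → inS t E p q v ≡ inS t E′ p′ q′ v′
  S-tr τ = T-edge τ 2F 0F ∧₂ T-edge τ 2F 1F

  -- Four parameters fit all uses: two vertices for the root of a heavy chain and two for the
  -- current part. Simpler sets repeat entries.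
  SetTr : ℕ → (a b c e a′ b′ c′ e′ : Fin n) → (P P′ : Fin n → Bool) → Set
  SetTr r a b c e a′ b′ c′ e′ P P′ = ∀ {v v′} → T r E E′ (v ∷ a ∷ b ∷ c ∷ e ∷ []) (v′ ∷ a′ ∷ b′ ∷ c′ ∷ e′ ∷ []) → P v ≡ P′ v′

  -- Each doubling takes one round for the midpoint, after which one endpoint is dropped; the depth
  -- grows by 1 and the number of pebbles not at all.
  reach-tr : ∀ {r a b c e a′ b′ c′ e′} {R R′ : Edges n} →
    (∀ {u v u′ v′} → T r E E′ (u ∷ v ∷ a ∷ b ∷ c ∷ e ∷ []) (u′ ∷ v′ ∷ a′ ∷ b′ ∷ c′ ∷ e′ ∷ []) → R u v ≡ R′ u′ v′) →
    ∀ s {x y x′ y′} → T (s + r) E E′ (x ∷ y ∷ a ∷ b ∷ c ∷ e ∷ []) (x′ ∷ y′ ∷ a′ ∷ b′ ∷ c′ ∷ e′ ∷ []) → reach R s x y ≡ reach R′ s x′ y′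
  reach-tr h zero    τ = T-same τ 0F 1F ∨₂ h τ
  reach-tr h (suc s) τ = ∃-tr τ λ τz →
    reach-tr h s (T-sub τz (1F ∷ 0F ∷ 3F ∷ 4F ∷ 5F ∷ 6F ∷ [])) ∧₂ reach-tr h s (T-sub τz (0F ∷ 2F ∷ 3F ∷ 4F ∷ 5F ∷ 6F ∷ []))

  X-tr : ∀ {p q v p′ q′ v′} → T t E E′ (p ∷ q ∷ v ∷ []) (p′ ∷ q′ ∷ v′ ∷ []) → inX t E p q v ≡ inX t E′ p′ q′ v′
  X-tr {p} {q} {v} {p′} {q′} {v′} τ = reach-tr
    (λ σ → T-edge σ 0F 1F ∧₂ not₂ (S-tr (T-sub σ (2F ∷ 3F ∷ 0F ∷ []))) ∧₂ not₂ (S-tr (T-sub σ (2F ∷ 3F ∷ 1F ∷ []))))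
    t (T-lower (≤-reflexive (+-identityʳ t)) (T-sub τ (1F ∷ 2F ∷ 0F ∷ 1F ∷ 0F ∷ 1F ∷ [])))

  A-tr : ∀ {p q v p′ q′ v′} → T (suc t) E E′ (p ∷ q ∷ v ∷ []) (p′ ∷ q′ ∷ v′ ∷ []) → inA t E p q v ≡ inA t E′ p′ q′ v′
  A-tr τ = X-tr (T-down 1 τ) ∧₂ ∀-tr τ λ σ → imp₂ (S-tr (T-sub σ (1F ∷ 2F ∷ 0F ∷ []))) (T-edge σ 0F 3F)

  block-tr : ∀ {r a b c e a′ b′ c′ e′} {X X′ A A′} → SetTr r a b c e a′ b′ c′ e′ X X′ → SetTr r a b c e a′ b′ c′ e′ A A′ →
    ∀ {x y x′ y′} → T (t + r) E E′ (x ∷ y ∷ a ∷ b ∷ c ∷ e ∷ []) (x′ ∷ y′ ∷ a′ ∷ b′ ∷ c′ ∷ e′ ∷ []) → block t E X A x y ≡ block t E′ X′ A′ x′ y′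
  block-tr Xtr Atr = reach-tr (λ σ → let σ₀ = T-sub σ (0F ∷ 2F ∷ 3F ∷ 4F ∷ 5F ∷ []) ; σ₁ = T-sub σ (1F ∷ 2F ∷ 3F ∷ 4F ∷ 5F ∷ []) in
    T-edge σ 0F 1F ∧₂ (Xtr σ₀ ∧₂ Xtr σ₁) ∧₂ not₂ (Atr σ₀ ∧₂ Atr σ₁)) t

  deg-tr : ∀ {d v v′} → T (suc d) E E′ (v ∷ []) (v′ ∷ []) → deg E v ≡ deg E′ v′
  deg-tr τ = count-tr τ λ σ → T-edge σ 1F 0F

-- Keeping the degree in the whole graph records how much of the neighbourhood of a boundary vertex lies outside the part.
record Iso {n} (E E′ : Edges n) (X S X′ S′ : Fin n → Bool) : Set where
  field
    π    : Perm {n}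
    onX  : ∀ v → X v ≡ X′ (π ⟨$⟩ʳ v)
    onS  : ∀ v → S v ≡ S′ (π ⟨$⟩ʳ v)
    edge : ∀ {u v} → X u ∨ S u ≡ true → X v ∨ S v ≡ true → E u v ≡ E′ (π ⟨$⟩ʳ u) (π ⟨$⟩ʳ v)
    degs : ∀ {v} → X v ∨ S v ≡ true → deg E v ≡ deg E′ (π ⟨$⟩ʳ v)

PartIso : ∀ {n} (t : ℕ) (E E′ : Edges n) → (p q p′ q′ : Fin n) → Set
PartIso t E E′ p q p′ q′ = Iso E E′ (inX t E p q) (inS t E p q) (inX t E′ p′ q′) (inS t E′ p′ q′)

module BlockFacts {n : ℕ} (t : ℕ) (big : n ≤ 2 ^ t) (E : Edges n) (sy : ∀ u v → E u v ≡ E v u) (X A : Fin n → Bool) where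

  open Reach {n} t big (crossing E X A) public
    renaming (reach-refl to block-refl; reach-snoc to block-snoc; reach-step to block-step; reach-trans to block-trans)

  crossing-intro : ∀ {u v} → E u v ≡ true → u ∈ X → v ∈ X → (u ∈ A → v ∈ A → ⊥) → crossing E X A u v ≡ true
  crossing-intro {u} {v} e x y a = ∧-intro e (∧-intro (∧-intro x y) (not-intro (≢true⇒false λ h → let h₁ , h₂ = ∧-elim h in a h₁ h₂)))

  crossing-elim : ∀ {u v} → crossing E X A u v ≡ true → E u v ≡ true × u ∈ X × v ∈ X × (u ∈ A → v ∉ A)
  crossing-elim {u} {v} h =
    let e , k = ∧-elim {E u v} h ; x , a = ∧-elim {X u ∧ X v} k ; x₁ , x₂ = ∧-elim {X u} x
    in e , x₁ , x₂ , λ ha → ≢true⇒false λ hb → clash (∧-intro ha hb) (not-elim a)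

  block-equiv : IsEquiv (block t E X A)
  block-equiv = record
    { rfl = block-refl
    ; symm = λ {x} {y} → reach-sym (λ u v h → let e , x , y , a = crossing-elim h in
        crossing-intro (trans (sy v u) e) y x (λ hv hu → clash hv (a hu))) {x} {y}
    ; tran = λ {x} {y} {z} → block-trans {x} {y} {z} }

  block-X : ∀ {x y} → x ∈ X → block t E X A x y ≡ true → y ∈ X
  block-X {x} {y} hx = reach-elim (crossing E X A) t (_∈ X) (λ u v _ h → proj₁ (proj₂ (proj₂ (crossing-elim {u} {v} h)))) hx

  -- No edge inside `A` survives in `crossing`, so a block within `A` cannot be left by even one
  -- step.
  block-A : ∀ {a} → (∀ {d} → block t E X A a d ≡ true → d ∈ A) → ∀ {y} → block t E X A a y ≡ true → a ≡ y
  block-A {a} all h = reach-elim (crossing E X A) t (a ≡_) stay refl h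
    where
    stay : ∀ u v → a ≡ u → crossing E X A u v ≡ true → a ≡ v
    stay u v refl k = clash (all (block-step {u} {v} k)) (proj₂ (proj₂ (proj₂ (crossing-elim {u} {v} k))) (all (block-refl u)))

-- Gluing children with disjoint boundaries

module StarGlue {n : ℕ} (t : ℕ) (big : n ≤ 2 ^ t) (E E′ : Edges n)
  (sy : ∀ u v → E u v ≡ E v u) (irr : ∀ u → E u u ≡ false) (sy′ : ∀ u v → E′ u v ≡ E′ v u) (irr′ : ∀ u → E′ u u ≡ false)
  (X S A X′ S′ A′ : Fin n → Bool) where

  open BlockFacts t big E sy X A using (block-equiv; block-X; block-step; crossing-intro)
  module H = BlockFacts t big E′ sy′ X′ A′
  open Blocks E E′ (block t E X A) (block t E′ X′ A′) (λ v → A v , deg E v) (λ v → A′ v , deg E′ v) block-equiv H.block-equiv public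

  -- All fields are first-order, unlike `linked` in `Config`, and can therefore be carried to the
  -- second graph by the game.
  record Flat (E : Edges n) (X S A : Fin n → Bool) : Set where
    field
      A⊆X    : ∀ v → v ∈ A → v ∈ X
      apart  : ∀ v → v ∈ X → v ∉ S
      clique : ∀ u v → S u ∨ A u ≡ true → S v ∨ A v ≡ true → u ≢ v → E u v ≡ true
      quiet  : ∀ s v → s ∈ S → v ∈ X → v ∉ A → E s v ≡ false

  module _ (G : Flat E X S A) (G′ : Flat E′ X′ S′ A′) (f : Perm {n})
    (f-X : ∀ v → X v ≡ X′ (f ⟨$⟩ʳ v)) (f-S : ∀ v → S v ≡ S′ (f ⟨$⟩ʳ v)) (f-deg : ∀ v → deg E v ≡ deg E′ (f ⟨$⟩ʳ v))
    (f-block : ∀ v → v ∈ X → BIso v (f ⟨$⟩ʳ v)) where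

    open Flat G
    module G′ = Flat G′

    private
      glued : Glued X X′ f
      glued = glue-blocks _ X X′ ≤-refl (λ {x} {y} → block-X {x} {y}) (λ {x} {y} → H.block-X {x} {y}) f (f-X , f-block)
      open Glued glued
      Φ-A : ∀ {v} → v ∈ X → A v ≡ A′ (Φ ⟨$⟩ʳ v)
      Φ-A {v} h = cong proj₁ (labels v h)
      Φ-S : ∀ v → S v ≡ S′ (Φ ⟨$⟩ʳ v)
      Φ-S v with split (X v)
      ... | inj₁ h = trans (apart v h) (sym (G′.apart _ (trans (sym (onP v)) h)))
      ... | inj₂ h = trans (f-S v) (cong S′ (sym (outside v h)))
      Φ-≢ : ∀ {u v} → u ≢ v → Φ ⟨$⟩ʳ u ≢ Φ ⟨$⟩ʳ v
      Φ-≢ ne e = ne (perm-inj Φ e)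
      to-X′ : ∀ {v} → v ∈ X → X′ (Φ ⟨$⟩ʳ v) ≡ true
      to-X′ {v} h = trans (sym (onP v)) h
      to-S′ : ∀ {v} → v ∈ S → S′ (Φ ⟨$⟩ʳ v) ≡ true
      to-S′ {v} h = trans (sym (Φ-S v)) h
      to-A′ : ∀ {v} → v ∈ X → v ∈ A → A′ (Φ ⟨$⟩ʳ v) ≡ true
      to-A′ hx ha = trans (sym (Φ-A hx)) ha

      XX : ∀ {u v} → u ∈ X → v ∈ X → E u v ≡ E′ (Φ ⟨$⟩ʳ u) (Φ ⟨$⟩ʳ v)
      XX {u} {v} hu hv with split (block t E X A u v) | split (A u ∧ A v)
      ... | inj₁ b | _ = edges u v hu b
      ... | inj₂ b | inj₁ a = let a₁ , a₂ = ∧-elim a ; ne = λ { refl → clash (IsEquiv.rfl block-equiv u) b } in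
              trans (clique u v (∨-introʳ {S u} a₁) (∨-introʳ {S v} a₂) ne)
                    (sym (G′.clique _ _ (∨-introʳ {S′ (Φ ⟨$⟩ʳ u)} (to-A′ hu a₁)) (∨-introʳ {S′ (Φ ⟨$⟩ʳ v)} (to-A′ hv a₂)) (Φ-≢ ne)))
      ... | inj₂ b | inj₂ a = trans
              (≢true⇒false λ e → clash (block-step {u} {v} (crossing-intro e hu hv λ h₁ h₂ → clash (∧-intro h₁ h₂) a)) b)
              (sym (≢true⇒false λ e → clash (H.block-step (H.crossing-intro e (to-X′ hu) (to-X′ hv)
                  λ h₁ h₂ → clash (∧-intro (trans (Φ-A hu) h₁) (trans (Φ-A hv) h₂)) a)) (trans (sym (blocks u v hu)) b)))

      SX : ∀ {u v} → u ∈ S → v ∈ X → E u v ≡ E′ (Φ ⟨$⟩ʳ u) (Φ ⟨$⟩ʳ v)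
      SX {u} {v} hu hv with split (A v)
      ... | inj₁ a = trans (clique u v (∨-introˡ hu) (∨-introʳ {S v} a) ne)
                           (sym (G′.clique _ _ (∨-introˡ (to-S′ hu)) (∨-introʳ {S′ (Φ ⟨$⟩ʳ v)} (to-A′ hv a)) (Φ-≢ ne)))
        where
        ne : u ≢ v
        ne refl = clash hu (apart u hv)
      ... | inj₂ a = trans (quiet u v hu hv a) (sym (G′.quiet _ _ (to-S′ hu) (to-X′ hv) (trans (sym (Φ-A hv)) a)))

      SS : ∀ {u v} → u ∈ S → v ∈ S → E u v ≡ E′ (Φ ⟨$⟩ʳ u) (Φ ⟨$⟩ʳ v)
      SS {u} {v} hu hv with split (u == v)
      ... | inj₁ e rewrite ==-elim e = trans (irr v) (sym (irr′ _))
      ... | inj₂ e = trans (clique u v (∨-introˡ hu) (∨-introˡ hv) (==-≢ e)) (sym (G′.clique _ _ (∨-introˡ (to-S′ hu)) (∨-introˡ (to-S′ hv)) (Φ-≢ (==-≢ e))))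

      all-edges : ∀ {u v} → X u ∨ S u ≡ true → X v ∨ S v ≡ true → E u v ≡ E′ (Φ ⟨$⟩ʳ u) (Φ ⟨$⟩ʳ v)
      all-edges {u} {v} hu hv with ∨-elim {X u} hu | ∨-elim {X v} hv
      ... | inj₁ a | inj₁ b = XX a b
      ... | inj₁ a | inj₂ b = trans (sy u v) (trans (SX b a) (sy′ _ _))
      ... | inj₂ a | inj₁ b = SX a b
      ... | inj₂ a | inj₂ b = SS a b

      all-degs : ∀ {v} → X v ∨ S v ≡ true → deg E v ≡ deg E′ (Φ ⟨$⟩ʳ v)
      all-degs {v} _ with split (X v)
      ... | inj₁ h = cong proj₂ (labels v h)
      ... | inj₂ h = trans (f-deg v) (cong (deg E′) (sym (outside v h)))

    -- Between different blocks the only edges are those of the clique `A`, and `S` sees of `X`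
    -- exactly `A`. Hence isomorphisms of the single blocks that respect `A` fit together.
    star-glue : Iso E E′ X S X′ S′
    star-glue = record { π = Φ ; onX = onP ; onS = Φ-S ; edge = all-edges ; degs = all-degs }

NoClaw : ∀ {n} → Edges n → Set
NoClaw {n} E = ∀ {z a b d : Fin n} → E z a ≡ true → E z b ≡ true → E z d ≡ true → a ≢ b → a ≢ d → b ≢ d →
  E a b ≡ false → E a d ≡ false → E b d ≡ false → ⊥

record Simple {n} (E : Edges n) : Set where
  field
    sy  : ∀ u v → E u v ≡ E v u
    irr : ∀ u → E u u ≡ false

outdeg : ∀ {n} → Edges n → (Fin n → Bool) → Fin n → ℕ
outdeg E Q v = count λ w → E v w ∧ not (Q w)

-- The degree in the whole graph is preserved, and so is the number of neighbours inside;
-- subtracting leaves those outside.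
Iso-outdeg : ∀ {n} {E E′ : Edges n} {X S X′ S′} (i : Iso E E′ X S X′ S′) → ∀ {v} → X v ∨ S v ≡ true →
  outdeg E (λ w → X w ∨ S w) v ≡ outdeg E′ (λ w → X′ w ∨ S′ w) (Iso.π i ⟨$⟩ʳ v)
Iso-outdeg {E = E} {E′} {X} {S} {X′} {S′} i {v} hv = +-cancelˡ-≡ (count λ w → E v w ∧ (X w ∨ S w)) _ _
  (trans (sym (count-split (E v) (λ w → X w ∨ S w)))
  (trans (Iso.degs i hv)
  (trans (count-split (E′ v′) (λ w → X′ w ∨ S′ w))
         (cong (_+ outdeg E′ (λ w → X′ w ∨ S′ w) v′) (sym inner)))))
  where
  v′ = Iso.π i ⟨$⟩ʳ v
  both : ∀ w → X w ∨ S w ≡ X′ (Iso.π i ⟨$⟩ʳ w) ∨ S′ (Iso.π i ⟨$⟩ʳ w)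
  both w = cong₂ _∨_ (Iso.onX i w) (Iso.onS i w)
  inner : count (λ w → E v w ∧ (X w ∨ S w)) ≡ count (λ w → E′ v′ w ∧ (X′ w ∨ S′ w))
  inner = count-perm′ _ _ (Iso.π i) λ w → Bool-ext
    (λ h → let e , k = ∧-elim {E v w} h in ∧-intro (trans (sym (Iso.edge i hv k)) e) (trans (sym (both w)) k))
    (λ h → let e , k = ∧-elim {E′ v′ _} h ; k′ = trans (both w) k in ∧-intro (trans (Iso.edge i hv k′) e) k′)

≡ᵇ-intro : ∀ {m n} → m ≡ n → (m ≡ᵇ n) ≡ true
≡ᵇ-intro {zero}  refl = refl
≡ᵇ-intro {suc m} refl = ≡ᵇ-intro {m} refl

≡ᵇ-elim : ∀ {m n} → (m ≡ᵇ n) ≡ true → m ≡ n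
≡ᵇ-elim {zero}  {zero}  h = refl
≡ᵇ-elim {suc m} {suc n} h = cong suc (≡ᵇ-elim h)

-- Uniformity is expressed by comparison with `q`, which will lie in `A` and hence in both
-- boundaries. A boundary vertex is then described towards a child by its membership in the boundary
-- alone, so what an isomorphism of the child does on the boundary can be discarded.
record Fork {n} (E : Edges n) (X S A X₁ S₁ X₂ S₂ : Fin n → Bool) (q : Fin n) : Set where
  field
    cover  : ∀ v → X v ≡ X₁ v ∨ (X₂ v ∨ A v)
    apart  : ∀ v → v ∈ X → v ∉ S
    offA   : ∀ v → X₁ v ∨ X₂ v ≡ true → v ∉ A
    disjoint   : ∀ v → v ∈ X₁ → v ∉ X₂
    far    : ∀ x y → x ∈ X₁ → y ∈ X₂ → E x y ≡ false
    clique : ∀ u v → S u ∨ A u ≡ true → S v ∨ A v ≡ true → u ≢ v → E u v ≡ true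
    bord₁  : ∀ v → v ∈ S₁ → S v ∨ A v ≡ true
    bord₂  : ∀ v → v ∈ S₂ → S v ∨ A v ≡ true
    unif₁  : ∀ x v → x ∈ X₁ → S v ∨ A v ≡ true → E v x ≡ S₁ v ∧ E q x
    unif₂  : ∀ x v → x ∈ X₂ → S v ∨ A v ≡ true → E v x ≡ S₂ v ∧ E q x

module ForkGlue {n : ℕ} (E E′ : Edges n) (simple : Simple E) (simple′ : Simple E′)
  {X S A X₁ S₁ X₂ S₂ X′ S′ A′ X₁′ S₁′ X₂′ S₂′ : Fin n → Bool} {q q′ : Fin n}
  (G : Fork E X S A X₁ S₁ X₂ S₂ q) (G′ : Fork E′ X′ S′ A′ X₁′ S₁′ X₂′ S₂′ q′) (q∈S₁ : q ∈ S₁) (q∈S₂ : q ∈ S₂)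
  (f : Perm {n}) (f-S : ∀ v → S v ≡ S′ (f ⟨$⟩ʳ v)) (f-A : ∀ v → A v ≡ A′ (f ⟨$⟩ʳ v))
  (f-X₁ : ∀ v → X₁ v ≡ X₁′ (f ⟨$⟩ʳ v)) (f-S₁ : ∀ v → S₁ v ≡ S₁′ (f ⟨$⟩ʳ v))
  (f-X₂ : ∀ v → X₂ v ≡ X₂′ (f ⟨$⟩ʳ v)) (f-S₂ : ∀ v → S₂ v ≡ S₂′ (f ⟨$⟩ʳ v))
  (f-deg : ∀ v → deg E v ≡ deg E′ (f ⟨$⟩ʳ v))
  (φ₁ : Iso E E′ X₁ S₁ X₁′ S₁′) (φ₂ : Iso E E′ X₂ S₂ X₂′ S₂′) where

  open Simple simple
  open Simple simple′ using () renaming (sy to sy′; irr to irr′)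
  open Fork G
  module G′ = Fork G′
  open Iso φ₁ using () renaming (π to π₁; onX to on-X₁; onS to on-S₁; edge to edge₁; degs to degs₁)
  open Iso φ₂ using () renaming (π to π₂; onX to on-X₂; onS to on-S₂; edge to edge₂; degs to degs₂)

  private
    first : Σ (Perm {n}) λ σ → (∀ x → X₂ x ≡ true → σ ⟨$⟩ʳ x ≡ π₂ ⟨$⟩ʳ x) × (∀ x → X₂ x ≡ false → σ ⟨$⟩ʳ x ≡ f ⟨$⟩ʳ x)
    first = glue X₂ X₂′ π₂ f on-X₂ f-X₂
    g = proj₁ first
    g-X₁ : ∀ v → X₁ v ≡ X₁′ (g ⟨$⟩ʳ v)
    g-X₁ v with split (X₂ v)
    ... | inj₂ h = trans (f-X₁ v) (cong X₁′ (sym (proj₂ (proj₂ first) v h)))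
    ... | inj₁ h = trans (≢true⇒false λ k → clash h (disjoint v k)) (sym (≢true⇒false λ k →
            clash (trans (cong X₂′ (proj₁ (proj₂ first) v h)) (trans (sym (on-X₂ v)) h)) (G′.disjoint _ k)))
    second : Σ (Perm {n}) λ σ → (∀ x → X₁ x ≡ true → σ ⟨$⟩ʳ x ≡ π₁ ⟨$⟩ʳ x) × (∀ x → X₁ x ≡ false → σ ⟨$⟩ʳ x ≡ g ⟨$⟩ʳ x)
    second = glue X₁ X₁′ π₁ g on-X₁ g-X₁
    Φ = proj₁ second

    K : Fin n → Set
    K v = S v ∨ A v ≡ true

    K-off : ∀ {v} → K v → v ∉ X₁ × v ∉ X₂
    K-off {v} k with ∨-elim {S v} k
    ... | inj₂ a = ≢true⇒false (λ h → clash a (offA v (∨-introˡ h))) , ≢true⇒false (λ h → clash a (offA v (∨-introʳ {X₁ v} h)))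
    ... | inj₁ s = ≢true⇒false (λ h → clash s (apart v (trans (cover v) (∨-introˡ h)))) ,
                   ≢true⇒false (λ h → clash s (apart v (trans (cover v) (∨-introʳ {X₁ v} (∨-introˡ h)))))

    Φ-1 : ∀ {v} → v ∈ X₁ → Φ ⟨$⟩ʳ v ≡ π₁ ⟨$⟩ʳ v
    Φ-1 = proj₁ (proj₂ second) _
    Φ-2 : ∀ {v} → v ∈ X₂ → Φ ⟨$⟩ʳ v ≡ π₂ ⟨$⟩ʳ v
    Φ-2 {v} h = trans (proj₂ (proj₂ second) v (≢true⇒false λ k → clash h (disjoint v k))) (proj₁ (proj₂ first) v h)
    Φ-f : ∀ {v} → v ∉ X₁ → v ∉ X₂ → Φ ⟨$⟩ʳ v ≡ f ⟨$⟩ʳ v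
    Φ-f {v} h₁ h₂ = trans (proj₂ (proj₂ second) v h₁) (proj₂ (proj₂ first) v h₂)
    Φ-K : ∀ {v} → K v → Φ ⟨$⟩ʳ v ≡ f ⟨$⟩ʳ v
    Φ-K k = Φ-f (proj₁ (K-off k)) (proj₂ (K-off k))

    in₁ : ∀ {v} → v ∈ X₁ → X₁′ (Φ ⟨$⟩ʳ v) ≡ true
    in₁ {v} h = trans (cong X₁′ (Φ-1 h)) (trans (sym (on-X₁ v)) h)
    in₂ : ∀ {v} → v ∈ X₂ → X₂′ (Φ ⟨$⟩ʳ v) ≡ true
    in₂ {v} h = trans (cong X₂′ (Φ-2 h)) (trans (sym (on-X₂ v)) h)
    inK : ∀ {v} → K v → S′ (Φ ⟨$⟩ʳ v) ∨ A′ (Φ ⟨$⟩ʳ v) ≡ true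
    inK {v} k = trans (cong (λ w → S′ w ∨ A′ w) (Φ-K k)) (trans (sym (cong₂ _∨_ (f-S v) (f-A v))) k)

    inX₁ : ∀ {v} → v ∈ X₁ → v ∈ X
    inX₁ {v} h = trans (cover v) (∨-introˡ h)
    inX₂ : ∀ {v} → v ∈ X₂ → v ∈ X
    inX₂ {v} h = trans (cover v) (∨-introʳ {X₁ v} (∨-introˡ h))
    inX₁′ : ∀ {v} → v ∈ X₁′ → v ∈ X′
    inX₁′ {v} h = trans (G′.cover v) (∨-introˡ h)
    inX₂′ : ∀ {v} → v ∈ X₂′ → v ∈ X′
    inX₂′ {v} h = trans (G′.cover v) (∨-introʳ {X₁′ v} (∨-introˡ h))

    onX : ∀ v → X v ≡ X′ (Φ ⟨$⟩ʳ v)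
    onX v with split (X₁ v) | split (X₂ v)
    ... | inj₁ h | _      = trans (inX₁ h) (sym (inX₁′ (in₁ h)))
    ... | inj₂ _ | inj₁ h = trans (inX₂ h) (sym (inX₂′ (in₂ h)))
    ... | inj₂ h | inj₂ k = trans (cover v) (trans (cong₂ _∨_ (f-X₁ v) (cong₂ _∨_ (f-X₂ v) (f-A v)))
                              (trans (sym (G′.cover (f ⟨$⟩ʳ v))) (cong X′ (sym (Φ-f h k)))))

    onS : ∀ v → S v ≡ S′ (Φ ⟨$⟩ʳ v)
    onS v with split (X₁ v) | split (X₂ v)
    ... | inj₁ h | _      = trans (apart v (inX₁ h)) (sym (G′.apart _ (inX₁′ (in₁ h))))
    ... | inj₂ _ | inj₁ h = trans (apart v (inX₂ h)) (sym (G′.apart _ (inX₂′ (in₂ h))))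
    ... | inj₂ h | inj₂ k = trans (f-S v) (cong S′ (sym (Φ-f h k)))

    -- `π₁` need not map `q` to `q′`; but the image of `q` lies in `S₁′`, and by uniformity it sees
    -- in `X₁′` the same vertices as `q′`.
    q-same₁ : ∀ {x} → x ∈ X₁ → E q x ≡ E′ q′ (π₁ ⟨$⟩ʳ x)
    q-same₁ {x} h = trans (edge₁ (∨-introʳ {X₁ q} q∈S₁) (∨-introˡ h))
      (trans (G′.unif₁ _ _ (trans (sym (on-X₁ x)) h) (G′.bord₁ _ (trans (sym (on-S₁ q)) q∈S₁)))
             (cong (_∧ E′ q′ (π₁ ⟨$⟩ʳ x)) (trans (sym (on-S₁ q)) q∈S₁)))
    q-same₂ : ∀ {x} → x ∈ X₂ → E q x ≡ E′ q′ (π₂ ⟨$⟩ʳ x)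
    q-same₂ {x} h = trans (edge₂ (∨-introʳ {X₂ q} q∈S₂) (∨-introˡ h))
      (trans (G′.unif₂ _ _ (trans (sym (on-X₂ x)) h) (G′.bord₂ _ (trans (sym (on-S₂ q)) q∈S₂)))
             (cong (_∧ E′ q′ (π₂ ⟨$⟩ʳ x)) (trans (sym (on-S₂ q)) q∈S₂)))

    K1 : ∀ {v x} → K v → x ∈ X₁ → E v x ≡ E′ (Φ ⟨$⟩ʳ v) (Φ ⟨$⟩ʳ x)
    K1 {v} {x} k h = trans (unif₁ x v h k) (trans
      (cong₂ _∧_ (trans (f-S₁ v) (cong S₁′ (sym (Φ-K k)))) (trans (q-same₁ h) (cong (E′ q′) (sym (Φ-1 h)))))
      (sym (G′.unif₁ _ _ (in₁ h) (inK k))))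
    K2 : ∀ {v x} → K v → x ∈ X₂ → E v x ≡ E′ (Φ ⟨$⟩ʳ v) (Φ ⟨$⟩ʳ x)
    K2 {v} {x} k h = trans (unif₂ x v h k) (trans
      (cong₂ _∧_ (trans (f-S₂ v) (cong S₂′ (sym (Φ-K k)))) (trans (q-same₂ h) (cong (E′ q′) (sym (Φ-2 h)))))
      (sym (G′.unif₂ _ _ (in₂ h) (inK k))))
    KK : ∀ {u v} → K u → K v → E u v ≡ E′ (Φ ⟨$⟩ʳ u) (Φ ⟨$⟩ʳ v)
    KK {u} {v} a b with split (u == v)
    ... | inj₁ e = subst (λ z → E u z ≡ E′ (Φ ⟨$⟩ʳ u) (Φ ⟨$⟩ʳ z)) (==-elim e) (trans (irr u) (sym (irr′ _)))
    ... | inj₂ e = trans (clique u v a b (==-≢ e)) (sym (G′.clique _ _ (inK a) (inK b) λ h → ==-≢ e (perm-inj Φ h)))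
    E12 : ∀ {u v} → u ∈ X₁ → v ∈ X₂ → E u v ≡ E′ (Φ ⟨$⟩ʳ u) (Φ ⟨$⟩ʳ v)
    E12 a b = trans (far _ _ a b) (sym (G′.far _ _ (in₁ a) (in₂ b)))
    turn : ∀ {u v} → E v u ≡ E′ (Φ ⟨$⟩ʳ v) (Φ ⟨$⟩ʳ u) → E u v ≡ E′ (Φ ⟨$⟩ʳ u) (Φ ⟨$⟩ʳ v)
    turn {u} {v} h = trans (sy u v) (trans h (sy′ _ _))

    data Place (v : Fin n) : Set where
      p₁ : v ∈ X₁ → Place v
      p₂ : v ∈ X₂ → Place v
      pK : K v → Place v

    place : ∀ {v} → X v ∨ S v ≡ true → Place v
    place {v} h with ∨-elim {X v} h
    ... | inj₂ s = pK (∨-introˡ s)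
    ... | inj₁ x with ∨-elim {X₁ v} (trans (sym (cover v)) x)
    ...   | inj₁ m = p₁ m
    ...   | inj₂ m with ∨-elim {X₂ v} m
    ...     | inj₁ k = p₂ k
    ...     | inj₂ k = pK (∨-introʳ {S v} k)

    edge : ∀ {u v} → Place u → Place v → E u v ≡ E′ (Φ ⟨$⟩ʳ u) (Φ ⟨$⟩ʳ v)
    edge (p₁ a) (p₁ b) = trans (edge₁ (∨-introˡ a) (∨-introˡ b)) (cong₂ E′ (sym (Φ-1 a)) (sym (Φ-1 b)))
    edge (p₁ a) (p₂ b) = E12 a b
    edge (p₁ a) (pK b) = turn (K1 b a)
    edge (p₂ a) (p₁ b) = turn (E12 b a)
    edge (p₂ a) (p₂ b) = trans (edge₂ (∨-introˡ a) (∨-introˡ b)) (cong₂ E′ (sym (Φ-2 a)) (sym (Φ-2 b)))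
    edge (p₂ a) (pK b) = turn (K2 b a)
    edge (pK a) (p₁ b) = K1 a b
    edge (pK a) (p₂ b) = K2 a b
    edge (pK a) (pK b) = KK a b

    degs : ∀ {v} → Place v → deg E v ≡ deg E′ (Φ ⟨$⟩ʳ v)
    degs (p₁ a) = trans (degs₁ (∨-introˡ a)) (cong (deg E′) (sym (Φ-1 a)))
    degs (p₂ a) = trans (degs₂ (∨-introˡ a)) (cong (deg E′) (sym (Φ-2 a)))
    degs (pK a) = trans (f-deg _) (cong (deg E′) (sym (Φ-K a)))

  fork-glue : Iso E E′ X S X′ S′
  fork-glue = record { π = Φ ; onX = onX ; onS = onS ; edge = λ a b → edge (place a) (place b) ; degs = λ a → degs (place a) }

-- Validity, size and inclusion of parts in the game

module PartTransfer {n : ℕ} (t : ℕ) (E E′ : Edges n) (r : ℕ) (t≤r : t ≤ r) where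

  open Tuples pebbles {n}
  open Transfer t E E′

  member-tr : ∀ {c p q v p′ q′ v′} → T (c + r) E E′ (p ∷ q ∷ v ∷ []) (p′ ∷ q′ ∷ v′ ∷ []) → inX t E p q v ≡ inX t E′ p′ q′ v′
  member-tr {c} τ = X-tr (T-lower (≤-trans t≤r (m≤n+m r c)) τ)

  size-tr : ∀ {p q p′ q′} → T (1 + r) E E′ (p ∷ q ∷ []) (p′ ∷ q′ ∷ []) → count (inX t E p q) ≡ count (inX t E′ p′ q′)
  size-tr τ = count-tr τ λ σ → member-tr {0} (T-sub σ (1F ∷ 2F ∷ 0F ∷ []))

  subset-tr : ∀ {o c p q o′ c′ p′ q′} → T (1 + r) E E′ (o ∷ c ∷ p ∷ q ∷ []) (o′ ∷ c′ ∷ p′ ∷ q′ ∷ []) →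
    (∀ {v} → v ∈ inX t E p q → v ∈ inX t E o c) → ∀ {v} → v ∈ inX t E′ p′ q′ → v ∈ inX t E′ o′ c′
  subset-tr τ sub {v} h = imp-elim (fact-tr τ
    (λ σ → imp₂ (member-tr {0} (T-sub σ (3F ∷ 4F ∷ 0F ∷ []))) (member-tr {0} (T-sub σ (1F ∷ 2F ∷ 0F ∷ [])))) (λ v → imp-intro sub) v) h

  valid-tr : ∀ {p q p′ q′} → T (2 + r) E E′ (p ∷ q ∷ []) (p′ ∷ q′ ∷ []) → Valid t E p q → Valid t E′ p′ q′
  valid-tr {p} {q} {p′} {q′} τ val = record
    { clique = λ {u} {v} hu hv ne → imp-elim (fact₂-tr τ
        (λ σ → imp₂ (S-tr (T-sub σ (2F ∷ 3F ∷ 1F ∷ [])) ∧₂ S-tr (T-sub σ (2F ∷ 3F ∷ 0F ∷ [])) ∧₂ not₂ (T-same σ 1F 0F)) (T-edge σ 1F 0F))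
        (λ u v → imp-intro {inS t E p q u ∧ inS t E p q v ∧ not (u == v)} λ h →
           let h₁ , h₂ = ∧-elim {inS t E p q u} h ; h₃ , h₄ = ∧-elim {inS t E p q v} h₂ in clique h₁ h₃ (==-≢ (not-elim h₄)))
        u v) (∧-intro hu (∧-intro hv (not-intro (==-false ne))))
    ; nonempty = ∃ᵇ-elim (trans (sym (∃-tr (T-down 1 τ) λ σ → S-tr (T-sub σ (1F ∷ 2F ∷ 0F ∷ [])))) (∃ᵇ-intro (proj₁ nonempty) (proj₂ nonempty)))
    ; outside = trans (sym (member-tr {2} (T-sub τ (0F ∷ 1F ∷ 0F ∷ [])))) outside }
    where open Valid val

-- the number of rounds that decides parts with fewer than 2 ^ j vertices
game-length : (t j : ℕ) → ℕ
game-length t zero    = t + suc t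
game-length t (suc j) = 14 + game-length t j

-- Connected components and their roots

module Components {n : ℕ} (t : ℕ) (big : n ≤ 2 ^ t) where

  conn : Edges n → Edges n
  conn E = reach (within E (λ _ → true)) t

  module _ (E : Edges n) (simple : Simple E) where

    open Simple simple
    open Paths E sy irr
    open Reach {n} t big (within E (λ _ → true))

    conn-step : ∀ {u v} → E u v ≡ true → conn E u v ≡ true
    conn-step {u} {v} e = reach-step {u} {v} (∧-intro e refl)

    conn-snoc : ∀ {u v w} → conn E u v ≡ true → E v w ≡ true → conn E u w ≡ true
    conn-snoc {u} {v} {w} r e = reach-snoc {u} {v} {w} r (∧-intro e refl)

    conn-equiv : IsEquiv (conn E)
    conn-equiv = record
      { rfl = reach-refl
      ; symm = λ {x} {y} → reach-sym (λ u v h → ∧-intro (adj-sym (proj₁ (∧-elim h))) refl) {x} {y}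
      ; tran = λ {x} {y} {z} → reach-trans {x} {y} {z} }

  rootX rootS : Edges n → Fin n → Fin n → Bool
  rootX E x y = conn E x y ∧ not (x == y)
  rootS E x y = x == y

  root-cover : ∀ E (simple : Simple E) x y → conn E x y ≡ rootX E x y ∨ rootS E x y
  root-cover E simple x y with split (x == y)
  ... | inj₁ e = trans (subst (λ z → conn E x z ≡ true) (==-elim e) (IsEquiv.rfl (conn-equiv E simple) x)) (sym (∨-introʳ {rootX E x y} e))
  ... | inj₂ e = Bool-ext (λ c → ∨-introˡ (∧-intro c (not-intro e))) (λ h → by (∨-elim {rootX E x y} h))
    where
    by : rootX E x y ≡ true ⊎ rootS E x y ≡ true → conn E x y ≡ true
    by (inj₁ h) = proj₁ (∧-elim h)
    by (inj₂ h) = clash h e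

  module _ (E : Edges n) (simple : Simple E) (x : Fin n) where

    open Simple simple
    open Paths E sy irr
    open IsEquiv (conn-equiv E simple)

    root-A⊆X : ∀ {v} → E x v ≡ true → rootX E x v ≡ true
    root-A⊆X e = ∧-intro (conn-step E simple e) (not-intro (==-false (adj-≢ e)))

    root-apart : ∀ {v} → rootX E x v ≡ true → rootS E x v ≡ false
    root-apart {v} h = not-elim (proj₂ (∧-elim {conn E x v} h))

    -- The recursion starts here: a simplicial vertex in the role of `S` and its neighbourhood in
    -- the role of `A` form a clique without any use of claw-freeness.
    root-config : Simplicial x → Config t E (rootX E x) (rootS E x) (E x)
    root-config simplicial = record
      { A⊆X = root-A⊆X ; apart = root-apart ; border = border ; clique = clique
      ; missed = λ _ na → x , ==-refl , na ; linked = linked }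
      where
      border : ∀ {u v} → rootX E x u ≡ true → E u v ≡ true → rootX E x v ≡ true ⊎ rootS E x v ≡ true
      border {u} {v} hu e with split (x == v)
      ... | inj₁ h = inj₂ h
      ... | inj₂ h = inj₁ (∧-intro (conn-snoc E simple {x} {u} {v} (proj₁ (∧-elim hu)) e) (not-intro h))
      clique : ∀ {u v} → rootS E x u ∨ E x u ≡ true → rootS E x v ∨ E x v ≡ true → u ≢ v → E u v ≡ true
      clique {u} {v} hu hv ne with ∨-elim {x == u} hu | ∨-elim {x == v} hv
      ... | inj₁ a | inj₁ b = ⊥-elim (ne (trans (sym (==-elim a)) (==-elim b)))
      ... | inj₁ a | inj₂ b = subst (λ z → E z v ≡ true) (==-elim a) b
      ... | inj₂ a | inj₁ b = subst (λ z → E u z ≡ true) (==-elim b) (adj-sym a)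
      ... | inj₂ a | inj₂ b = simplicial a b ne
      linked : ∀ {v} (C : Fin n → Bool) → rootX E x v ≡ true → v ∈ C → (∀ {u} → u ∈ C → E x u ≡ false) →
               (∀ {u w} → u ∈ C → E u w ≡ true → rootX E x w ≡ true → E x w ≡ false → w ∈ C) →
               ∃ λ u → ∃ λ a → u ∈ C × E x a ≡ true × E u a ≡ true
      -- A walk from `v` to `x` ends outside `C`. Since no vertex of `C` is adjacent to `x`, the
      -- first step out of `C` leads to a neighbour of `x`.
      linked {v} C hx hc off closed = by (reach-elim (within E (λ _ → true)) t Walk go {v} {x} (inj₂ (hc , hx)) (symm (proj₁ (∧-elim hx))))
        where
        Walk : Fin n → Set
        Walk u = (∃ λ u → ∃ λ a → u ∈ C × E x a ≡ true × E u a ≡ true) ⊎ (u ∈ C × rootX E x u ≡ true)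
        go : ∀ u w → Walk u → within E (λ _ → true) u w ≡ true → Walk w
        go u w (inj₁ k) _ = inj₁ k
        go u w (inj₂ (c , hu)) r with proj₁ (∧-elim {E u w} r)
        ... | e with border hu e | split (E x w)
        ...   | inj₂ h | _ = clash (adj-sym (subst (λ z → E u z ≡ true) (sym (==-elim h)) e)) (off c)
        ...   | inj₁ h | inj₁ a = inj₁ (u , w , c , a , e)
        ...   | inj₁ h | inj₂ a = inj₂ (closed c e h a , h)
        by : Walk x → ∃ λ u → ∃ λ a → u ∈ C × E x a ≡ true × E u a ≡ true
        by (inj₁ k) = k
        by (inj₂ (_ , h)) = clash ==-refl (root-apart h)

-- The structure of chordal claw-free graphs and its preservation by the game

module Main {n : ℕ} (t : ℕ) (big : n ≤ 2 ^ t) (E : Edges n) (simple : Simple E) (claw : NoClaw E) (chordal : Chordal ⟦ E ⟧) where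

  open Simple simple
  open Paths E sy irr
  open Parts t big E sy irr

  module ValidPart (p q : Fin n) (valid : Valid t E p q) where

    open Valid valid public
    S = inS t E p q
    X = inX t E p q
    A = inA t E p q

    X-≁p : ∀ {v} → v ∈ X → E p v ≡ false
    X-≁p v∈ = ≢true⇒false λ h → case (X-border p q v∈ (adj-sym h))
      where
      case : p ∈ X ⊎ p ∈ S → ⊥
      case (inj₁ h) = clash h outside
      case (inj₂ h) = clash h (p∉S p q)

    X-≢p : ∀ {v} → v ∈ X → p ≢ v
    X-≢p v∈ refl = clash v∈ outside

    -- Two non-adjacent vertices of `A` would form, together with `p`, the leaves of a claw at a
    -- vertex of `S`.
    A-clique : ∀ {a b} → a ∈ A → b ∈ A → a ≢ b → E a b ≡ true
    A-clique {a} {b} ha hb ne = not-false (≢true⇒false λ h →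
      let s , hs = nonempty in
      claw (proj₁ (∧-elim hs)) (S-A p q hs ha) (S-A p q hs hb) (X-≢p (A⊆X p q ha)) (X-≢p (A⊆X p q hb)) ne
           (X-≁p (A⊆X p q ha)) (X-≁p (A⊆X p q hb)) (not-elim h))

    K-clique : ∀ {u v} → S u ∨ A u ≡ true → S v ∨ A v ≡ true → u ≢ v → E u v ≡ true
    K-clique {u} {v} hu hv ne with ∨-elim {S u} hu | ∨-elim {S v} hv
    ... | inj₁ a | inj₁ b = clique a b ne
    ... | inj₁ a | inj₂ b = S-A p q a b
    ... | inj₂ a | inj₁ b = adj-sym (S-A p q b a)
    ... | inj₂ a | inj₂ b = A-clique a b ne

    config : Config t E X S A
    config = record
      { A⊆X = A⊆X p q ; apart = X∉S p q ; border = X-border p q ; clique = K-clique ; missed = missed ; linked = linked }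
      where
      missed : ∀ {v} → v ∈ X → v ∉ A → ∃ λ s → s ∈ S × E s v ≡ false
      missed {v} hx ha with split (∀ᵇ λ s → imp (S s) (E s v))
      ... | inj₁ h = clash (∧-intro hx h) ha
      ... | inj₂ h = let s , i = ∀ᵇ-counter h in
              s , not-false (≢true⇒false λ k → clash (imp-intro {S s} λ k′ → clash k′ (not-elim k)) i) , ≢true⇒false λ k → clash (imp-intro {S s} λ _ → k) i
      linked : ∀ {v} (C : Fin n → Bool) → v ∈ X → v ∈ C → (∀ {u} → u ∈ C → u ∉ A) →
               (∀ {u w} → u ∈ C → E u w ≡ true → w ∈ X → w ∉ A → w ∈ C) →
               ∃ λ u → ∃ λ a → u ∈ C × a ∈ A × E u a ≡ true
      linked C hx hc off closed with X-elim p q (λ u → (∃ λ u → ∃ λ a → u ∈ C × a ∈ A × E u a ≡ true) ⊎ u ∈ C) go hx (q∈X p q) (inj₂ hc)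
        where
        go : ∀ {u v} → (∃ λ u → ∃ λ a → u ∈ C × a ∈ A × E u a ≡ true) ⊎ u ∈ C → u ∈ X → E u v ≡ true → v ∈ X →
             (∃ λ u → ∃ λ a → u ∈ C × a ∈ A × E u a ≡ true) ⊎ v ∈ C
        go (inj₁ w) _ _ _ = inj₁ w
        go {u} {v} (inj₂ c) _ e v∈ with split (A v)
        ... | inj₁ a = inj₁ (u , v , c , a , e)
        ... | inj₂ a = inj₂ (closed c e v∈ a)
      ... | inj₁ w = w
      ... | inj₂ c = clash (q∈A p q) (off c)

    -- claw at s with leaves p, d, a
    A-adj : ∀ {s d a} → s ∈ S → d ∈ X → d ∉ A → E s d ≡ true → a ∈ A → E a d ≡ true
    A-adj hs hd nd e ha = not-false (≢true⇒false λ h →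
      claw (proj₁ (∧-elim hs)) e (S-A p q hs ha) (X-≢p hd) (X-≢p (A⊆X p q ha)) (λ { refl → clash ha nd })
           (X-≁p hd) (X-≁p (A⊆X p q ha)) (non-adj-sym (not-elim h)))

  -- Two crossing parts inside a common part: p′ ∈ X and p ∈ X′, and a vertex of the common boundary is a claw center.
  nested : ∀ {o c p q p′ q′ x} → Valid t E o c → Valid t E p q → Valid t E p′ q′ →
    (∀ {v} → v ∈ inX t E p q → v ∈ inX t E o c) → (∀ {v} → v ∈ inX t E p′ q′ → v ∈ inX t E o c) →
    x ∈ inX t E p q → x ∈ inX t E p′ q′ →
    (∀ {v} → v ∈ inX t E p q → v ∈ inX t E p′ q′) ⊎ (∀ {v} → v ∈ inX t E p′ q′ → v ∈ inX t E p q)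
  nested {o} {c} {p} {q} {p′} {q′} {x} V₀ V V′ sub sub′ x∈ x∈′
    with split (∃ᵇ λ v → inX t E p q v ∧ inS t E p′ q′ v) | split (∃ᵇ λ v → inX t E p′ q′ v ∧ inS t E p q v)
  ... | inj₂ none | _ = inj₁ λ h → X-elim p q (_∈ inX t E p′ q′)
          (λ {u} {v} c _ e v∈ → X-step p′ q′ c e (≢true⇒false λ s → clash (∧-intro v∈ s) (∃ᵇ-false none v))) x∈ h x∈′
  ... | inj₁ _ | inj₂ none = inj₂ λ h → X-elim p′ q′ (_∈ inX t E p q)
          (λ {u} {v} c _ e v∈ → X-step p q c e (≢true⇒false λ s → clash (∧-intro v∈ s) (∃ᵇ-false none v))) x∈′ h x∈
  ... | inj₁ w | inj₁ w′ = ⊥-elim absurd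
    where
    module P = ValidPart p q V
    module P′ = ValidPart p′ q′ V′
    module P₀ = ValidPart o c V₀
    z = proj₁ (∃ᵇ-elim w)
    z∈ : z ∈ P.X × z ∈ P′.S
    z∈ = ∧-elim (proj₂ (∃ᵇ-elim w))
    y = proj₁ (∃ᵇ-elim w′)
    y∈ : y ∈ P′.X × y ∈ P.S
    y∈ = ∧-elim (proj₂ (∃ᵇ-elim w′))
    p∈ : p ∈ P′.X
    p∈ with X-border p′ q′ (proj₁ y∈) (proj₁ (∧-elim (proj₂ y∈)))
    ... | inj₁ h = h
    ... | inj₂ h = clash (P′.clique h (proj₂ z∈) (P.X-≢p (proj₁ z∈))) (P.X-≁p (proj₁ z∈))
    p′∈ : p′ ∈ P.X
    p′∈ with X-border p q (proj₁ z∈) (proj₁ (∧-elim (proj₂ z∈)))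
    ... | inj₁ h = h
    ... | inj₂ h = clash (P.clique h (proj₂ y∈) (P′.X-≢p (proj₁ y∈))) (P′.X-≁p (proj₁ y∈))
    In W : Fin n → Set
    W v = v ∈ P.S × v ∈ P′.S
    In v = v ∈ P.X ⊎ v ∈ P′.X ⊎ W v
    from-X : ∀ {u v} → u ∈ P.X → E u v ≡ true → In v
    from-X {u} {v} hu e with X-border p q hu e | split (P′.X v)
    ... | inj₁ h | _      = inj₁ h
    ... | inj₂ h | inj₁ k = inj₂ (inj₁ k)
    ... | inj₂ h | inj₂ k with X-border p′ q′ (proj₁ y∈) (P.clique (proj₂ y∈) h λ { refl → clash (proj₁ y∈) k })
    ...   | inj₁ m = clash m k
    ...   | inj₂ m = inj₂ (inj₂ (h , m))
    from-X′ : ∀ {u v} → u ∈ P′.X → E u v ≡ true → In v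
    from-X′ {u} {v} hu e with X-border p′ q′ hu e | split (P.X v)
    ... | inj₁ h | _      = inj₂ (inj₁ h)
    ... | inj₂ h | inj₁ k = inj₁ k
    ... | inj₂ h | inj₂ k with X-border p q (proj₁ z∈) (P′.clique (proj₂ z∈) h λ { refl → clash (proj₁ z∈) k })
    ...   | inj₁ m = clash m k
    ...   | inj₂ m = inj₂ (inj₂ (m , h))
    from-W : ∀ {u v} → W u → E u v ≡ true → In v
    from-W {u} {v} (h , h′) e with split (p == v) | split (p′ == v) | split (E p v) | split (E p′ v)
    ... | inj₁ a | _ | _ | _ = inj₂ (inj₁ (subst (_∈ P′.X) (==-elim a) p∈))
    ... | inj₂ _ | inj₁ a | _ | _ = inj₁ (subst (_∈ P.X) (==-elim a) p′∈)
    ... | inj₂ _ | inj₂ _ | inj₁ a | _ = from-X′ p∈ a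
    ... | inj₂ _ | inj₂ _ | inj₂ _ | inj₁ a = from-X p′∈ a
    ... | inj₂ a | inj₂ b | inj₂ c′ | inj₂ d = ⊥-elim (claw (proj₁ (∧-elim h)) (proj₁ (∧-elim h′)) e
            (P.X-≢p p′∈) (==-≢ a) (==-≢ b) (P.X-≁p p′∈) c′ d)
    -- The set `In` is closed under adjacency and thus spreads through the common part to `c`, over
    -- its boundary to `o`. But `o` lies outside the common part and has no neighbour in it, whereas
    -- a vertex of `W` is adjacent to `q`.
    spread : ∀ {u v} → In u → E u v ≡ true → In v
    spread (inj₁ h)        = from-X h
    spread (inj₂ (inj₁ h)) = from-X′ h
    spread (inj₂ (inj₂ h)) = from-W h
    c-In : In c
    c-In = X-elim o c In (λ i _ e _ → spread i e) (sub x∈) (q∈X o c) (inj₁ x∈)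
    o-In : In o
    o-In = let s , hs = Valid.nonempty V₀ ; so , sc = ∧-elim hs in spread (spread c-In (adj-sym sc)) so
    absurd : ⊥
    absurd with o-In
    ... | inj₁ h = clash (sub h) (Valid.outside V₀)
    ... | inj₂ (inj₁ h) = clash (sub′ h) (Valid.outside V₀)
    ... | inj₂ (inj₂ (h , _)) = clash (proj₂ (∧-elim {E o p} h)) (P₀.X-≁p (sub (q∈X p q)))

  -- Children of a part

  module _ {X S A : Fin n → Bool} (cf : Config t E X S A) where

    open Config cf

    -- Let `q` be an apex of the component of `d`, which sees all the clique vertices that the
    -- component touches. As `q` is not in `A`, some `p` in `S` misses it, and then `p` is not
    -- touched at all. The common neighbours of `p` and `q` are exactly the touched clique vertices,
    -- and these cut out the component.
    child : ∀ {d} → d ∈ X → d ∉ A → ∃ λ p → ∃ λ q → Child t E X S A d p q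
    child {d} hd nd = p , q , record
      { valid = record { clique = λ hu hv → clique (S⇒K hu) (S⇒K hv) ; nonempty = nonempty ; outside = outside }
      ; member = D⇒X (reach-refl d)
      ; below = λ h → M-elim (D⊆M (X⇒D h))
      ; border = S⇒K
      ; top = p∈S }
      where
      M : Fin n → Bool
      M v = X v ∧ not (A v)
      M-elim : ∀ {v} → v ∈ M → v ∈ X × v ∉ A
      M-elim h = let a , b = ∧-elim h in a , not-elim b
      M-intro : ∀ {v} → v ∈ X → v ∉ A → v ∈ M
      M-intro a b = ∧-intro a (not-intro b)
      open Apex t big chordal M d (M-intro hd nd)
      open Reach {n} t big (within E M)
      K : Fin n → Bool
      K v = S v ∨ A v
      K∉M : ∀ {v} → v ∈ K → v ∉ M
      K∉M {v} h = ≢true⇒false λ m → case (∨-elim {S v} h) (M-elim m)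
        where
        case : v ∈ S ⊎ v ∈ A → v ∈ X × v ∉ A → ⊥
        case (inj₁ s) (x , _) = clash s (apart x)
        case (inj₂ a) (_ , b) = clash a b
      K∉D : ∀ {v} → v ∈ K → v ∉ D
      K∉D h = ≢true⇒false λ m → clash (D⊆M m) (K∉M h)
      top : ∃ λ q → q ∈ D × (∀ {v} → v ∈ K → v ∈ touched → E q v ≡ true)
      top = apex clique K∉D
      q = proj₁ top
      q∈D = proj₁ (proj₂ top)
      q-adj = proj₂ (proj₂ top)
      miss : ∃ λ s → s ∈ S × E s q ≡ false
      miss = let a , b = M-elim (D⊆M q∈D) in missed a b
      p = proj₁ miss
      p∈S = proj₁ (proj₂ miss)
      p≁ : ∀ {v} → v ∈ D → E p v ≡ false
      p≁ {v} hv = ≢true⇒false λ e → clash (adj-sym (q-adj (∨-introˡ p∈S) (∃ᵇ-intro v (∧-intro hv (adj-sym e))))) (proj₂ (proj₂ miss))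
      border-D : ∀ {u v} → u ∈ D → E u v ≡ true → v ∈ D ⊎ (v ∈ K × v ∈ touched)
      border-D {u} {v} hu e with border (proj₁ (M-elim (D⊆M hu))) e | split (A v)
      ... | inj₂ s | _      = inj₂ (∨-introˡ s , ∃ᵇ-intro u (∧-intro hu e))
      ... | inj₁ x | inj₁ a = inj₂ (∨-introʳ {S v} a , ∃ᵇ-intro u (∧-intro hu e))
      ... | inj₁ x | inj₂ a = inj₁ (D-closed hu e (M-intro x a))
      S⇒Kt : ∀ {v} → v ∈ inS t E p q → v ∈ K × v ∈ touched
      S⇒Kt {v} h with border-D q∈D (adj-sym (proj₂ (∧-elim {E v p} h)))
      ... | inj₁ m = clash (adj-sym (proj₁ (∧-elim h))) (p≁ m)
      ... | inj₂ k = k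
      S⇒K : ∀ {v} → v ∈ inS t E p q → v ∈ K
      S⇒K h = proj₁ (S⇒Kt h)
      Kt⇒S : ∀ {v} → v ∈ K → v ∈ touched → v ∈ inS t E p q
      Kt⇒S {v} k w = let e = q-adj k w in
        ∧-intro (clique k (∨-introˡ p∈S) λ { refl → clash (adj-sym e) (proj₂ (proj₂ miss)) }) (adj-sym e)
      X⇒D : ∀ {v} → v ∈ inX t E p q → v ∈ D
      X⇒D h = X-elim p q (_∈ D) go (q∈X p q) h q∈D
        where
        go : ∀ {u v} → u ∈ D → u ∈ inX t E p q → E u v ≡ true → v ∈ inX t E p q → v ∈ D
        go hu _ e v∈ with border-D hu e
        ... | inj₁ m = m
        ... | inj₂ (k , w) = clash (Kt⇒S k w) (X∉S p q v∈)
      D⇒X : ∀ {v} → v ∈ D → v ∈ inX t E p q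
      D⇒X {v} h = proj₁ (reach-elim (within E M) t (λ u → u ∈ inX t E p q × u ∈ M)
        (λ u v (c , m) r → let e , k = ∧-elim {E u v} r ; m′ = proj₂ (∧-elim {M u} k) in
            X-step p q c e (≢true⇒false λ s → clash m′ (K∉M (S⇒K s))) , m′)
        (q∈X p q , D⊆M q∈D) (reach-trans {q} {d} {v} (reach-sym within-sym {d} {q} q∈D) h))
      nonempty : ∃ λ s → s ∈ inS t E p q
      nonempty = let u , a , hu , ha , e = linked D hd (reach-refl d) (λ h → proj₂ (M-elim (D⊆M h))) (λ hu e x na → D-closed hu e (M-intro x na))
                 in a , Kt⇒S (∨-introʳ {S a} ha) (∃ᵇ-intro u (∧-intro hu e))
      outside : p ∉ inX t E p q
      outside = ≢true⇒false λ h → clash p∈S (apart (proj₁ (M-elim (D⊆M (X⇒D h)))))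

    module ChildFacts {d p q} (c : Child t E X S A d p q) where

      open Child c public using (valid; member; below; top) renaming (border to S⊆K)

      X₁ = inX t E p q
      S₁ = inS t E p q

      K∉X₁ : ∀ {v} → S v ∨ A v ≡ true → v ∉ X₁
      K∉X₁ {v} h = ≢true⇒false λ m → case (∨-elim {S v} h) (below m)
        where
        case : v ∈ S ⊎ v ∈ A → v ∈ X × v ∉ A → ⊥
        case (inj₁ s) (x , _) = clash s (apart x)
        case (inj₂ a) (_ , b) = clash a b

      closed : ∀ {u v} → u ∈ X₁ → E u v ≡ true → v ∈ X → v ∉ A → v ∈ X₁
      closed {u} {v} hu e hx na with X-border p q hu e
      ... | inj₁ h = h
      ... | inj₂ h with ∨-elim {S v} (S⊆K h)
      ...   | inj₁ s = clash s (apart hx)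
      ...   | inj₂ a = clash a na

      touch : ∀ {u v} → u ∈ X₁ → E u v ≡ true → S v ∨ A v ≡ true → v ∈ S₁
      touch hu e k with X-border p q hu e
      ... | inj₁ h = clash h (K∉X₁ k)
      ... | inj₂ h = h

      S₁-q : ∀ {v} → v ∈ S₁ → E v q ≡ true
      S₁-q {v} h = proj₂ (∧-elim {E v p} h)

      absorb : ∀ {e p′ q′} → Child t E X S A e p′ q′ → ∀ {x y} → x ∈ inX t E p′ q′ → y ∈ inX t E p′ q′ → x ∈ X₁ → y ∈ X₁
      absorb {e} {p′} {q′} c′ hx hy = X-elim p′ q′ (_∈ X₁) (λ h _ e v∈ → let a , b = Child.below c′ v∈ in closed h e a b) hx hy

      top∉S₁ : p ∉ S₁
      top∉S₁ = p∉S p q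

  module Cases (p q : Fin n) (val : Valid t E p q) where

    open ValidPart p q val public

    private
      A⇒K : ∀ {v} → v ∈ A → S v ∨ A v ≡ true
      A⇒K {v} = ∨-introʳ {S v}
      S⇒K : ∀ {v} → v ∈ S → S v ∨ A v ≡ true
      S⇒K = ∨-introˡ

    A∉S : ∀ {v} → v ∈ A → v ∉ S
    A∉S h = X∉S p q (A⊆X p q h)

    -- A witness that some vertex of `S` sees a child. Then every vertex of `A` sees `d`, so the
    -- boundary of this child contains `A`.
    record Seen (s d p₁ q₁ : Fin n) : Set where
      field
        s∈S  : s ∈ S
        d∈X  : d ∈ X
        d∉A  : d ∉ A
        s~d  : E s d ≡ true
        kid  : Child t E X S A d p₁ q₁

    module One {s d p₁ q₁} (seen : Seen s d p₁ q₁) where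

      open Seen seen public
      open ChildFacts config kid public renaming (valid to valid₁)

      A~d : ∀ {a} → a ∈ A → E a d ≡ true
      A~d = A-adj s∈S d∈X d∉A s~d

      A⊆S₁ : ∀ {a} → a ∈ A → a ∈ S₁
      A⊆S₁ h = touch member (adj-sym (A~d h)) (A⇒K h)

      module Only (alone : ∀ {s e} → s ∈ S → e ∈ X → e ∉ A → e ∉ X₁ → E s e ≡ false) where

        -- A second child would have all its boundary in `A`, because `S` sees only the first. A
        -- boundary vertex of it would be the center of a claw with leaves `d`, `q₂` and `p₁`.
        filled : ∀ {e} → e ∈ X → e ∉ A → e ∈ X₁
        filled {e} he ne = not-false (≢true⇒false λ h → absurd (not-elim h) (child config he ne))
          where
          absurd : e ∉ X₁ → (∃ λ p → ∃ λ q → Child t E X S A e p q) → ⊥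
          absurd e∉ (p₂ , q₂ , c₂) = case (∨-elim {S w} (Child.border c₂ w∈))
            where
            w = proj₁ (Valid.nonempty (Child.valid c₂))
            w∈ = proj₂ (Valid.nonempty (Child.valid c₂))
            w~q₂ : E w q₂ ≡ true
            w~q₂ = proj₂ (∧-elim {E w p₂} w∈)
            q₂-below = Child.below c₂ (q∈X p₂ q₂)
            q₂∉ : q₂ ∉ X₁
            q₂∉ = ≢true⇒false λ h → clash (absorb c₂ (q∈X p₂ q₂) (Child.member c₂) h) e∉
            case : w ∈ S ⊎ w ∈ A → ⊥
            case (inj₁ s) = clash w~q₂ (alone s (proj₁ q₂-below) (proj₂ q₂-below) q₂∉)
            case (inj₂ a) = claw (A~d a) w~q₂ (adj-sym (S-A p q top a))
              (λ { refl → clash member q₂∉ }) (λ { refl → clash top (X∉S p q d∈X) }) (λ { refl → clash top (X∉S p q (proj₁ q₂-below)) })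
              (≢true⇒false λ h → clash (closed member h (proj₁ q₂-below) (proj₂ q₂-below)) q₂∉)
              (≢true⇒false λ h → clash (touch member h (S⇒K top)) top∉S₁)
              (non-adj-sym (alone top (proj₁ q₂-below) (proj₂ q₂-below) q₂∉))

    module Two {s d p₁ q₁ s′ d′ p₂ q₂} (seen : Seen s d p₁ q₁) (seen′ : Seen s′ d′ p₂ q₂) (new : d′ ∉ inX t E p₁ q₁) where

      open One seen
      module O′ = One seen′

      disjoint : ∀ {x} → x ∈ X₁ → x ∉ O′.X₁
      disjoint h = ≢true⇒false λ h′ → clash (absorb O′.kid h′ O′.member h) new

      apart₁₂ : ∀ {x y} → x ∈ X₁ → y ∈ O′.X₁ → E x y ≡ false
      apart₁₂ {x} {y} hx hy = ≢true⇒false λ e → let a , b = O′.below hy in clash (closed hx e a b) (≢true⇒false λ h → clash hy (disjoint h))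

      apart-≢ : ∀ {x y} → x ∈ X₁ → y ∈ O′.X₁ → x ≢ y
      apart-≢ hx hy refl = clash hy (disjoint hx)

      private
        q-A = q∈A p q

      -- Otherwise there is a claw at `r` with leaves `p`, `q₁`, `q₂`.
      S-once : ∀ {r} → r ∈ S → r ∈ S₁ → r ∉ O′.S₁
      S-once hr h₁ = ≢true⇒false λ h₂ → claw (proj₁ (∧-elim hr)) (S₁-q h₁) (O′.S₁-q h₂)
        (X-≢p (proj₁ (below (q∈X p₁ q₁)))) (X-≢p (proj₁ (O′.below (q∈X p₂ q₂)))) (apart-≢ (q∈X p₁ q₁) (q∈X p₂ q₂))
        (X-≁p (proj₁ (below (q∈X p₁ q₁)))) (X-≁p (proj₁ (O′.below (q∈X p₂ q₂)))) (apart₁₂ (q∈X p₁ q₁) (q∈X p₂ q₂))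

      -- A third child would have an apex `q₃` adjacent to some vertex of `A`, and that vertex also
      -- sees `d` and `d′`: a claw.
      filled : ∀ {e} → e ∈ X → e ∉ A → e ∈ X₁ ⊎ e ∈ O′.X₁
      filled {e} he ne = ∨-elim (not-false (≢true⇒false λ h → absurd (child config he ne)
          (≢true⇒false λ k → clash (∨-introˡ k) (not-elim h)) (≢true⇒false λ k → clash (∨-introʳ {X₁ e} k) (not-elim h))))
        where
        absurd : (∃ λ p → ∃ λ q → Child t E X S A e p q) → e ∉ X₁ → e ∉ O′.X₁ → ⊥
        absurd (p₃ , q₃ , c₃) h h′ = case (∨-elim {S w} (Child.border c₃ w∈))
          where
          w = proj₁ (Valid.nonempty (Child.valid c₃))
          w∈ = proj₂ (Valid.nonempty (Child.valid c₃))
          w~q₃ : E w q₃ ≡ true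
          w~q₃ = proj₂ (∧-elim {E w p₃} w∈)
          q₃-below = Child.below c₃ (q∈X p₃ q₃)
          q₃∉ : q₃ ∉ X₁
          q₃∉ = ≢true⇒false λ k → clash (absorb c₃ (q∈X p₃ q₃) (Child.member c₃) k) h
          q₃∉′ : q₃ ∉ O′.X₁
          q₃∉′ = ≢true⇒false λ k → clash (O′.absorb c₃ (q∈X p₃ q₃) (Child.member c₃) k) h′
          star : ∀ {a} → a ∈ A → E a q₃ ≡ true → ⊥
          star ha e₃ = claw (A~d ha) (O′.A~d ha) e₃ (apart-≢ member O′.member)
            (λ { refl → clash member q₃∉ }) (λ { refl → clash O′.member q₃∉′ }) (apart₁₂ member O′.member)
            (≢true⇒false λ k → clash (closed member k (proj₁ q₃-below) (proj₂ q₃-below)) q₃∉)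
            (≢true⇒false λ k → clash (O′.closed O′.member k (proj₁ q₃-below) (proj₂ q₃-below)) q₃∉′)
          case : w ∈ S ⊎ w ∈ A → ⊥
          -- A vertex of `S` that sees `q₃` passes this on to all of `A`, in particular to `q`.
          case (inj₁ ws) = star q-A (A-adj ws (proj₁ q₃-below) (proj₂ q₃-below) w~q₃ q-A)
          case (inj₂ wa) = star wa w~q₃

      -- claw at a with leaves x, d′, r
      pull : ∀ {a r x} → a ∈ A → r ∈ S → r ∈ S₁ → x ∈ X₁ → E a x ≡ true → E r x ≡ true
      pull {a} {r} {x} ha hr h₁ hx e = not-false (≢true⇒false λ h → claw e (O′.A~d ha) (adj-sym (S-A p q hr ha))
        (apart-≢ hx O′.member) (λ { refl → clash hr (X∉S p q (proj₁ (below hx))) }) (λ { refl → clash hr (X∉S p q O′.d∈X) })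
        (apart₁₂ hx O′.member) (non-adj-sym (not-elim h))
        (≢true⇒false λ k → clash (O′.touch O′.member k (S⇒K hr)) (S-once hr h₁)))

      -- `A-adj` carries adjacency to `x` from `S` to `A`, and `pull` carries it from `A` to `S`.
      -- Between two vertices of `A` it passes through `s`.
      uniform : ∀ {v x} → v ∈ S₁ → x ∈ X₁ → E v x ≡ E q x
      uniform {v} {x} hv hx with ∨-elim {S v} (S⊆K hv)
      ... | inj₁ vs = Bool-ext (λ e → A-adj vs (proj₁ (below hx)) (proj₂ (below hx)) e q-A) (pull q-A vs hv hx)
      ... | inj₂ va = Bool-ext (across va q-A) (across q-A va)
        where
        across : ∀ {a b} → a ∈ A → b ∈ A → E a x ≡ true → E b x ≡ true
        across ha hb e = A-adj s∈S (proj₁ (below hx)) (proj₂ (below hx)) (pull ha s∈S (touch member (adj-sym s~d) (S⇒K s∈S)) hx e) hb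

  module StarFacts {X S A : Fin n → Bool} (cf : Config t E X S A) (quiet : ∀ {s d} → s ∈ S → d ∈ X → d ∉ A → E s d ≡ false)
    {d p q : Fin n} (c : Child t E X S A d p q) where

    open Config cf using (apart; clique)
    open ChildFacts cf c
    open BlockFacts t big E sy X A

    S₁⊆A : ∀ {v} → v ∈ S₁ → v ∈ A
    S₁⊆A {v} h with ∨-elim {S v} (S⊆K h)
    ... | inj₁ s = let a , b = below (q∈X p q) in clash (S₁-q h) (quiet s a b)
    ... | inj₂ a = a

    -- claw at a with leaves u, w, p
    same-child : ∀ {a u w} → a ∈ A → E a u ≡ true → E a w ≡ true → u ∈ X₁ → w ∈ X → w ∉ A → w ∈ X₁
    same-child {a} {u} {w} ha eu ew hu hw nw = not-false (≢true⇒false λ h → let ux , ua = below hu in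
      claw eu ew (clique (∨-introʳ {S a} ha) (∨-introˡ top) λ { refl → clash top (apart (Config.A⊆X cf ha)) })
        (λ { refl → clash hu (not-elim h) }) (λ { refl → clash top (apart ux) }) (λ { refl → clash top (apart hw) })
        (≢true⇒false λ e → clash (closed hu e hw nw) (not-elim h))
        (non-adj-sym (quiet top ux ua)) (non-adj-sym (quiet top hw nw)))

    block⇒ : ∀ {x y} → X₁ x ∨ S₁ x ≡ true → block t E X A x y ≡ true → X₁ y ∨ S₁ y ≡ true
    block⇒ {x} {y} hx = reach-elim (crossing E X A) t (λ u → X₁ u ∨ S₁ u ≡ true) grow hx
      where
      grow : ∀ u v → X₁ u ∨ S₁ u ≡ true → crossing E X A u v ≡ true → X₁ v ∨ S₁ v ≡ true
      grow u v hu k with crossing-elim {u} {v} k | ∨-elim {X₁ u} hu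
      ... | e , ux , vx , a | inj₂ h = ∨-introˡ (same-child (S₁⊆A h) (S₁-q h) e (q∈X p q) vx (a (S₁⊆A h)))
      ... | e , ux , vx , a | inj₁ h with X-border p q h e
      ...   | inj₁ m = ∨-introˡ m
      ...   | inj₂ m = ∨-introʳ {X₁ v} m

    ⇒block : ∀ {y} → X₁ y ∨ S₁ y ≡ true → block t E X A q y ≡ true
    ⇒block {y} hy with ∨-elim {X₁ y} hy
    ... | inj₂ h = let a , b = below (q∈X p q) in
            block-step {q} {y} (crossing-intro (adj-sym (S₁-q h)) a (Config.A⊆X cf (S₁⊆A h)) λ k _ → clash k b)
    ... | inj₁ h = X-elim p q (λ u → block t E X A q u ≡ true)
            (λ {u} {v} r hu e hv → block-snoc {q} {u} {v} r (crossing-intro e (proj₁ (below hu)) (proj₁ (below hv)) λ k _ → clash k (proj₂ (below hu))))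
            (q∈X p q) h (block-refl q)

    open IsEquiv block-equiv

    -- The block cannot leave the child and its boundary: `X₁` is left only into `S₁`, and a
    -- surviving edge at a vertex of `S₁` leads outside `A`, hence back into `X₁` by `same-child`.
    -- Conversely `X₁` is connected and `q` sees all of `S₁`.
    block-of : ∀ {x} → X₁ x ∨ S₁ x ≡ true → ∀ y → block t E X A x y ≡ X₁ y ∨ S₁ y
    block-of hx y = Bool-ext (block⇒ hx) (λ h → tran (symm (⇒block hx)) (⇒block h))

    block-of-d : ∀ {x} → block t E X A x d ≡ true → ∀ y → block t E X A x y ≡ X₁ y ∨ S₁ y
    block-of-d r y = trans (class-≡ r y) (block-of (∨-introˡ member) y)

    -- An isomorphism of the child knows `S₁` but not `A`; on a block the two coincide, so the label
    -- `A` is preserved.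
    A-S₁ : ∀ {y} → X₁ y ∨ S₁ y ≡ true → A y ≡ S₁ y
    A-S₁ {y} h with ∨-elim {X₁ y} h
    ... | inj₁ m = trans (proj₂ (below m)) (sym (X∉S p q m))
    ... | inj₂ m = trans (S₁⊆A m) (sym m)

  -- Isomorphisms of parts from winning positions

  module Against (E′ : Edges n) (simple′ : Simple E′) where

    open Simple simple′ using () renaming (sy to sy′; irr to irr′)
    open Tuples pebbles {n}
    open Transfer t E E′
    module H = Parts t big E′ sy′ irr′

    -- The deepest set that is tested is a block: `t` rounds for reachability, above `suc t` for the
    -- membership in `A` that its edges mention. The rounds `D` are the reserve that remains when
    -- such a test begins.
    module _ (D : ℕ) (B≤D : t + suc t ≤ D) where

      1+t≤D : suc t ≤ D
      1+t≤D = ≤-trans (m≤n+m (suc t) t) B≤D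

      X-tr′ : ∀ {c p q v p′ q′ v′} → T (c + D) E E′ (p ∷ q ∷ v ∷ []) (p′ ∷ q′ ∷ v′ ∷ []) → inX t E p q v ≡ inX t E′ p′ q′ v′
      X-tr′ {c} τ = X-tr (T-lower (≤-trans (n≤1+n t) (≤-trans 1+t≤D (m≤n+m D c))) τ)

      A-tr′ : ∀ {c p q v p′ q′ v′} → T (c + D) E E′ (p ∷ q ∷ v ∷ []) (p′ ∷ q′ ∷ v′ ∷ []) → inA t E p q v ≡ inA t E′ p′ q′ v′
      A-tr′ {c} τ = A-tr (T-lower (≤-trans 1+t≤D (m≤n+m D c)) τ)

      -- Of the four rounds beyond `D`, one yields the bijection `f`, two place the pair that
      -- defines a child, and one is left for a vertex under test.
      module Star {a b c e a′ b′ c′ e′ : Fin n} {X S A X′ S′ A′ : Fin n → Bool}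
        (cf : Config t E X S A) (quiet : ∀ {s d} → s ∈ S → d ∈ X → d ∉ A → E s d ≡ false)
        (apart′ : ∀ v → v ∈ X′ → v ∉ S′) (A⊆X′ : ∀ v → v ∈ A′ → v ∈ X′)
        (Xtr : SetTr (suc t) a b c e a′ b′ c′ e′ X X′) (Str : SetTr (suc t) a b c e a′ b′ c′ e′ S S′) (Atr : SetTr (suc t) a b c e a′ b′ c′ e′ A A′)
        (τ : T (4 + D) E E′ (a ∷ b ∷ c ∷ e ∷ []) (a′ ∷ b′ ∷ c′ ∷ e′ ∷ []))
        (oracle : ∀ {p q p′ q′} → T (1 + D) E E′ (p ∷ q ∷ a ∷ b ∷ c ∷ e ∷ []) (p′ ∷ q′ ∷ a′ ∷ b′ ∷ c′ ∷ e′ ∷ []) →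
                  Valid t E p q → (∀ {v} → v ∈ inX t E p q → v ∈ X × v ∉ A) → PartIso t E E′ p q p′ q′)
        where

        open StarGlue t big E E′ sy irr sy′ irr′ X S A X′ S′ A′
        open Config cf using (apart; clique)
        open BlockFacts t big E sy X A using (block-X; block-A; block-refl; block-equiv)

        low : ∀ {P P′ v v′} → SetTr (suc t) a b c e a′ b′ c′ e′ P P′ → T D E E′ (v ∷ a ∷ b ∷ c ∷ e ∷ []) (v′ ∷ a′ ∷ b′ ∷ c′ ∷ e′ ∷ []) → P v ≡ P′ v′
        low tr σ = tr (T-lower 1+t≤D σ)

        flat : Flat E X S A
        flat = record { A⊆X = λ _ → Config.A⊆X cf ; apart = λ _ → apart ; clique = λ _ _ → clique ; quiet = λ _ _ → quiet }

        flat′ : Flat E′ X′ S′ A′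
        flat′ = record
          { A⊆X = A⊆X′ ; apart = apart′
          ; clique = λ u v hu hv ne → imp-elim (fact₂-tr (T-down 2 τ)
              (λ σ → imp₂ ((low Str (first σ) ∨₂ low Atr (first σ)) ∧₂ (low Str (second σ) ∨₂ low Atr (second σ)) ∧₂ not₂ (T-same σ 1F 0F)) (T-edge σ 1F 0F))
              (λ u v → imp-intro {(S u ∨ A u) ∧ (S v ∨ A v) ∧ not (u == v)} λ h →
                 let h₁ , h₂ = ∧-elim h ; h₃ , h₄ = ∧-elim h₂ in clique h₁ h₃ (==-≢ (not-elim h₄)))
              u v) (∧-intro hu (∧-intro hv (not-intro (==-false ne))))
          ; quiet = λ s v hs hv na → not-elim (imp-elim (fact₂-tr (T-down 2 τ)
              (λ σ → imp₂ (low Str (first σ) ∧₂ low Xtr (second σ) ∧₂ not₂ (low Atr (second σ))) (not₂ (T-edge σ 1F 0F)))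
              (λ s v → imp-intro {S s ∧ X v ∧ not (A v)} λ h →
                 let h₁ , h₂ = ∧-elim h ; h₃ , h₄ = ∧-elim h₂ in not-intro (quiet h₁ h₃ (not-elim h₄)))
              s v) (∧-intro hs (∧-intro hv (not-intro na)))) }
          where
          first : ∀ {u u′ v v′} → T D E E′ (v ∷ u ∷ a ∷ b ∷ c ∷ e ∷ []) (v′ ∷ u′ ∷ a′ ∷ b′ ∷ c′ ∷ e′ ∷ []) → T D E E′ (u ∷ a ∷ b ∷ c ∷ e ∷ []) (u′ ∷ a′ ∷ b′ ∷ c′ ∷ e′ ∷ [])
          first σ = T-sub σ (1F ∷ 2F ∷ 3F ∷ 4F ∷ 5F ∷ [])
          second : ∀ {u u′ v v′} → T D E E′ (v ∷ u ∷ a ∷ b ∷ c ∷ e ∷ []) (v′ ∷ u′ ∷ a′ ∷ b′ ∷ c′ ∷ e′ ∷ []) → T D E E′ (v ∷ a ∷ b ∷ c ∷ e ∷ []) (v′ ∷ a′ ∷ b′ ∷ c′ ∷ e′ ∷ [])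
          second σ = T-sub σ (0F ∷ 2F ∷ 3F ∷ 4F ∷ 5F ∷ [])

        f : Perm {n}
        f = proj₁ (T-ext τ)

        τf : ∀ v → T (3 + D) E E′ (v ∷ a ∷ b ∷ c ∷ e ∷ []) ((f ⟨$⟩ʳ v) ∷ a′ ∷ b′ ∷ c′ ∷ e′ ∷ [])
        τf = proj₂ (T-ext τ)

        block-tr′ : ∀ {x y x′ y′} → T D E E′ (x ∷ y ∷ a ∷ b ∷ c ∷ e ∷ []) (x′ ∷ y′ ∷ a′ ∷ b′ ∷ c′ ∷ e′ ∷ []) → block t E X A x y ≡ block t E′ X′ A′ x′ y′
        block-tr′ σ = block-tr {X = X} {X′} {A} {A′} Xtr Atr (T-lower B≤D σ)

        single : ∀ {v w} → T (3 + D) E E′ (v ∷ a ∷ b ∷ c ∷ e ∷ []) (w ∷ a′ ∷ b′ ∷ c′ ∷ e′ ∷ []) → v ∈ X → (∀ {d} → block t E X A v d ≡ true → d ∈ A) → BIso v w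
        single {v} {w} τ v∈ all = record
          -- A permutation of all vertices is required although the block is a singleton; the swap
          -- is one that takes `v` to `w`.
          { π = swap v w
          ; onB = λ x → Bool-ext
              (λ h → subst (λ z → block t E′ X′ A′ w z ≡ true) (sym (trans (cong (swapF v w) (sym (block-A all h))) (swapF-a v w))) (H.block-refl w))
              (λ h → subst (λ z → block t E X A v z ≡ true) (pre (==-elim (imp-elim (alone (swapF v w x)) h))) (block-refl v))
          ; edge = λ x y hx hy → edge x y (block-A all hx) (block-A all hy)
          ; labs = λ x h → labs x (block-A all h) }
          where
          alone : ∀ x′ → imp (block t E′ X′ A′ w x′) (w == x′) ≡ true
          alone = fact-tr (T-down 2 τ) {P = λ x → imp (block t E X A v x) (v == x)}
            (λ σ → imp₂ (block-tr′ (T-sub σ (1F ∷ 0F ∷ 2F ∷ 3F ∷ 4F ∷ 5F ∷ []))) (T-same σ 1F 0F))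
            (λ x → imp-intro λ h → subst (λ z → (v == z) ≡ true) (block-A all h) ==-refl)
          pre : ∀ {x} → w ≡ swapF v w x → v ≡ x
          pre {x} e = trans (sym (swapF-b v w)) (trans (cong (swapF v w) e) (swapF-inv v w x))
          edge : ∀ x y → v ≡ x → v ≡ y → E x y ≡ E′ (swapF v w x) (swapF v w y)
          edge x y refl refl = trans (irr v) (sym (irr′ _))
          labs : ∀ x → v ≡ x → (A x , deg E x) ≡ (A′ (swapF v w x) , deg E′ (swapF v w x))
          labs x refl rewrite swapF-a v w = cong₂ _,_ (low Atr (T-down 3 τ)) (deg-tr (T-sub τ (0F ∷ [])))

        -- In the first graph the block is a child with its boundary. The game carries this identity
        -- to the answers `p′`, `q′`, and so the isomorphism of the child becomes one of blocks.
        branch : ∀ {v w d p q} → T (3 + D) E E′ (v ∷ a ∷ b ∷ c ∷ e ∷ []) (w ∷ a′ ∷ b′ ∷ c′ ∷ e′ ∷ []) →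
          block t E X A v d ≡ true → Child t E X S A d p q → BIso v w
        branch {v} {w} {d} {p} {q} τ r kid =
          let p′ , τ₁ = T-forth τ p
              q′ , τ₂ = T-forth τ₁ q
              i = oracle (T-sub τ₂ (1F ∷ 0F ∷ 3F ∷ 4F ∷ 5F ∷ 6F ∷ [])) (Child.valid kid) (Child.below kid)
              inside : ∀ x → iff (block t E X A v x) (inX t E p q x ∨ inS t E p q x) ≡ true
              inside = λ x → iff-intro (block-of-d r x)
              inside′ : ∀ x′ → iff (block t E′ X′ A′ w x′) (inX t E′ p′ q′ x′ ∨ inS t E′ p′ q′ x′) ≡ true
              inside′ = fact-tr τ₂ (λ σ → iff₂ (block-tr′ (T-sub σ (3F ∷ 0F ∷ 4F ∷ 5F ∷ 6F ∷ 7F ∷ [])))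
                         (X-tr′ {0} (T-sub σ (2F ∷ 1F ∷ 0F ∷ [])) ∨₂ S-tr (T-sub σ (2F ∷ 1F ∷ 0F ∷ [])))) inside
              inside-A : ∀ x → imp (inX t E p q x ∨ inS t E p q x) (iff (A x) (inS t E p q x)) ≡ true
              inside-A = λ x → imp-intro λ h → iff-intro (A-S₁ h)
              inside-A′ : ∀ x′ → imp (inX t E′ p′ q′ x′ ∨ inS t E′ p′ q′ x′) (iff (A′ x′) (inS t E′ p′ q′ x′)) ≡ true
              inside-A′ = fact-tr τ₂ (λ σ → let σ₁ = T-sub σ (2F ∷ 1F ∷ 0F ∷ []) in
                         imp₂ (X-tr′ {0} σ₁ ∨₂ S-tr σ₁) (iff₂ (low Atr (T-sub σ (0F ∷ 4F ∷ 5F ∷ 6F ∷ 7F ∷ []))) (S-tr σ₁))) inside-A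
              both = λ x → cong₂ _∨_ (Iso.onX i x) (Iso.onS i x)
              in-part = λ {x} (h : block t E X A v x ≡ true) → trans (sym (block-of-d r x)) h
          in record
            { π = Iso.π i
            ; onB = λ x → trans (block-of-d r x) (trans (both x) (sym (iff-elim (inside′ _))))
            ; edge = λ x y hx hy → Iso.edge i (in-part hx) (in-part hy)
            ; labs = λ x hx → cong₂ _,_
                (trans (A-S₁ (in-part hx)) (trans (Iso.onS i x) (sym (iff-elim (imp-elim (inside-A′ _) (trans (sym (both x)) (in-part hx)))))))
                (Iso.degs i (in-part hx)) }
          where
          open StarFacts cf quiet kid using (block-of-d; A-S₁)

        f-block : ∀ v → v ∈ X → BIso v (f ⟨$⟩ʳ v)
        f-block v v∈ with split (∃ᵇ λ d → block t E X A v d ∧ not (A d))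
        ... | inj₂ none = single (τf v) v∈ λ {d} h → not-false (≢true⇒false λ k → clash (∧-intro h k) (∃ᵇ-false none d))
        ... | inj₁ some =
          let d , h = ∃ᵇ-elim some
              r , na = ∧-elim h
              p , q , kid = child cf (block-X {v} {d} v∈ r) (not-elim na)
          in branch (τf v) r kid

        star : Iso E E′ X S X′ S′
        star = star-glue flat flat′ f (λ v → low Xtr (T-down 3 (τf v))) (λ v → low Str (T-down 3 (τf v)))
          (λ v → deg-tr (T-sub (τf v) (0F ∷ []))) f-block

      module Beta {p q p′ q′ : Fin n} (val : Valid t E p q) {s d p₁ q₁ p₁′ q₁′} (seen : Cases.Seen p q val s d p₁ q₁)
        (alone : ∀ {s e} → s ∈ inS t E p q → e ∈ inX t E p q → e ∉ inA t E p q → e ∉ inX t E p₁ q₁ → E s e ≡ false)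
        (τ : T (3 + D) E E′ (p ∷ q ∷ p₁ ∷ q₁ ∷ []) (p′ ∷ q′ ∷ p₁′ ∷ q₁′ ∷ []))
        (φ : PartIso t E E′ p₁ q₁ p₁′ q₁′) where

        open ValidPart p q val
        open Cases.One p q val seen using (A⊆S₁; X₁; S₁; S⊆K; K∉X₁; touch; below)
        open Cases.One.Only p q val seen alone using (filled)
        open Iso φ renaming (π to π₁; onX to on-X₁; onS to on-S₁; edge to edge₁; degs to degs₁)

        S′ = inS t E′ p′ q′
        X′ = inX t E′ p′ q′
        A′ = inA t E′ p′ q′
        X₁′ = inX t E′ p₁′ q₁′
        S₁′ = inS t E′ p₁′ q₁′

        Q Q′ : Fin n → Bool
        Q v = X₁ v ∨ S₁ v
        Q′ v = X₁′ v ∨ S₁′ v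

        rest : ℕ
        rest = count λ v → S v ∧ not (S₁ v)

        module Tr {k v v′} (σ : T (k + D) E E′ (v ∷ p ∷ q ∷ p₁ ∷ q₁ ∷ []) (v′ ∷ p′ ∷ q′ ∷ p₁′ ∷ q₁′ ∷ [])) where
          s-tr : S v ≡ S′ v′
          s-tr = S-tr (T-sub σ (1F ∷ 2F ∷ 0F ∷ []))
          x-tr : X v ≡ X′ v′
          x-tr = X-tr′ {k} (T-sub σ (1F ∷ 2F ∷ 0F ∷ []))
          a-tr : A v ≡ A′ v′
          a-tr = A-tr′ {k} (T-sub σ (1F ∷ 2F ∷ 0F ∷ []))
          s₁-tr : S₁ v ≡ S₁′ v′
          s₁-tr = S-tr (T-sub σ (3F ∷ 4F ∷ 0F ∷ []))
          x₁-tr : X₁ v ≡ X₁′ v′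
          x₁-tr = X-tr′ {k} (T-sub σ (3F ∷ 4F ∷ 0F ∷ []))

        open Tr

        drop₁ : ∀ {k u v u′ v′} → T k E E′ (v ∷ u ∷ p ∷ q ∷ p₁ ∷ q₁ ∷ []) (v′ ∷ u′ ∷ p′ ∷ q′ ∷ p₁′ ∷ q₁′ ∷ []) →
                T k E E′ (u ∷ p ∷ q ∷ p₁ ∷ q₁ ∷ []) (u′ ∷ p′ ∷ q′ ∷ p₁′ ∷ q₁′ ∷ [])
        drop₁ σ = T-sub σ (1F ∷ 2F ∷ 3F ∷ 4F ∷ 5F ∷ [])
        drop₂ : ∀ {k u v u′ v′} → T k E E′ (v ∷ u ∷ p ∷ q ∷ p₁ ∷ q₁ ∷ []) (v′ ∷ u′ ∷ p′ ∷ q′ ∷ p₁′ ∷ q₁′ ∷ []) →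
                T k E E′ (v ∷ p ∷ q ∷ p₁ ∷ q₁ ∷ []) (v′ ∷ p′ ∷ q′ ∷ p₁′ ∷ q₁′ ∷ [])
        drop₂ σ = T-sub σ (0F ∷ 2F ∷ 3F ∷ 4F ∷ 5F ∷ [])

        S₁-A∨S : ∀ {v} → v ∈ S₁ → v ∉ A → v ∈ S
        S₁-A∨S {v} h na with ∨-elim {S v} (S⊆K h)
        ... | inj₁ s = s
        ... | inj₂ a = clash a na

        -- vertices of A see outside the child only the rest of S, those of S also see p
        A-outdeg : ∀ {v} → v ∈ S₁ → A v ≡ (outdeg E Q v ≡ᵇ rest)
        A-outdeg {v} hv = Bool-ext
          (λ ha → ≡ᵇ-intro (count-cong λ w → Bool-ext
            (λ h → let e , nq = ∧-elim {E v w} h in out ha e (not-elim nq))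
            (λ h → let hs , ns = ∧-elim {S w} h in ∧-intro (adj-sym (S-A p q hs ha))
               (not-intro (∨-false (K∉X₁ (∨-introˡ hs)) (not-elim ns))))))
          (λ h → not-false (≢true⇒false λ na → <-irrefl (sym (≡ᵇ-elim h)) (more (S₁-A∨S hv (not-elim na)))))
          where
          out : ∀ {w} → v ∈ A → E v w ≡ true → w ∉ Q → S w ∧ not (S₁ w) ≡ true
          out {w} ha e nq with X-border p q (A⊆X p q ha) e
          ... | inj₂ hs = ∧-intro hs (not-intro (≢true⇒false λ k → clash (∨-introʳ {X₁ w} k) nq))
          ... | inj₁ hx with split (A w)
          ...   | inj₁ a = clash (∨-introʳ {X₁ w} (A⊆S₁ a)) nq
          ...   | inj₂ a = clash (∨-introˡ (filled hx a)) nq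
          more : v ∈ S → rest < outdeg E Q v
          more vs = count-strict
            (λ w h → let hs , ns = ∧-elim {S w} h in ∧-intro (clique vs hs λ { refl → clash hv (not-elim ns) })
               (not-intro (∨-false (K∉X₁ (∨-introˡ hs)) (not-elim ns))))
            p (∧-intro (proj₁ (∧-elim vs)) (not-intro (∨-false
                 (≢true⇒false λ h → clash (proj₁ (below h)) outside)
                 (≢true⇒false λ h → case (∨-elim {S p} (S⊆K h))))))
            (≢true⇒false λ h → clash (proj₁ (∧-elim {S p} h)) (p∉S p q))
            where
            case : p ∈ S ⊎ p ∈ A → ⊥
            case (inj₁ h) = clash h (p∉S p q)
            case (inj₂ h) = clash (A⊆X p q h) outside

        X-cover : ∀ v → X v ≡ X₁ v ∨ (S₁ v ∧ A v)
        X-cover v = Bool-ext there′ here′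
          where
          there′ : v ∈ X → X₁ v ∨ (S₁ v ∧ A v) ≡ true
          there′ h with split (A v)
          ... | inj₁ a = ∨-introʳ {X₁ v} (∧-intro (A⊆S₁ a) a)
          ... | inj₂ a = ∨-introˡ (filled h a)
          here′ : X₁ v ∨ (S₁ v ∧ A v) ≡ true → v ∈ X
          here′ h with ∨-elim {X₁ v} h
          ... | inj₁ m = proj₁ (below m)
          ... | inj₂ m = A⊆X p q (proj₂ (∧-elim {S₁ v} m))

        A-outdeg′ : ∀ {v} → v ∈ S₁′ → A′ v ≡ (outdeg E′ Q′ v ≡ᵇ rest)
        A-outdeg′ {v} h = iff-elim (imp-elim (fact-tr τ
          (λ σ → imp₂ (s₁-tr {2} σ) (iff₂ (a-tr {2} σ) (cong (_≡ᵇ rest) (count-tr σ λ ρ →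
             T-edge ρ 1F 0F ∧₂ not₂ (x₁-tr {1} (drop₂ ρ) ∨₂ s₁-tr {1} (drop₂ ρ))))))
          (λ v → imp-intro λ h → iff-intro (A-outdeg h)) v) h)

        X-cover′ : ∀ v → X′ v ≡ X₁′ v ∨ (S₁′ v ∧ A′ v)
        X-cover′ v = iff-elim (fact-tr τ (λ σ → iff₂ (x-tr {2} σ) (x₁-tr {2} σ ∨₂ s₁-tr {2} σ ∧₂ a-tr {2} σ)) (λ v → iff-intro (X-cover v)) v)

        clique′ : ∀ {u v} → S′ u ∨ A′ u ≡ true → S′ v ∨ A′ v ≡ true → u ≢ v → E′ u v ≡ true
        clique′ {u} {v} hu hv ne = imp-elim (fact₂-tr τ
          (λ σ → imp₂ ((s-tr {1} (drop₁ σ) ∨₂ a-tr {1} (drop₁ σ)) ∧₂ (s-tr {1} (drop₂ σ) ∨₂ a-tr {1} (drop₂ σ)) ∧₂ not₂ (T-same σ 1F 0F)) (T-edge σ 1F 0F))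
          (λ u v → imp-intro {(S u ∨ A u) ∧ (S v ∨ A v) ∧ not (u == v)} λ h →
             let h₁ , h₂ = ∧-elim h ; h₃ , h₄ = ∧-elim h₂ in K-clique h₁ h₃ (==-≢ (not-elim h₄)))
          u v) (∧-intro hu (∧-intro hv (not-intro (==-false ne))))

        hidden : ∀ {s x} → s ∈ S → s ∉ S₁ → x ∈ X₁ → E s x ≡ false
        hidden hs ns hx = ≢true⇒false λ e → clash (touch hx (adj-sym e) (∨-introˡ hs)) ns

        hidden′ : ∀ {s x} → s ∈ S′ → s ∉ S₁′ → x ∈ X₁′ → E′ s x ≡ false
        hidden′ {s} {x} hs ns hx = not-elim (imp-elim (fact₂-tr τ
          (λ σ → imp₂ (s-tr {1} (drop₁ σ) ∧₂ not₂ (s₁-tr {1} (drop₁ σ)) ∧₂ x₁-tr {1} (drop₂ σ)) (not₂ (T-edge σ 1F 0F)))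
          (λ s x → imp-intro {S s ∧ not (S₁ s) ∧ X₁ x} λ h →
             let h₁ , h₂ = ∧-elim h ; h₃ , h₄ = ∧-elim h₂ in not-intro (hidden h₁ (not-elim h₃) h₄))
          s x) (∧-intro hs (∧-intro (not-intro ns) hx)))

        S₁⊆K′ : ∀ {v} → v ∈ S₁′ → S′ v ∨ A′ v ≡ true
        S₁⊆K′ {v} h = imp-elim (fact-tr τ (λ σ → imp₂ (s₁-tr {2} σ) (s-tr {2} σ ∨₂ a-tr {2} σ)) (λ v → imp-intro S⊆K) v) h

        f = proj₁ (T-ext τ)
        τf = proj₂ (T-ext τ)

        -- `Q` contains all of `X`. Left over are vertices of `S` outside `S₁`; they see the rest of
        -- the clique and nothing in `X₁`, so they may follow `f`.
        joined = glue Q Q′ π₁ f (λ v → cong₂ _∨_ (on-X₁ v) (on-S₁ v)) (λ v → cong₂ _∨_ (x₁-tr {2} (τf v)) (s₁-tr {2} (τf v)))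
        Φ = proj₁ joined
        Φ-in : ∀ {v} → v ∈ Q → Φ ⟨$⟩ʳ v ≡ π₁ ⟨$⟩ʳ v
        Φ-in = proj₁ (proj₂ joined) _
        Φ-out : ∀ {v} → v ∉ Q → Φ ⟨$⟩ʳ v ≡ f ⟨$⟩ʳ v
        Φ-out = proj₂ (proj₂ joined) _

        -- Inside `S₁` the set `A` is characterised by the number of outer neighbours, which
        -- `Iso-outdeg` preserves. This is the purpose of the degrees in `Iso`.
        on-A₁ : ∀ {v} → v ∈ S₁ → A v ≡ A′ (π₁ ⟨$⟩ʳ v)
        on-A₁ {v} h = trans (A-outdeg h) (trans (cong (_≡ᵇ rest) (Iso-outdeg φ (∨-introʳ {X₁ v} h))) (sym (A-outdeg′ (trans (sym (on-S₁ v)) h))))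

        onX : ∀ v → X v ≡ X′ (Φ ⟨$⟩ʳ v)
        onX v with split (Q v)
        ... | inj₂ h = trans (x-tr {2} (τf v)) (cong X′ (sym (Φ-out h)))
        ... | inj₁ h = trans (X-cover v) (trans (trans (cong₂ _∨_ (on-X₁ v) S₁A) (sym (X-cover′ _))) (cong X′ (sym (Φ-in h))))
          where
          S₁A : S₁ v ∧ A v ≡ S₁′ (π₁ ⟨$⟩ʳ v) ∧ A′ (π₁ ⟨$⟩ʳ v)
          S₁A with split (S₁ v)
          ... | inj₁ k = cong₂ _∧_ (on-S₁ v) (on-A₁ k)
          ... | inj₂ k rewrite k | sym (on-S₁ v) | k = refl

        onS : ∀ v → S v ≡ S′ (Φ ⟨$⟩ʳ v)
        onS v with split (Q v)
        ... | inj₂ h = trans (s-tr {2} (τf v)) (cong S′ (sym (Φ-out h)))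
        ... | inj₁ h = trans (go (∨-elim {X₁ v} h)) (cong S′ (sym (Φ-in h)))
          where
          go : v ∈ X₁ ⊎ v ∈ S₁ → S v ≡ S′ (π₁ ⟨$⟩ʳ v)
          go (inj₁ m) = trans (X∉S p q (proj₁ (below m)))
            (sym (H.X∉S p′ q′ (trans (X-cover′ _) (∨-introˡ (trans (sym (on-X₁ v)) m)))))
          go (inj₂ m) with split (A v)
          ... | inj₁ a = trans (Cases.A∉S p q val a) (sym (H.X∉S p′ q′ (H.A⊆X p′ q′ (trans (sym (on-A₁ m)) a))))
          ... | inj₂ a with ∨-elim {S′ (π₁ ⟨$⟩ʳ v)} (S₁⊆K′ (trans (sym (on-S₁ v)) m))
          ...   | inj₁ k = trans (S₁-A∨S m a) (sym k)
          ...   | inj₂ k = clash k (trans (sym (on-A₁ m)) a)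

        Outer : Fin n → Set
        Outer v = v ∈ S × v ∉ S₁ × v ∉ Q

        classify : ∀ {v} → X v ∨ S v ≡ true → v ∈ Q ⊎ Outer v
        classify {v} h with split (Q v)
        ... | inj₁ k = inj₁ k
        ... | inj₂ k with ∨-elim {X v} h
        ...   | inj₂ s = inj₂ (s , ≢true⇒false (λ m → clash (∨-introʳ {X₁ v} m) k) , k)
        ...   | inj₁ x with ∨-elim {X₁ v} (trans (sym (X-cover v)) x)
        ...     | inj₁ m = clash (∨-introˡ m) k
        ...     | inj₂ m = clash (∨-introʳ {X₁ v} (proj₁ (∧-elim m))) k

        outer-S′ : ∀ {v} → Outer v → S′ (Φ ⟨$⟩ʳ v) ≡ true
        outer-S′ {v} (s , _ , _) = trans (sym (onS v)) s

        outer-S₁′ : ∀ {v} → Outer v → S₁′ (Φ ⟨$⟩ʳ v) ≡ false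
        outer-S₁′ {v} (_ , n₁ , nq) = trans (cong S₁′ (Φ-out nq)) (trans (sym (s₁-tr {2} (τf v))) n₁)

        Φ-≢ : ∀ {u v} → u ≢ v → Φ ⟨$⟩ʳ u ≢ Φ ⟨$⟩ʳ v
        Φ-≢ ne e = ne (perm-inj Φ e)

        mixed : ∀ {u v} → u ∈ Q → Outer v → E v u ≡ E′ (Φ ⟨$⟩ʳ v) (Φ ⟨$⟩ʳ u)
        mixed {u} {v} hu ov@(vs , n₁ , nq) with ∨-elim {X₁ u} hu
        ... | inj₁ m = trans (hidden vs n₁ m) (sym (hidden′ (outer-S′ ov) (outer-S₁′ ov)
                         (trans (cong X₁′ (Φ-in hu)) (trans (sym (on-X₁ u)) m))))
        ... | inj₂ m = trans (K-clique (∨-introˡ vs) (S⊆K m) ne)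
                         (sym (clique′ (∨-introˡ (outer-S′ ov)) (S₁⊆K′ (trans (cong S₁′ (Φ-in hu)) (trans (sym (on-S₁ u)) m))) (Φ-≢ ne)))
          where
          ne : v ≢ u
          ne refl = clash m n₁

        edge : ∀ {u v} → X u ∨ S u ≡ true → X v ∨ S v ≡ true → E u v ≡ E′ (Φ ⟨$⟩ʳ u) (Φ ⟨$⟩ʳ v)
        edge {u} {v} hu hv with classify hu | classify hv
        ... | inj₁ a | inj₁ b = trans (edge₁ a b) (cong₂ E′ (sym (Φ-in a)) (sym (Φ-in b)))
        ... | inj₁ a | inj₂ b = trans (sy u v) (trans (mixed a b) (sy′ _ _))
        ... | inj₂ a | inj₁ b = mixed b a
        ... | inj₂ a | inj₂ b with split (u == v)
        ...   | inj₁ e rewrite ==-elim e = trans (irr v) (sym (irr′ _))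
        ...   | inj₂ e = trans (clique (proj₁ a) (proj₁ b) (==-≢ e))
                           (sym (clique′ (∨-introˡ (outer-S′ a)) (∨-introˡ (outer-S′ b)) (Φ-≢ (==-≢ e))))

        degs : ∀ {v} → X v ∨ S v ≡ true → deg E v ≡ deg E′ (Φ ⟨$⟩ʳ v)
        degs {v} h with split (Q v)
        ... | inj₁ a = trans (degs₁ a) (cong (deg E′) (sym (Φ-in a)))
        ... | inj₂ b = trans (deg-tr (T-sub (τf v) (0F ∷ []))) (cong (deg E′) (sym (Φ-out b)))

        beta : PartIso t E E′ p q p′ q′
        beta = record { π = Φ ; onX = onX ; onS = onS ; edge = edge ; degs = degs }

      module Gamma {p q p′ q′ : Fin n} (val : Valid t E p q) {s d p₁ q₁ s₂ d₂ p₂ q₂ p₁′ q₁′ p₂′ q₂′}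
        (seen₁ : Cases.Seen p q val s d p₁ q₁) (seen₂ : Cases.Seen p q val s₂ d₂ p₂ q₂) (new : d₂ ∉ inX t E p₁ q₁)
        (τ : T (2 + D) E E′ (p ∷ q ∷ p₁ ∷ q₁ ∷ p₂ ∷ q₂ ∷ []) (p′ ∷ q′ ∷ p₁′ ∷ q₁′ ∷ p₂′ ∷ q₂′ ∷ []))
        (φ₁ : PartIso t E E′ p₁ q₁ p₁′ q₁′) (φ₂ : PartIso t E E′ p₂ q₂ p₂′ q₂′) where

        open ValidPart p q val using (X; S; A; K-clique; config)
        open Cases.Seen seen₁ using () renaming (kid to kid₁)
        open Cases.Seen seen₂ using () renaming (kid to kid₂)

        new′ : d ∉ inX t E p₂ q₂
        new′ = ≢true⇒false λ h → clash h (Cases.Two.disjoint p q val seen₁ seen₂ new (Child.member kid₁))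

        S′ = inS t E′ p′ q′
        X′ = inX t E′ p′ q′
        A′ = inA t E′ p′ q′
        X₁ = inX t E p₁ q₁
        S₁ = inS t E p₁ q₁
        X₁′ = inX t E′ p₁′ q₁′
        S₁′ = inS t E′ p₁′ q₁′
        X₂ = inX t E p₂ q₂
        S₂ = inS t E p₂ q₂
        X₂′ = inX t E′ p₂′ q₂′
        S₂′ = inS t E′ p₂′ q₂′

        cover : ∀ v → X v ≡ X₁ v ∨ (X₂ v ∨ A v)
        cover v = Bool-ext covered covers
          where
          covered : v ∈ X → X₁ v ∨ (X₂ v ∨ A v) ≡ true
          covered h = by-A (split (A v))
            where
            by-child : v ∈ X₁ ⊎ v ∈ X₂ → X₁ v ∨ (X₂ v ∨ A v) ≡ true
            by-child (inj₁ m) = ∨-introˡ m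
            by-child (inj₂ m) = ∨-introʳ {X₁ v} (∨-introˡ m)
            by-A : v ∈ A ⊎ v ∉ A → X₁ v ∨ (X₂ v ∨ A v) ≡ true
            by-A (inj₁ a) = ∨-introʳ {X₁ v} (∨-introʳ {X₂ v} a)
            by-A (inj₂ a) = by-child (Cases.Two.filled p q val seen₁ seen₂ new h a)
          covers : X₁ v ∨ (X₂ v ∨ A v) ≡ true → v ∈ X
          covers h with ∨-elim {X₁ v} h
          ... | inj₁ m = proj₁ (Child.below kid₁ m)
          ... | inj₂ m with ∨-elim {X₂ v} m
          ...   | inj₁ k = proj₁ (Child.below kid₂ k)
          ...   | inj₂ k = A⊆X p q k

        unif₁ : ∀ x v → x ∈ X₁ → S v ∨ A v ≡ true → E v x ≡ S₁ v ∧ E q x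
        unif₁ x v hx hv with split (S₁ v)
        ... | inj₁ h = trans (Cases.Two.uniform p q val seen₁ seen₂ new h hx) (cong (_∧ E q x) (sym h))
        ... | inj₂ h = trans (≢true⇒false λ e → clash (ChildFacts.touch config kid₁ hx (adj-sym e) hv) h) (cong (_∧ E q x) (sym h))

        unif₂ : ∀ x v → x ∈ X₂ → S v ∨ A v ≡ true → E v x ≡ S₂ v ∧ E q x
        unif₂ x v hx hv with split (S₂ v)
        ... | inj₁ h = trans (Cases.Two.uniform p q val seen₂ seen₁ new′ h hx) (cong (_∧ E q x) (sym h))
        ... | inj₂ h = trans (≢true⇒false λ e → clash (ChildFacts.touch config kid₂ hx (adj-sym e) hv) h) (cong (_∧ E q x) (sym h))

        fork : Fork E X S A X₁ S₁ X₂ S₂ q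
        fork = record
          { cover = cover ; apart = λ v → X∉S p q
          ; offA = λ v h → off (∨-elim {X₁ v} h)
          ; disjoint = λ v → Cases.Two.disjoint p q val seen₁ seen₂ new ; far = λ x y → Cases.Two.apart₁₂ p q val seen₁ seen₂ new ; clique = λ u v → K-clique
          ; bord₁ = λ v → Child.border kid₁ ; bord₂ = λ v → Child.border kid₂ ; unif₁ = unif₁ ; unif₂ = unif₂ }
          where
          off : ∀ {v} → v ∈ X₁ ⊎ v ∈ X₂ → v ∉ A
          off (inj₁ h) = proj₂ (Child.below kid₁ h)
          off (inj₂ h) = proj₂ (Child.below kid₂ h)

        module Tr {k v v′} (σ : T (k + D) E E′ (v ∷ p ∷ q ∷ p₁ ∷ q₁ ∷ p₂ ∷ q₂ ∷ []) (v′ ∷ p′ ∷ q′ ∷ p₁′ ∷ q₁′ ∷ p₂′ ∷ q₂′ ∷ [])) where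
          s-tr : S v ≡ S′ v′
          s-tr = S-tr (T-sub σ (1F ∷ 2F ∷ 0F ∷ []))
          x-tr : X v ≡ X′ v′
          x-tr = X-tr′ {k} (T-sub σ (1F ∷ 2F ∷ 0F ∷ []))
          a-tr : A v ≡ A′ v′
          a-tr = A-tr′ {k} (T-sub σ (1F ∷ 2F ∷ 0F ∷ []))
          k-tr : S v ∨ A v ≡ S′ v′ ∨ A′ v′
          k-tr = s-tr ∨₂ a-tr
          s₁-tr : S₁ v ≡ S₁′ v′
          s₁-tr = S-tr (T-sub σ (3F ∷ 4F ∷ 0F ∷ []))
          x₁-tr : X₁ v ≡ X₁′ v′
          x₁-tr = X-tr′ {k} (T-sub σ (3F ∷ 4F ∷ 0F ∷ []))
          s₂-tr : S₂ v ≡ S₂′ v′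
          s₂-tr = S-tr (T-sub σ (5F ∷ 6F ∷ 0F ∷ []))
          x₂-tr : X₂ v ≡ X₂′ v′
          x₂-tr = X-tr′ {k} (T-sub σ (5F ∷ 6F ∷ 0F ∷ []))

        open Tr

        drop₁ : ∀ {k u v u′ v′} → T k E E′ (v ∷ u ∷ p ∷ q ∷ p₁ ∷ q₁ ∷ p₂ ∷ q₂ ∷ []) (v′ ∷ u′ ∷ p′ ∷ q′ ∷ p₁′ ∷ q₁′ ∷ p₂′ ∷ q₂′ ∷ []) →
                T k E E′ (u ∷ p ∷ q ∷ p₁ ∷ q₁ ∷ p₂ ∷ q₂ ∷ []) (u′ ∷ p′ ∷ q′ ∷ p₁′ ∷ q₁′ ∷ p₂′ ∷ q₂′ ∷ [])
        drop₁ σ = T-sub σ (1F ∷ 2F ∷ 3F ∷ 4F ∷ 5F ∷ 6F ∷ 7F ∷ [])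
        drop₂ : ∀ {k u v u′ v′} → T k E E′ (v ∷ u ∷ p ∷ q ∷ p₁ ∷ q₁ ∷ p₂ ∷ q₂ ∷ []) (v′ ∷ u′ ∷ p′ ∷ q′ ∷ p₁′ ∷ q₁′ ∷ p₂′ ∷ q₂′ ∷ []) →
                T k E E′ (v ∷ p ∷ q ∷ p₁ ∷ q₁ ∷ p₂ ∷ q₂ ∷ []) (v′ ∷ p′ ∷ q′ ∷ p₁′ ∷ q₁′ ∷ p₂′ ∷ q₂′ ∷ [])
        drop₂ σ = T-sub σ (0F ∷ 2F ∷ 3F ∷ 4F ∷ 5F ∷ 6F ∷ 7F ∷ [])

        open Fork fork using (offA; disjoint; far; clique; bord₁; bord₂)

        -- Apart from the disjointness of `X′` and `S′`, which holds for every such pair, each field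
        -- is a fact about at most two vertices; the two rounds beyond `D` pay for these.
        fork′ : Fork E′ X′ S′ A′ X₁′ S₁′ X₂′ S₂′ q′
        fork′ = record
          { cover = λ v → iff-elim (fact-tr τ (λ σ → iff₂ (x-tr {1} σ) (x₁-tr {1} σ ∨₂ x₂-tr {1} σ ∨₂ a-tr {1} σ)) (λ v → iff-intro (cover v)) v)
          ; apart = λ v → H.X∉S p′ q′
          ; offA = λ v h → not-elim (imp-elim (fact-tr τ (λ σ → imp₂ (x₁-tr {1} σ ∨₂ x₂-tr {1} σ) (not₂ (a-tr {1} σ)))
                     (λ v → imp-intro {X₁ v ∨ X₂ v} λ h → not-intro (offA v h)) v) h)
          ; disjoint = λ v h → not-elim (imp-elim (fact-tr τ (λ σ → imp₂ (x₁-tr {1} σ) (not₂ (x₂-tr {1} σ)))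
                     (λ v → imp-intro λ h → not-intro (disjoint v h)) v) h)
          ; far = λ x y hx hy → not-elim (imp-elim (fact₂-tr τ (λ σ → imp₂ (x₁-tr {0} (drop₁ σ) ∧₂ x₂-tr {0} (drop₂ σ)) (not₂ (T-edge σ 1F 0F)))
                     (λ x y → imp-intro {X₁ x ∧ X₂ y} λ h → let a , b = ∧-elim h in not-intro (far x y a b)) x y) (∧-intro hx hy))
          ; clique = λ u v hu hv ne → imp-elim (fact₂-tr τ (λ σ → imp₂ (k-tr {0} (drop₁ σ) ∧₂ k-tr {0} (drop₂ σ) ∧₂ not₂ (T-same σ 1F 0F)) (T-edge σ 1F 0F))
                     (λ u v → imp-intro {(S u ∨ A u) ∧ (S v ∨ A v) ∧ not (u == v)} λ h →
                        let h₁ , h₂ = ∧-elim h ; h₃ , h₄ = ∧-elim h₂ in clique u v h₁ h₃ (==-≢ (not-elim h₄)))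
                     u v) (∧-intro hu (∧-intro hv (not-intro (==-false ne))))
          ; bord₁ = λ v h → imp-elim (fact-tr τ (λ σ → imp₂ (s₁-tr {1} σ) (k-tr {1} σ)) (λ v → imp-intro (bord₁ v)) v) h
          ; bord₂ = λ v h → imp-elim (fact-tr τ (λ σ → imp₂ (s₂-tr {1} σ) (k-tr {1} σ)) (λ v → imp-intro (bord₂ v)) v) h
          ; unif₁ = λ x v hx hv → iff-elim (imp-elim (fact₂-tr τ
                     (λ σ → imp₂ (x₁-tr {0} (drop₁ σ) ∧₂ k-tr {0} (drop₂ σ)) (iff₂ (T-edge σ 0F 1F) (s₁-tr {0} (drop₂ σ) ∧₂ T-edge σ 3F 1F)))
                     (λ x v → imp-intro {X₁ x ∧ (S v ∨ A v)} λ h → let a , b = ∧-elim {X₁ x} h in iff-intro (unif₁ x v a b)) x v) (∧-intro hx hv))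
          ; unif₂ = λ x v hx hv → iff-elim (imp-elim (fact₂-tr τ
                     (λ σ → imp₂ (x₂-tr {0} (drop₁ σ) ∧₂ k-tr {0} (drop₂ σ)) (iff₂ (T-edge σ 0F 1F) (s₂-tr {0} (drop₂ σ) ∧₂ T-edge σ 3F 1F)))
                     (λ x v → imp-intro {X₂ x ∧ (S v ∨ A v)} λ h → let a , b = ∧-elim {X₂ x} h in iff-intro (unif₂ x v a b)) x v) (∧-intro hx hv)) }

        gamma : PartIso t E E′ p q p′ q′
        gamma = let f , τf = T-ext τ in
          ForkGlue.fork-glue E E′ simple simple′ fork fork′ (Cases.One.A⊆S₁ p q val seen₁ (q∈A p q)) (Cases.One.A⊆S₁ p q val seen₂ (q∈A p q))
            f (λ v → s-tr {1} (τf v)) (λ v → a-tr {1} (τf v)) (λ v → x₁-tr {1} (τf v)) (λ v → s₁-tr {1} (τf v))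
            (λ v → x₂-tr {1} (τf v)) (λ v → s₂-tr {1} (τf v)) (λ v → deg-tr (T-sub (τf v) (0F ∷ []))) φ₁ φ₂

      -- `o` and `c` stay in the tuple because a heavy child is identified by its size inside the
      -- part that they define.
      Oracle : (o c p q o′ c′ p′ q′ : Fin n) → Set
      Oracle o c p q o′ c′ p′ q′ = ∀ {p₁ q₁ p₁′ q₁′} → T (1 + D) E E′ (p₁ ∷ q₁ ∷ o ∷ c ∷ p ∷ q ∷ []) (p₁′ ∷ q₁′ ∷ o′ ∷ c′ ∷ p′ ∷ q′ ∷ []) →
        Valid t E p₁ q₁ → (∀ {v} → v ∈ inX t E p₁ q₁ → v ∈ inX t E p q × v ∉ inA t E p q) → PartIso t E E′ p₁ q₁ p₁′ q₁′

      module _ {o c p q o′ c′ p′ q′ : Fin n} (val : Valid t E p q)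
        (τ : T (6 + D) E E′ (o ∷ c ∷ p ∷ q ∷ []) (o′ ∷ c′ ∷ p′ ∷ q′ ∷ [])) (oracle : Oracle o c p q o′ c′ p′ q′) where

        open ValidPart p q val using (config)

        private
          S = inS t E p q
          X = inX t E p q
          A = inA t E p q

          alpha : (∀ {s d} → s ∈ S → d ∈ X → d ∉ A → E s d ≡ false) → PartIso t E E′ p q p′ q′
          alpha quiet = Star.star {o} {c} {p} {q} {o′} {c′} {p′} {q′} config quiet
            (λ v → H.X∉S p′ q′) (λ v → H.A⊆X p′ q′)
            (λ σ → X-tr (T-down 1 (T-sub σ (3F ∷ 4F ∷ 0F ∷ [])))) (λ σ → S-tr (T-sub σ (3F ∷ 4F ∷ 0F ∷ []))) (λ σ → A-tr (T-sub σ (3F ∷ 4F ∷ 0F ∷ [])))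
            (T-down 2 τ) oracle

          one : ∀ {s d p₁ q₁} → Cases.Seen p q val s d p₁ q₁ →
            (∀ {s e} → s ∈ S → e ∈ X → e ∉ A → e ∉ inX t E p₁ q₁ → E s e ≡ false) → PartIso t E E′ p q p′ q′
          one {p₁ = p₁} {q₁} seen alone =
            let p₁′ , τ₁ = T-forth τ p₁
                q₁′ , τ₂ = T-forth τ₁ q₁
            in Beta.beta val seen alone (T-down 1 (T-sub τ₂ (4F ∷ 5F ∷ 1F ∷ 0F ∷ [])))
                 (oracle (T-down 3 (T-sub τ₂ (1F ∷ 0F ∷ 2F ∷ 3F ∷ 4F ∷ 5F ∷ []))) (Child.valid (Cases.Seen.kid seen)) (Child.below (Cases.Seen.kid seen)))

          -- This case accounts for the six rounds beyond `D`: four place the two children, and two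
          -- remain for facts about pairs of vertices.
          two : ∀ {s d p₁ q₁ s₂ d₂ p₂ q₂} → Cases.Seen p q val s d p₁ q₁ → Cases.Seen p q val s₂ d₂ p₂ q₂ → d₂ ∉ inX t E p₁ q₁ → PartIso t E E′ p q p′ q′
          two {p₁ = p₁} {q₁} {p₂ = p₂} {q₂} seen₁ seen₂ new =
            let p₁′ , τ₁ = T-forth τ p₁
                q₁′ , τ₂ = T-forth τ₁ q₁
                p₂′ , τ₃ = T-forth τ₂ p₂
                q₂′ , τ₄ = T-forth τ₃ q₂
            in Gamma.gamma val seen₁ seen₂ new (T-sub τ₄ (6F ∷ 7F ∷ 3F ∷ 2F ∷ 1F ∷ 0F ∷ []))
                 (oracle (T-down 1 (T-sub τ₄ (3F ∷ 2F ∷ 4F ∷ 5F ∷ 6F ∷ 7F ∷ []))) (Child.valid (Cases.Seen.kid seen₁)) (Child.below (Cases.Seen.kid seen₁)))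
                 (oracle (T-down 1 (T-sub τ₄ (1F ∷ 0F ∷ 4F ∷ 5F ∷ 6F ∷ 7F ∷ []))) (Child.valid (Cases.Seen.kid seen₂)) (Child.below (Cases.Seen.kid seen₂)))

          Sight : (Fin n → Bool) → Set
          Sight P = ∃ λ s → ∃ λ d → s ∈ S × d ∈ X × d ∉ A × d ∈ P × E s d ≡ true

          sees : (Fin n → Bool) → Bool
          sees P = ∃ᵇ λ s → ∃ᵇ λ d → S s ∧ (X d ∧ (not (A d) ∧ (P d ∧ E s d)))

          Blind : (Fin n → Bool) → Set
          Blind P = ∀ {s d} → s ∈ S → d ∈ X → d ∉ A → d ∈ P → E s d ≡ false

          sight? : ∀ P → Sight P ⊎ Blind P
          sight? P = by (split (sees P))
            where
            by : sees P ≡ true ⊎ sees P ≡ false → Sight P ⊎ Blind P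
            by (inj₁ h) =
              let s , k = ∃ᵇ-elim h ; d , m = ∃ᵇ-elim k
                  a , m₁ = ∧-elim {S s} m ; b , m₂ = ∧-elim {X d} m₁ ; c , m₃ = ∧-elim {not (A d)} m₂ ; e , g = ∧-elim {P d} m₃
              in inj₁ (s , d , a , b , not-elim c , e , g)
            by (inj₂ h) = inj₂ λ {s} {d} a b c e → ≢true⇒false λ g →
              clash (∧-intro a (∧-intro b (∧-intro (not-intro c) (∧-intro e g)))) (∃ᵇ-false (∃ᵇ-false h s) d)

          seen-from : ∀ {P} ((s , d , _) : Sight P) → ∃ λ p₁ → ∃ λ q₁ → Cases.Seen p q val s d p₁ q₁
          seen-from (s , d , hs , hx , na , _ , e) = let p₁ , q₁ , kid = child config hx na in
            p₁ , q₁ , record { s∈S = hs ; d∈X = hx ; d∉A = na ; s~d = e ; kid = kid }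

          second : ∀ {s d p₁ q₁} → Cases.Seen p q val s d p₁ q₁ → Sight (λ e → not (inX t E p₁ q₁ e)) ⊎ Blind (λ e → not (inX t E p₁ q₁ e)) → PartIso t E E′ p q p′ q′
          second seen₁ (inj₂ blind) = one seen₁ λ hs hx na nx → blind hs hx na (not-intro nx)
          second seen₁ (inj₁ w@(_ , _ , _ , _ , _ , new , _)) = let _ , _ , seen₂ = seen-from w in two seen₁ seen₂ (not-elim new)

          first : Sight (λ _ → true) ⊎ Blind (λ _ → true) → PartIso t E E′ p q p′ q′
          first (inj₂ blind) = alpha λ hs hx na → blind hs hx na refl
          first (inj₁ w) = let p₁ , q₁ , seen₁ = seen-from w in second seen₁ (sight? (λ e → not (inX t E p₁ q₁ e)))

        part-step : PartIso t E E′ p q p′ q′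
        part-step = first (sight? (λ _ → true))

    rounds : ℕ → ℕ
    rounds = game-length t

    rounds-base : ∀ j → t + suc t ≤ rounds j
    rounds-base zero    = ≤-refl
    rounds-base (suc j) = ≤-trans (rounds-base j) (m≤n+m _ 14)

    t≤rounds : ∀ j → t ≤ rounds j
    t≤rounds j = ≤-trans (m≤m+n t (suc t)) (rounds-base j)

    -- A boundary vertex sees `q`, which lies in the other part too. It is therefore in that part or
    -- in its boundary, and the former is excluded as the parts are equal.
    boundary-≡ : ∀ {p q p₁ q₁} → (∀ v → inX t E p q v ≡ inX t E p₁ q₁ v) → ∀ {v} → v ∈ inS t E p q → v ∈ inS t E p₁ q₁
    boundary-≡ {p} {q} {p₁} {q₁} same {v} h with X-border p₁ q₁ (trans (sym (same q)) (q∈X p q)) (adj-sym (proj₂ (∧-elim {E v p} h)))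
    ... | inj₂ s = s
    ... | inj₁ x = clash h (X∉S p q (trans (same v) x))

    retarget : ∀ {X S X′ S′ X″ S″ : Fin n → Bool} → (∀ v → X′ v ≡ X″ v) → (∀ v → S′ v ≡ S″ v) → Iso E E′ X S X′ S′ → Iso E E′ X S X″ S″
    retarget hx hs i = record { π = Iso.π i ; onX = λ v → trans (Iso.onX i v) (hx _) ; onS = λ v → trans (Iso.onS i v) (hs _) ; edge = Iso.edge i ; degs = Iso.degs i }

    -- A part of size at least 2 ^ j inside a part of size less than 2 ^ suc j is determined there by its size.
    module Unique (j : ℕ) {o c o′ c′ : Fin n} (V₀ : Valid t E o c) (small : count (inX t E o c) < 2 ^ suc j) where

      meeting : ∀ {P Q : Fin n → Bool} → (∀ {v} → v ∈ P → v ∈ inX t E o c) → (∀ {v} → v ∈ Q → v ∈ inX t E o c) →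
        2 ^ j ≤ count P → 2 ^ j ≤ count Q → ∃ λ x → x ∈ P × x ∈ Q
      meeting {P} {Q} subP subQ bp bq with split (∃ᵇ λ x → P x ∧ Q x)
      ... | inj₁ h = let x , k = ∃ᵇ-elim h in x , ∧-elim k
      ... | inj₂ h = ⊥-elim (<-irrefl refl (<-≤-trans small (≤-trans (≤-reflexive (cong (2 ^ j +_) (+-identityʳ _))) (≤-trans (+-mono-≤ bp bq)
              (count-disjoint (λ i p → subP p , ≢true⇒false λ q → clash (∧-intro p q) (∃ᵇ-false h i)) (λ i → subQ))))))

      equal : ∀ {p q p₁ q₁} → Valid t E p q → Valid t E p₁ q₁ →
        (∀ {v} → v ∈ inX t E p q → v ∈ inX t E o c) → (∀ {v} → v ∈ inX t E p₁ q₁ → v ∈ inX t E o c) →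
        count (inX t E p q) ≡ count (inX t E p₁ q₁) → 2 ^ j ≤ count (inX t E p₁ q₁) → ∀ v → inX t E p q v ≡ inX t E p₁ q₁ v
      equal {p} {q} {p₁} {q₁} V V₁ sub sub₁ size heavy = go (meeting sub sub₁ (subst (2 ^ j ≤_) (sym size) heavy) heavy)
        where
        go : (∃ λ x → x ∈ inX t E p q × x ∈ inX t E p₁ q₁) → ∀ v → inX t E p q v ≡ inX t E p₁ q₁ v
        go (x , hx , hx₁) v with nested V₀ V V₁ sub sub₁ hx hx₁
        ... | inj₁ le = Bool-ext le (count-≡⇒⊆ (λ _ → le) size v)
        ... | inj₂ ge = Bool-ext (count-≡⇒⊆ (λ _ → ge) (sym size) v) ge

      module _ {p₁ q₁ p₁′ q₁′ p* q* : Fin n} (V₁ : Valid t E p₁ q₁) (sub₁ : ∀ {v} → v ∈ inX t E p₁ q₁ → v ∈ inX t E o c)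
        (heavy : 2 ^ j ≤ count (inX t E p₁ q₁))
        (τ* : T (5 + rounds j) E E′ (o ∷ c ∷ p₁ ∷ q₁ ∷ []) (o′ ∷ c′ ∷ p* ∷ q* ∷ []))
        (τ₁ : T (5 + rounds j) E E′ (o ∷ c ∷ p₁ ∷ q₁ ∷ []) (o′ ∷ c′ ∷ p₁′ ∷ q₁′ ∷ [])) where

        private
          module F = PartTransfer t E E′ (rounds j) (t≤rounds j)
          module B = PartTransfer t E′ E (rounds j) (t≤rounds j)
          -- Uniqueness is known in the first graph only. Hence `p*` and `q*` are pulled back there
          -- along `τ₁`; validity, inclusion and size reach `y` and `z` from `p₁` and `q₁` by way of
          -- `p*` and `q*`. The resulting equality is then carried forward to the second graph.
          y-step = T-back τ₁ p*
          y = proj₁ y-step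
          z-step = T-back (proj₂ y-step) q*
          z = proj₁ z-step
          σ : T (3 + rounds j) E E′ (z ∷ y ∷ o ∷ c ∷ p₁ ∷ q₁ ∷ []) (q* ∷ p* ∷ o′ ∷ c′ ∷ p₁′ ∷ q₁′ ∷ [])
          σ = proj₂ z-step
          σ⁻ : T (3 + rounds j) E′ E (o′ ∷ c′ ∷ p* ∷ q* ∷ []) (o ∷ c ∷ y ∷ z ∷ [])
          σ⁻ = T-sym (T-sub σ (2F ∷ 3F ∷ 1F ∷ 0F ∷ []))
          V : Valid t E y z
          V = B.valid-tr (T-down 1 (T-sub σ⁻ (2F ∷ 3F ∷ []))) (F.valid-tr (T-down 3 (T-sub τ* (2F ∷ 3F ∷ []))) V₁)
          sub : ∀ {v} → v ∈ inX t E y z → v ∈ inX t E o c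
          sub = B.subset-tr (T-down 2 σ⁻) (F.subset-tr (T-down 4 τ*) sub₁)
          size : count (inX t E y z) ≡ count (inX t E p₁ q₁)
          size = sym (trans (F.size-tr (T-down 4 (T-sub τ* (2F ∷ 3F ∷ [])))) (B.size-tr (T-down 2 (T-sub σ⁻ (2F ∷ 3F ∷ [])))))
          same : ∀ v → inX t E y z v ≡ inX t E p₁ q₁ v
          same = equal V V₁ sub sub₁ size heavy

        same-X′ : ∀ v → inX t E′ p* q* v ≡ inX t E′ p₁′ q₁′ v
        same-X′ v = iff-elim (fact-tr σ (λ ρ → iff₂ (F.member-tr {2} (T-sub ρ (2F ∷ 1F ∷ 0F ∷ []))) (F.member-tr {2} (T-sub ρ (5F ∷ 6F ∷ 0F ∷ []))))
          (λ v → iff-intro (same v)) v)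

        same-S′ : ∀ v → inS t E′ p* q* v ≡ inS t E′ p₁′ q₁′ v
        same-S′ v = iff-elim (fact-tr σ (λ ρ → iff₂ (S-tr (T-sub ρ (2F ∷ 1F ∷ 0F ∷ []))) (S-tr (T-sub ρ (5F ∷ 6F ∷ 0F ∷ []))))
          (λ v → iff-intro (Bool-ext (boundary-≡ same) (boundary-≡ (λ v → sym (same v))))) v)

    -- A light part passes to a smaller `j`. For heavy ones, two of the fourteen rounds place a
    -- member of the chain next to `o` and `c`. With the other twelve `part-step` runs at
    -- `D = 6 + rounds j`, and its oracle keeps seven rounds beyond `rounds j` to compare two
    -- answers to the same child.
    parts-isomorphic : ∀ j {o c o′ c′} → Valid t E o c → count (inX t E o c) < 2 ^ j →
      T (rounds j) E E′ (o ∷ c ∷ []) (o′ ∷ c′ ∷ []) → PartIso t E E′ o c o′ c′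
    parts-isomorphic zero V small τ = ⊥-elim (<-irrefl refl (<-≤-trans small (count-pos _ (q∈X _ _))))
    parts-isomorphic (suc j) {o} {c} {o′} {c′} V small τ with 2 ^ j ≤? count (inX t E o c)
    ... | no light = parts-isomorphic j V (≰⇒> light) (T-down 14 τ)
    ... | yes heavy = heavy-part _ V (λ h → h) heavy ≤-refl (T-down 2 (T-sub τ (0F ∷ 1F ∷ 0F ∷ 1F ∷ [])))
      where
      open Unique j {o} {c} {o′} {c′} V small using (same-X′; same-S′)
      -- The pebbles on the heavy child are placed anew relative to o and c, so that no rounds are lost along a chain of heavy parts.
      heavy-part : ∀ N {p q p′ q′} → Valid t E p q → (∀ {v} → v ∈ inX t E p q → v ∈ inX t E o c) → 2 ^ j ≤ count (inX t E p q) →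
        count (inX t E p q) ≤ N → T (12 + rounds j) E E′ (o ∷ c ∷ p ∷ q ∷ []) (o′ ∷ c′ ∷ p′ ∷ q′ ∷ []) → PartIso t E E′ p q p′ q′
      heavy-part zero V₁ sub heavy le σ = ⊥-elim (<-irrefl refl (<-≤-trans (count-pos _ (q∈X _ _)) le))
      heavy-part (suc N) {p} {q} {p′} {q′} V₁ sub heavy le σ = part-step (6 + rounds j) (≤-trans (rounds-base j) (m≤n+m _ 6)) V₁ σ oracle
        where
        oracle : Oracle (6 + rounds j) (≤-trans (rounds-base j) (m≤n+m _ 6)) o c p q o′ c′ p′ q′
        oracle {p₁} {q₁} {p₁′} {q₁′} ρ V₂ below with 2 ^ j ≤? count (inX t E p₁ q₁)
        ... | no light = parts-isomorphic j V₂ (≰⇒> light) (T-down 7 (T-sub ρ (0F ∷ 1F ∷ [])))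
        ... | yes heavy₁ =
          let p* , τ₁ = T-forth τ p₁
              q* , τ₂ = T-forth τ₁ q₁
              sub₁ = λ {v} (h : v ∈ inX t E p₁ q₁) → sub (proj₁ (below h))
              -- The vertex `q` belongs to `A` and so to no child.
              fewer = count-strict {P = inX t E p₁ q₁} {inX t E p q} (λ _ h → proj₁ (below h)) q (q∈X p q) (≢true⇒false λ h → clash (q∈A p q) (proj₂ (below h)))
              i = heavy-part N V₂ sub₁ heavy₁ (≤-pred (≤-trans fewer le)) (T-sub τ₂ (2F ∷ 3F ∷ 1F ∷ 0F ∷ []))
              τ* = T-down 7 (T-sub τ₂ (2F ∷ 3F ∷ 1F ∷ 0F ∷ []))
              ρ* = T-down 2 (T-sub ρ (2F ∷ 3F ∷ 0F ∷ 1F ∷ []))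
          -- The isomorphism found leads to the fresh answer `p*`, `q*`, but the caller fixed `p₁′`,
          -- `q₁′`. Both pairs define the same part.
          in retarget (same-X′ V₂ sub₁ heavy₁ τ* ρ*) (same-S′ V₂ sub₁ heavy₁ τ* ρ*) i

    -- Whole graphs

    open Components t big

    -- `suc t` rather than `t`, since the bound on sizes is strict while n may equal `2 ^ t`.
    top : ℕ
    top = game-length t (suc t)

    all-small : ∀ (P : Fin n → Bool) → count P < 2 ^ suc t
    all-small P = ≤-<-trans (≤-trans (count≤n P) big) (subst (2 ^ t <_) (cong (2 ^ t +_) (sym (+-identityʳ _))) (m<m+n _ (m^n>0 2 t)))

    conn-tr : ∀ {r x y x′ y′} → T (t + r) E E′ (x ∷ y ∷ []) (x′ ∷ y′ ∷ []) → conn E x y ≡ conn E′ x′ y′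
    conn-tr {x = x} {x′ = x′} τ = reach-tr {a = x} {x} {x} {x} {x′} {x′} {x′} {x′} (λ σ → T-edge σ 0F 1F ∧₂ refl) t
      (T-sub τ (0F ∷ 1F ∷ 0F ∷ 0F ∷ 0F ∷ 0F ∷ []))

    opaque
      root-iso : ∀ {x x′} → Simplicial x → T (4 + top) E E′ (x ∷ []) (x′ ∷ []) →
        Iso E E′ (rootX E x) (rootS E x) (rootX E′ x′) (rootS E′ x′)
      root-iso {x} {x′} simplicial τ = Star.star top (rounds-base (suc t))
        {x} {x} {x} {x} {x′} {x′} {x′} {x′}
        (root-config E simple x simplicial) (λ {s} {d} hs _ na → subst (λ z → E z d ≡ false) (==-elim hs) na)
        (λ v → root-apart E′ simple′ x′) (λ v → root-A⊆X E′ simple′ x′)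
        (λ σ → conn-tr {0} (T-lower (≤-trans (≤-reflexive (+-identityʳ t)) (n≤1+n t)) (T-sub σ (1F ∷ 0F ∷ []))) ∧₂ not₂ (T-same σ 1F 0F))
        (λ σ → T-same σ 1F 0F) (λ σ → T-edge σ 1F 0F)
        (T-sub τ (0F ∷ 0F ∷ 0F ∷ 0F ∷ []))
        (λ ρ V _ → parts-isomorphic (suc t) V (all-small _) (T-down 1 (T-sub ρ (0F ∷ 1F ∷ []))))

    open Blocks E E′ (conn E) (conn E′) (λ _ → tt) (λ _ → tt) (conn-equiv E simple) (conn-equiv E′ simple′)
    open IsEquiv (conn-equiv E simple) using (symm; class-≡)
    open IsEquiv (conn-equiv E′ simple′) using () renaming (symm to symm′; class-≡ to class-≡′)

    opaque
      -- One round moves from `v` to a simplicial vertex of its component, the root that chordality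
      -- provides.
      component-iso : ∀ {v v′} → T (5 + top) E E′ (v ∷ []) (v′ ∷ []) → BIso v v′
      component-iso {v} {v′} τ = from (simplicial-exists {t} big chordal v)
        where
        from : (∃ λ x → conn E v x ≡ true × Simplicial x) → BIso v v′
        from (x , vx , simplicial) = record
          { π = Iso.π i
          ; onB = λ y → trans (inside y) (trans (cong₂ _∨_ (Iso.onX i y) (Iso.onS i y)) (sym (inside′ (Iso.π i ⟨$⟩ʳ y))))
          ; edge = λ y z hy hz → Iso.edge i (trans (sym (inside y)) hy) (trans (sym (inside z)) hz)
          ; labs = λ _ _ → refl }
          where
          x-step : Σ (Fin n) λ x′ → T (4 + top) E E′ (x ∷ v ∷ []) (x′ ∷ v′ ∷ [])
          x-step = T-forth τ x
          x′ : Fin n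
          x′ = proj₁ x-step
          i : Iso E E′ (rootX E x) (rootS E x) (rootX E′ x′) (rootS E′ x′)
          i = root-iso simplicial (T-sub (proj₂ x-step) (0F ∷ []))
          vx′ : conn E′ v′ x′ ≡ true
          vx′ = trans (sym (conn-tr {0} (T-lower (≤-trans (≤-reflexive (+-identityʳ t)) (≤-trans (t≤rounds (suc t)) (m≤n+m top 4)))
                  (T-sub (proj₂ x-step) (1F ∷ 0F ∷ []))))) vx
          inside : ∀ y → conn E v y ≡ rootX E x y ∨ rootS E x y
          inside y = trans (class-≡ vx y) (root-cover E simple x y)
          inside′ : ∀ y → conn E′ v′ y ≡ rootX E′ x′ y ∨ rootS E′ x′ y
          inside′ y = trans (class-≡′ vx′ y) (root-cover E′ simple′ x′ y)

    from-glued : ∀ {f} → Glued (λ _ → true) (λ _ → true) f → Σ (Perm {n}) λ Φ → ∀ u w → E u w ≡ E′ (Φ ⟨$⟩ʳ u) (Φ ⟨$⟩ʳ w)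
    from-glued g = Φ , edge
      where
      open Glued g
      edge : ∀ u w → E u w ≡ E′ (Φ ⟨$⟩ʳ u) (Φ ⟨$⟩ʳ w)
      edge u w with split (conn E u w)
      ... | inj₁ h = edges u w refl h
      ... | inj₂ h = trans (≢true⇒false λ e → clash (conn-step E simple e) h)
                       (sym (≢true⇒false λ e → clash (conn-step E′ simple′ e) (trans (sym (blocks u w refl)) h)))

    opaque
      -- Components are blocks once more: the first round gives a bijection between vertices with
      -- isomorphic components, and `glue-blocks` makes it respect the components.
      isomorphic : ∀ {v v′} → T (6 + top) E E′ (v ∷ []) (v′ ∷ []) → Σ (Perm {n}) λ Φ → ∀ u w → E u w ≡ E′ (Φ ⟨$⟩ʳ u) (Φ ⟨$⟩ʳ w)
      isomorphic τ = let f , τf = T-ext τ in from-glued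
        (glue-blocks _ (λ _ → true) (λ _ → true) ≤-refl (λ _ _ → refl) (λ _ _ → refl) f
          ((λ _ → refl) , λ v _ → component-iso (T-sub (τf v) (0F ∷ []))))

-- The defining sentence

-- The competing structure may have loops or be directed; two rounds detect either.
simple-tr : ∀ {n d} {E E′ : Edges n} → Simple E → ∀ {v v′} → Tuples.T pebbles (2 + d) E E′ (v ∷ []) (v′ ∷ []) → Simple E′
simple-tr {n} {E = E} {E′} simple τ = record
  { sy = λ u v → iff-elim (fact₂-tr τ (λ σ → iff₂ (T-edge σ 1F 0F) (T-edge σ 0F 1F)) (λ u v → iff-intro (sy u v)) u v)
  ; irr = λ u → not-elim (fact-tr τ (λ σ → not₂ (T-edge σ 0F 0F)) (λ u → not-intro (irr u)) u) }
  where
  open Simple simple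
  open Tuples pebbles {n}

EQ-iso : ∀ {n k} r {E E′ : Edges n} (f : Perm {n}) → (∀ u v → E′ u v ≡ E (f ⟨$⟩ʳ u) (f ⟨$⟩ʳ v)) →
  {ρ σ : Fin k → Fin n} → (∀ x → ρ x ≡ f ⟨$⟩ʳ (σ x)) → EQ r E ρ E′ σ
EQ-iso zero {E} {E′} f h {ρ} {σ} c = atoms
  (λ x y → trans (cong₂ E (c x) (c y)) (sym (h _ _)))
  (λ x y → trans (cong₂ _==_ (c x) (c y)) (==-perm f _ _))
EQ-iso {n} {k} (suc r) {E} {E′} f h {ρ} {σ} c = EQ-iso zero f h c , λ x → Perm.flip f , λ v → EQ-iso r f h (follow x v)
  where
  follow : ∀ x v y → upd ρ x v y ≡ f ⟨$⟩ʳ (upd σ x (f ⟨$⟩ˡ v) y)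
  follow x v y with does (x ≟ y)
  ... | true  = sym (inverseʳ f)
  ... | false = c y

n≤2^⌈log2⌉ : ∀ n (rs : Acc _<_ n) → n ≤ 2 ^ ⌈log2⌉ n rs
n≤2^⌈log2⌉ 0             rs       = z≤n
n≤2^⌈log2⌉ 1             rs       = ≤-refl
n≤2^⌈log2⌉ (suc (suc n)) (acc rs) = begin
  2 + n                                   ≤⟨ +-monoʳ-≤ 2 half ⟩
  2 + (⌈ n /2⌉ + ⌈ n /2⌉)                 ≡⟨ cong suc (sym (+-suc ⌈ n /2⌉ ⌈ n /2⌉)) ⟩
  suc ⌈ n /2⌉ + suc ⌈ n /2⌉               ≤⟨ +-mono-≤ ih ih ⟩
  2 ^ m + 2 ^ m                           ≡⟨ cong (2 ^ m +_) (sym (+-identityʳ _)) ⟩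
  2 ^ m + (2 ^ m + 0)                     ∎
  where
  open ≤-Reasoning
  m = ⌈log2⌉ (suc ⌈ n /2⌉) (rs (⌈n/2⌉<n n))
  ih : suc ⌈ n /2⌉ ≤ 2 ^ m
  ih = n≤2^⌈log2⌉ (suc ⌈ n /2⌉) (rs (⌈n/2⌉<n n))
  half : n ≤ ⌈ n /2⌉ + ⌈ n /2⌉
  half = ≤-trans (≤-reflexive (sym (⌊n/2⌋+⌈n/2⌉≡n n))) (+-monoˡ-≤ ⌈ n /2⌉ (⌊n/2⌋≤⌈n/2⌉ n))

n≤2^⌈log₂n⌉ : ∀ n → n ≤ 2 ^ ⌈log₂ n ⌉
n≤2^⌈log₂n⌉ n = n≤2^⌈log2⌉ n (<-wellFounded n)

open Hintikka {11}

opaque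
  play-length : ℕ → ℕ
  play-length n = 6 + game-length ⌈log₂ n ⌉ (suc ⌈log₂ n ⌉)

  play-length-≡ : ∀ n → play-length n ≡ 6 + game-length ⌈log₂ n ⌉ (suc ⌈log₂ n ⌉)
  play-length-≡ n = refl

-- The summand 12 stems from the quantifiers of `close`, one for each pebble.
depth : ℕ → ℕ
depth n = 12 + play-length n

game-length-linear : ∀ t j → game-length t j ≡ 14 * j + (t + suc t)
game-length-linear t zero    = refl
game-length-linear t (suc j) = trans (cong (14 +_) (game-length-linear t j))
  (trans (sym (+-assoc 14 (14 * j) (t + suc t))) (cong (_+ (t + suc t)) (sym (*-suc 14 j))))

depth-log : IsOLog depth
-- With t the logarithm, the depth is 33 + 16 t. From n = 2 on t is at least 1, so 33 is at most 33
-- t, and 33 + 16 = 49.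
depth-log = 49 , 2 , λ n le → subst (λ r → 12 + r ≤ 49 * ⌈log₂ n ⌉) (sym (play-length-≡ n)) (bound ⌈log₂ n ⌉ (⌈log₂⌉-mono-≤ le))
  where
  open ≤-Reasoning
  bound : ∀ t → 1 ≤ t → 18 + game-length t (suc t) ≤ 49 * t
  bound t le = begin
    18 + game-length t (suc t)          ≡⟨ cong (18 +_) (game-length-linear t (suc t)) ⟩
    18 + (14 * suc t + (t + suc t))     ≡⟨ linear t ⟩
    33 * 1 + 16 * t                     ≤⟨ +-monoˡ-≤ (16 * t) (*-monoʳ-≤ 33 le) ⟩
    33 * t + 16 * t                     ≡⟨ sym (*-distribʳ-+ t 33 16) ⟩
    49 * t                              ∎
    where
    linear : ∀ t → 18 + (14 * suc t + (t + suc t)) ≡ 33 * 1 + 16 * t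
    linear = solve-∀

opaque
  -- All pebbles start on one vertex: the strategy takes no advantage of a particular initial
  -- position.
  game-type : ∀ {n} → Edges (suc n) → Formula pebbles
  game-type {n} E = Hin (play-length (suc n)) E (λ _ → zero)

  game-type-depth : ∀ {n} (E : Edges (suc n)) → qd (game-type E) ≤ play-length (suc n)
  game-type-depth {n} E = qd-Hin (play-length (suc n)) E (λ _ → zero)

  game-type-sound : ∀ {n} (E E′ : Edges (suc n)) σ → Val E′ (game-type E) σ ≡ true → EQ (play-length (suc n)) E (λ _ → zero) E′ σ
  game-type-sound {n} E E′ σ = Hin-sound (play-length (suc n)) E (λ _ → zero) E′ σ

  game-type-complete : ∀ {n} (E E′ : Edges (suc n)) σ → EQ (play-length (suc n)) E (λ _ → zero) E′ σ → Val E′ (game-type E) σ ≡ true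
  game-type-complete {n} E E′ σ = Hin-complete (play-length (suc n)) E (λ _ → zero) E′ σ

-- The empty graph has no vertex to carry pebbles, but its order determines it.
describe : ∀ {n} → Edges n → Formula pebbles
describe {zero}  E = closed-true
describe {suc n} E = close (game-type E)

-- The game compares two edge relations on the same `Fin n`; the first conjunct forces the other
-- graph to have this order.
sentence : ∀ {n} → Edges n → Formula pebbles
sentence {n} E = conj (exactly n zero (truth zero)) (describe E)

sentence-closed : ∀ {n} (E : Edges n) → Sentence (sentence E)
sentence-closed {n} E z = cong₂ _∨_ (order-closed z) (describe-closed E z)
  where
  order-closed : ∀ z → free (exactly n zero (truth zero)) z ≡ false
  order-closed zero    = refl
  order-closed (suc z) = refl
  describe-closed : ∀ {m} (E : Edges m) z → free (describe E) z ≡ false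
  describe-closed {zero}  E zero    = refl
  describe-closed {zero}  E (suc z) = refl
  describe-closed {suc m} E z = free-close (game-type E) z

sentence-depth : ∀ {n} (E : Edges n) → qd (sentence E) ≤ depth n
sentence-depth {n} E = ⊔-lub (s≤s z≤n) (describe-depth E)
  where
  describe-depth : ∀ {m} (E : Edges m) → qd (describe E) ≤ depth m
  describe-depth {zero}  E = s≤s z≤n
  describe-depth {suc m} E = ≤-trans (≤-reflexive (qd-close (game-type E))) (+-monoʳ-≤ 12 (game-type-depth E))

order-≡ : ∀ n (H : Graph) ρ → eval H (exactly n zero (truth zero)) ρ ≡ true → order H ≡ n
order-≡ n H ρ h = trans (sym (count-ones (order H)))
  (trans (count-cong λ v → sym (truth-true H zero (update {G = H} ρ zero v))) (exactly-elim H n zero (truth zero) ρ h))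

order-true : ∀ (H : Graph) ρ → eval H (exactly (order H) zero (truth zero)) ρ ≡ true
order-true H ρ = exactly-intro H (order H) zero (truth zero) ρ
  (trans (count-cong λ v → truth-true H zero (update {G = H} ρ zero v)) (count-ones (order H)))

no-claw : ∀ {n} (E : Edges n) → Simple E → ClawFree ⟦ E ⟧ → NoClaw E
no-claw E simple cf {z} {a} {b} {d} za zb zd ab ad bd eab ead ebd = cf (z , a , b , d ,
  (adj-≢ za , adj-≢ zb , adj-≢ zd , ab , ad , bd) ,
  (za , zb , zd , adj-sym za , adj-sym zb , adj-sym zd) ,
  (eab , trans (sy b a) eab , ead , trans (sy d a) ead , ebd , trans (sy d b) ebd))
  where
  open Simple simple
  open Paths E sy irr

-- Reindexing by the constant map gathers all pebbles on the position of pebble `zero`, whatever the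
-- witness `σ` does with the others.
constant-pebbles : ∀ {n} r {E E′ : Edges n} {k} {v} (σ : Fin (suc k) → Fin n) → EQ {k = suc k} r E (λ _ → v) E′ σ →
  Tuples.T (suc k) r E E′ (v ∷ []) (σ zero ∷ [])
constant-pebbles r {v = v} σ e .Tuples.game g = EQ-≗ r (λ x → sym (by (g x))) (λ x → sym (by (g x))) (EQ-reindex r e (λ _ → zero))
  where
  by : ∀ {A : Set} {a : A} (i : Fin 1) → Data.Vec.lookup (a ∷ []) i ≡ a
  by zero = refl

game-decides : ∀ {n} t → n ≤ 2 ^ t → (E E′ : Edges n) → Simple E → NoClaw E → Chordal ⟦ E ⟧ → ∀ {v v′} →
  Tuples.T pebbles (6 + game-length t (suc t)) E E′ (v ∷ []) (v′ ∷ []) → ⟦ E′ ⟧ ≅ ⟦ E ⟧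
game-decides t big E E′ simple claw chordal τ = turn (Main.Against.isomorphic t big E simple claw chordal E′ (simple-tr {d = 4 + game-length t (suc t)} simple τ) τ)
  where
  turn : (Σ Perm λ Φ → ∀ u w → E u w ≡ E′ (Φ ⟨$⟩ʳ u) (Φ ⟨$⟩ʳ w)) → ⟦ E′ ⟧ ≅ ⟦ E ⟧
  turn (Φ , e) = Perm.flip Φ , λ u v → trans (cong₂ E′ (sym (inverseʳ Φ)) (sym (inverseʳ Φ))) (sym (e _ _))

describe-sound : ∀ {n} (E E′ : Edges n) → Simple E → NoClaw E → Chordal ⟦ E ⟧ →
  ⟦ E′ ⟧ ⊨ describe E → ⟦ E′ ⟧ ≅ ⟦ E ⟧
describe-sound {zero}  E E′ simple claw chordal h = Perm.id , λ ()
describe-sound {suc n} E E′ simple claw chordal h = play (close-elim E′ (game-type E) (emptyAssignment {G = ⟦ E′ ⟧}) h)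
  where
  t = ⌈log₂ suc n ⌉
  play : (Σ (Fin pebbles → Fin (suc n)) λ σ → Val E′ (game-type E) σ ≡ true) → ⟦ E′ ⟧ ≅ ⟦ E ⟧
  play (σ , v) = game-decides t (n≤2^⌈log₂n⌉ (suc n)) E E′ simple claw chordal
    (subst (λ r → Tuples.T pebbles r E E′ (zero ∷ []) (σ zero ∷ [])) (play-length-≡ (suc n))
      (constant-pebbles (play-length (suc n)) σ (game-type-sound E E′ σ v)))

describe-complete : ∀ {n} (E E′ : Edges n) → ⟦ E′ ⟧ ≅ ⟦ E ⟧ → ⟦ E′ ⟧ ⊨ describe E
describe-complete {zero}  E E′ (f , h) = refl
describe-complete {suc n} E E′ (f , h) = close-intro E′ (game-type E) (emptyAssignment {G = ⟦ E′ ⟧}) (λ _ → Inverse.from f zero)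
  (game-type-complete E E′ _ (EQ-iso (play-length (suc n)) f h (λ _ → sym (inverseʳ f))))

sentence-sound : ∀ {n} (E : Edges n) → Simple E → NoClaw E → Chordal ⟦ E ⟧ →
  ∀ H → H ⊨ sentence E → H ≅ ⟦ E ⟧
sentence-sound {n} E simple claw chordal H h = finish H (order-≡ n H (emptyAssignment {G = H}) (proj₁ parts)) (proj₂ parts)
  where
  parts : eval H (exactly n zero (truth zero)) (emptyAssignment {G = H}) ≡ true × H ⊨ describe E
  parts = ∧-elim {eval H (exactly n zero (truth zero)) (emptyAssignment {G = H})} {eval H (describe E) (emptyAssignment {G = H})} h
  finish : ∀ H → order H ≡ n → H ⊨ describe E → H ≅ ⟦ E ⟧
  finish record { order = .n ; E = E′ } refl d = describe-sound E E′ simple claw chordal d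

sentence-complete : ∀ {n} (E : Edges n) H → H ≅ ⟦ E ⟧ → H ⊨ sentence E
sentence-complete {n} E H (f , h) = finish H (↔⇒≡ f) (f , h)
  where
  finish : ∀ H → order H ≡ n → H ≅ ⟦ E ⟧ → H ⊨ sentence E
  finish record { order = .n ; E = E′ } refl i = ∧-intro (order-true ⟦ E′ ⟧ (emptyAssignment {G = ⟦ E′ ⟧})) (describe-complete E E′ i)

theorem3 : Σ ℕ λ k → Σ (ℕ → ℕ) λ f → IsOLog f ×
    ((n : ℕ) (G : Graph) → order G ≡ n →
    Undirected G → Chordal G → ClawFree G →
    Σ (Formula k) λ Φ → Sentence Φ × qd Φ ≤ f n ×
    ((H : Graph) → (H ⊨ Φ → H ≅ G) × (H ≅ G → H ⊨ Φ)))
theorem3 = pebbles , depth , depth-log , λ { n record { order = .n ; E = E } refl (sy , irr) chordal claw-free →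
  let simple = record { sy = sy ; irr = irr } in
  sentence E , sentence-closed E , sentence-depth E ,
  λ H → sentence-sound E simple (no-claw E simple claw-free) chordal H , sentence-complete E H }
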